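{- (a) For the Hamming graph $H(q,n)$ we have $c_2(H(q,n)) = \sqrt{n}$. (b) For the Johnson graph $J(v,n)$ we have $c_2(J(v,n)) = \sqrt{n}$. (c) For a strongly regular graph $G$ of diameter $2$ with parameters $(\nu,k,\lambda,\mu)$ we have \[ c_2(G) = \sqrt{\frac{4(\nu-k-1)(k-r)}{k(\nu-k+r)}}, \qquad \text{where } r = \tfrac12\big(\lambda-\mu+\sqrt{\nu}\big). \]
   Context: Graphs are finite and undirected, with edges being two-element subsets of the vertex set. For a connected graph with vertex set $V$, $d(x,y)$ denotes the length of a shortest path between $x$ and $y$, and the diameter is $\max_{x,y\in V} d(x,y)$; $(V,d)$ is a finite metric space. Distortion: for a finite metric space $(X,d)$ with $N$ elements, an embedding $\varrho : X \to \mathbb{R}^N$ (Euclidean norm $\|\cdot\|$) has distortion $D$ if $d(x,y) \le \|\varrho(x)-\varrho(y)\| \le D\, d(x,y)$ for all $x,y\in X$. The least distortion $c_2(X,d)$ is the least $D$ for which such an embedding exists. For a connected graph $G$ with shortest path metric $d$, $c_2(G) := c_2(V,d)$. Hamming graph $H(q,n)$: for a finite set $X$ of cardinality $q \ge 2$, the vertex set is $X^n$, the set of all vectors of length $n$, and two vertices are adjacent if they differ in exactly one coordinate. Johnson graph $J(v,n)$: for a set $V$ of size $v$ and an integer $n$ with $v \ge 2n$, the vertex set is the set of all $n$-element subsets of $V$, and two vertices $x,y$ are adjacent if $|x\cap y| = n-1$. Strongly regular graph with parameters $(\nu,k,\lambda,\mu)$: a graph with $\nu$ vertices in which every vertex is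 adjacent to $k$ vertices, every pair of adjacent vertices has precisely $\lambda$ common neighbors, and every pair of (distinct) nonadjacent vertices has precisely $\mu$ common neighbors.
   Formalization: In (c), r is ½(λ−μ+√Δ) with Δ = (λ−μ)²+4(k−μ), not ½(λ−μ+√ν): the printed formula fails for the Petersen graph (10,3,0,1), giving c₂² ≈ 1.90 where the true value is 2; the two agree when ν = Δ. -}

module Defs where

open import Data.Fin using (Fin; zero; suc)
open import Data.Fin.Properties as Fin using (*↔×; +↔⊎; any?; all?)
open import Data.Fin.Subset as Subset using (Subset; inside; outside; _∩_)
open import Data.Fin.Subset.Properties using (∩-comm; ∩-idem)
open import Data.Integer as ℤ using (ℤ; +_; +[1+_]; -[1+_])
import Data.Integer.Properties as ℤ
open import Data.List using (List; allFin; filter; length; map)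
open import Data.Nat as ℕ using (ℕ; zero; suc)
open import Data.Nat.Combinatorics
  using (_C_; nCn≡1; k>n⇒nCk≡0; nCk≡nC[n∸k]; nCk+nC[k+1]≡[n+1]C[k+1])
import Data.Nat.Properties as ℕ
open import Data.Product using (Σ; Σ-syntax; ∃; ∃-syntax; _×_; _,_; proj₁; proj₂)
open import Data.Rational as ℚ
  using (ℚ; mkℚ; 0ℚ; 1ℚ; ½; _+_; _-_; -_; _*_; _≤_; _<_; _⊔_; ∣_∣; 1/_; NonNegative)
import Data.Rational.Properties as ℚ
open import Data.Rational.Solver using (module +-*-Solver)
import Data.Rational.Unnormalised as ℚᵘ
import Data.Rational.Unnormalised.Properties as ℚᵘ
open import Data.Sum using (_⊎_; inj₁; inj₂)
open import Data.Vec using (Vec; []; _∷_; lookup)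
open import Data.Vec.Functional using (Vector; foldr)
open import Function using (_∘_; _↔_; mk↔ₛ′; Inverse)
open import Function.Construct.Composition using (_↔-∘_)
open import Relation.Binary.PropositionalEquality
  using (_≡_; _≢_; refl; sym; trans; cong; cong₂; subst; subst₂)
open import Relation.Nullary using (¬_; Dec; yes; no; ¬?; _×-dec_; _→-dec_)
open import Relation.Unary using (Pred; Decidable)
open import Level using (0ℓ)

open +-*-Solver using (solve; _:+_; _:*_; _:-_; :-_; _:=_)

------------------------------------------------------------------------
-- Rational estimates

-- The ring solver is only run on variables: instantiating its proofs by
-- larger terms makes type checking very slow.

ring-flip : ∀ a b → b - a ≡ - (a - b)
ring-flip = solve 2 (λ a b → b :- a := :- (a :- b)) refl

ring-neg : ∀ a b → - (a - b) ≡ - a - - b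
ring-neg = solve 2 (λ a b → :- (a :- b) := :- a :- :- b) refl

ring-cancel : ∀ a b → a + (b - a) ≡ b
ring-cancel = solve 2 (λ a b → a :+ (b :- a) := b) refl

ring-add : ∀ a b e → a + e + (b + e) ≡ a + b + (e + e)
ring-add = solve 3 (λ a b e → a :+ e :+ (b :+ e) := a :+ b :+ (e :+ e)) refl

ring-share : ∀ a b e r → a * (e * r) + e * r * b ≡ e * ((a + b) * r)
ring-share = solve 4 (λ a b e r → a :* (e :* r) :+ e :* r :* b := e :* ((a :+ b) :* r)) refl

ring-mul : ∀ a b c d → a * b - c * d ≡ a * (b - d) + (a - c) * d
ring-mul = solve 4 (λ a b c d → a :* b :- c :* d := a :* (b :- d) :+ (a :- c) :* d) refl

ring-swap : ∀ a b c → a * (b * c) ≡ b * a * c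
ring-swap = solve 3 (λ a b c → a :* (b :* c) := b :* a :* c) refl

ring-inv : ∀ a t h b → a * ((t + h) * b) ≡ t * a * b + h * (a * b)
ring-inv = solve 4 (λ a t h b → a :* ((t :+ h) :* b) := t :* a :* b :+ h :* (a :* b)) refl

ring-pair : ∀ a b c → a * (b * b) * (c * c) ≡ a * ((b * c) * (b * c))
ring-pair = solve 3 (λ a b c → a :* (b :* b) :* (c :* c) := a :* ((b :* c) :* (b :* c))) refl

ring-square : ∀ a b → a * a + b * b + (a * b + a * b) ≡ (a + b) * (a + b)
ring-square = solve 2 (λ a b → a :* a :+ b :* b :+ (a :* b :+ a :* b) := (a :+ b) :* (a :+ b)) refl

∣∣≤ : ∀ {p ε} → p ≤ ε → - p ≤ ε → ∣ p ∣ ≤ ε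
∣∣≤ {p} p≤ε -p≤ε with ℚ.∣p∣≡p∨∣p∣≡-p p
... | inj₁ e = subst (_≤ _) (sym e) p≤ε
... | inj₂ e = subst (_≤ _) (sym e) -p≤ε

p≤∣p∣ : ∀ p → p ≤ ∣ p ∣
p≤∣p∣ p with ℚ.≤-total 0ℚ p
... | inj₁ 0≤p = ℚ.≤-reflexive (sym (ℚ.0≤p⇒∣p∣≡p 0≤p))
... | inj₂ p≤0 = ℚ.≤-trans p≤0 (ℚ.0≤∣p∣ p)

p-q≤r⇒p≤q+r : ∀ {p q r} → p - q ≤ r → p ≤ q + r
p-q≤r⇒p≤q+r {p} {q} {r} le =
  subst (_≤ q + r) (ring-cancel q p) (ℚ.+-monoʳ-≤ q le)

p≤q+r⇒p-q≤r : ∀ {p q r} → p ≤ q + r → p - q ≤ r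
p≤q+r⇒p-q≤r {p} {q} {r} le =
  subst (p - q ≤_) (trans (ℚ.+-assoc q r (- q)) (ring-cancel q r)) (ℚ.+-monoˡ-≤ (- q) le)

*-mono-≤ : ∀ {p q r s} → 0ℚ ≤ p → 0ℚ ≤ s → p ≤ q → r ≤ s → p * r ≤ q * s
*-mono-≤ {p} {q} {r} {s} 0≤p 0≤s p≤q r≤s = ℚ.≤-trans
  (ℚ.*-monoˡ-≤-nonNeg p {{ℚ.nonNegative 0≤p}} r≤s)
  (ℚ.*-monoʳ-≤-nonNeg s {{ℚ.nonNegative 0≤s}} p≤q)

0<* : ∀ {p q} → 0ℚ < p → 0ℚ < q → 0ℚ < p * q
0<* {p} {q} 0<p 0<q =
  ℚ.positive⁻¹ (p * q) {{ℚ.pos*pos⇒pos p {{ℚ.positive 0<p}} q {{ℚ.positive 0<q}}}}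

0≤* : ∀ {p q} → 0ℚ ≤ p → 0ℚ ≤ q → 0ℚ ≤ p * q
0≤* {p} {q} 0≤p 0≤q = subst (_≤ p * q) (ℚ.*-zeroˡ q)
  (ℚ.*-monoʳ-≤-nonNeg q {{ℚ.nonNegative 0≤q}} 0≤p)

p≤p+q : ∀ {p q} → 0ℚ ≤ q → p ≤ p + q
p≤p+q {p} {q} 0≤q = subst (_≤ p + q) (ℚ.+-identityʳ p) (ℚ.+-monoʳ-≤ p 0≤q)

recip : ∀ p → 0ℚ < p → ℚ
recip p 0<p = (1/ p) {{ℚ.>-nonZero 0<p}}

0<recip : ∀ p 0<p → 0ℚ < recip p 0<p
0<recip p@(mkℚ +[1+ _ ] _ _) 0<p = ℚ.positive⁻¹ (recip p 0<p)
0<recip (mkℚ (+ zero) _ _) (ℚ.*<* (ℤ.+<+ ()))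
0<recip (mkℚ -[1+ _ ] _ _) (ℚ.*<* ())

*-recip : ∀ p 0<p → p * recip p 0<p ≡ 1ℚ
*-recip p 0<p = ℚ.*-inverseʳ p {{ℚ.>-nonZero 0<p}}

0<1 : 0ℚ < 1ℚ
0<1 = ℚ.positive⁻¹ 1ℚ

0<½* : ∀ ε → 0ℚ < ε → 0ℚ < ½ * ε
0<½* ε = 0<* {½} {ε} (ℚ.positive⁻¹ ½)

½+½ : ∀ ε → ½ * ε + ½ * ε ≡ ε
½+½ ε = trans (sym (ℚ.*-distribʳ-+ ε ½ ½)) (ℚ.*-identityˡ ε)

------------------------------------------------------------------------
-- Real numbers, as Cauchy sequences of rationals with a modulus

IsCauchy : (ℕ → ℚ) → Set
IsCauchy x = ∀ ε → 0ℚ < ε → ∃[ N ] ∀ m n → N ℕ.≤ m → N ℕ.≤ n → ∣ x m - x n ∣ ≤ ε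

record ℝ : Set where
  constructor _,_
  field
    seq    : ℕ → ℚ
    cauchy : IsCauchy seq

open ℝ public

one-sided⇒cauchy : ∀ x →
  (∀ ε → 0ℚ < ε → ∃[ N ] ∀ m n → N ℕ.≤ m → N ℕ.≤ n → x m ≤ x n + ε) → IsCauchy x
one-sided⇒cauchy x h ε 0<ε with h ε 0<ε
... | N , b = N , λ m n N≤m N≤n → ∣∣≤
  (p≤q+r⇒p-q≤r (b m n N≤m N≤n))
  (subst (_≤ ε) (ring-flip (x m) (x n))
    (p≤q+r⇒p-q≤r (b n m N≤n N≤m)))

cauchy⇒one-sided : ∀ x → IsCauchy x →
  ∀ ε → 0ℚ < ε → ∃[ N ] ∀ m n → N ℕ.≤ m → N ℕ.≤ n → x m ≤ x n + ε
cauchy⇒one-sided x c ε 0<ε with c ε 0<ε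
... | N , b = N , λ m n N≤m N≤n →
  p-q≤r⇒p≤q+r (ℚ.≤-trans (p≤∣p∣ _) (b m n N≤m N≤n))

infix 4 _≤ᴿ_ _<ᴿ_ _≃ᴿ_

_≤ᴿ_ _<ᴿ_ _≃ᴿ_ : ℝ → ℝ → Set
x ≤ᴿ y = ∀ ε → 0ℚ < ε → ∃[ N ] ∀ n → N ℕ.≤ n → seq x n ≤ seq y n + ε
x <ᴿ y = Σ[ ε ∈ ℚ ] 0ℚ < ε × ∃[ N ] ∀ n → N ℕ.≤ n → seq x n + ε ≤ seq y n
x ≃ᴿ y = x ≤ᴿ y × y ≤ᴿ x

fromℚ : ℚ → ℝ
fromℚ q = (λ _ → q) , one-sided⇒cauchy (λ _ → q) λ ε 0<ε → 0 , λ _ _ _ _ → p≤p+q (ℚ.<⇒≤ 0<ε)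

fromℕ : ℕ → ℝ
fromℕ n = fromℚ (+ n ℚ./ 1)

0ᴿ : ℝ
0ᴿ = fromℕ 0

infix  8 -ᴿ_
infixl 7 _*ᴿ_
infixl 6 _+ᴿ_ _-ᴿ_

_+ᴿ_ : ℝ → ℝ → ℝ
(x , cx) +ᴿ (y , cy) = (λ n → x n + y n) , one-sided⇒cauchy _ go
  where
  go : ∀ ε → 0ℚ < ε →
    ∃[ N ] ∀ m n → N ℕ.≤ m → N ℕ.≤ n → x m + y m ≤ x n + y n + ε
  go ε 0<ε = M ℕ.⊔ N , λ m n M⊔N≤m M⊔N≤n → begin
    x m + y m
      ≤⟨ ℚ.+-mono-≤
           (proj₂ bx m n (ℕ.m⊔n≤o⇒m≤o M N M⊔N≤m) (ℕ.m⊔n≤o⇒m≤o M N M⊔N≤n))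
           (proj₂ by m n (ℕ.m⊔n≤o⇒n≤o M N M⊔N≤m) (ℕ.m⊔n≤o⇒n≤o M N M⊔N≤n)) ⟩
    (x n + δ) + (y n + δ)
      ≡⟨ ring-add (x n) (y n) δ ⟩
    x n + y n + (δ + δ)
      ≡⟨ cong (_+_ (x n + y n)) (½+½ ε) ⟩
    x n + y n + ε ∎
    where
    open ℚ.≤-Reasoning
    δ : ℚ
    δ = ½ * ε
    bx = cauchy⇒one-sided x cx δ (0<½* ε 0<ε)
    by = cauchy⇒one-sided y cy δ (0<½* ε 0<ε)
    M N : ℕ
    M = proj₁ bx
    N = proj₁ by

-ᴿ_ : ℝ → ℝ
-ᴿ (x , cx) = (λ n → - x n) , λ ε 0<ε → let N , b = cx ε 0<ε in
  N , λ m n N≤m N≤n → subst (_≤ ε)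
    (trans (sym (ℚ.∣-p∣≡∣p∣ (x m - x n)))
      (cong ∣_∣ (ring-neg (x m) (x n))))
    (b m n N≤m N≤n)

_-ᴿ_ : ℝ → ℝ → ℝ
x -ᴿ y = x +ᴿ -ᴿ y

eventually-bounded : ∀ x → IsCauchy x →
  Σ[ B ∈ ℚ ] 0ℚ < B × ∃[ N ] ∀ n → N ℕ.≤ n → ∣ x n ∣ ≤ B
eventually-bounded x c with c 1ℚ 0<1
... | N , b = ∣ x N ∣ + 1ℚ
  , ℚ.<-≤-trans 0<1 (subst (_≤ ∣ x N ∣ + 1ℚ) (ℚ.+-identityˡ 1ℚ) (ℚ.+-monoˡ-≤ 1ℚ (ℚ.0≤∣p∣ (x N))))
  , N , λ n N≤n → ℚ.≤-trans
    (subst (_≤ ∣ x N ∣ + ∣ x n - x N ∣)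
      (cong ∣_∣ (ring-cancel (x N) (x n)))
      (ℚ.∣p+q∣≤∣p∣+∣q∣ (x N) (x n - x N)))
    (ℚ.+-monoʳ-≤ ∣ x N ∣ (b n N N≤n ℕ.≤-refl))

product-estimate : ∀ {a b c d A B δ} → 0ℚ ≤ δ → 0ℚ ≤ B → ∣ a ∣ ≤ A → ∣ d ∣ ≤ B →
  ∣ b - d ∣ ≤ δ → ∣ a - c ∣ ≤ δ → ∣ a * b - c * d ∣ ≤ A * δ + δ * B
product-estimate {a} {b} {c} {d} {A} {B} {δ} 0≤δ 0≤B a≤A d≤B b-d≤δ a-c≤δ = begin
  ∣ a * b - c * d ∣                    ≡⟨ cong ∣_∣ (ring-mul a b c d) ⟩
  ∣ a * (b - d) + (a - c) * d ∣        ≤⟨ ℚ.∣p+q∣≤∣p∣+∣q∣ (a * (b - d)) ((a - c) * d) ⟩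
  ∣ a * (b - d) ∣ + ∣ (a - c) * d ∣    ≡⟨ cong₂ _+_ (ℚ.∣p*q∣≡∣p∣*∣q∣ a (b - d)) (ℚ.∣p*q∣≡∣p∣*∣q∣ (a - c) d) ⟩
  ∣ a ∣ * ∣ b - d ∣ + ∣ a - c ∣ * ∣ d ∣
    ≤⟨ ℚ.+-mono-≤
         (*-mono-≤ {∣ a ∣} {A} {∣ b - d ∣} {δ} (ℚ.0≤∣p∣ a) 0≤δ a≤A b-d≤δ)
         (*-mono-≤ {∣ a - c ∣} {δ} {∣ d ∣} {B} (ℚ.0≤∣p∣ (a - c)) 0≤B a-c≤δ d≤B) ⟩
  A * δ + δ * B                        ∎
  where open ℚ.≤-Reasoning

share : ∀ {A B ε} → 0ℚ < A → 0ℚ < B → 0ℚ < ε → Σ[ δ ∈ ℚ ] 0ℚ < δ × A * δ + δ * B ≡ ε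
share {A} {B} {ε} 0<A 0<B 0<ε = ε * r , 0<* 0<ε (0<recip (A + B) 0<A+B) ,
  trans (ring-share A B ε r) (trans (cong (ε *_) (*-recip (A + B) 0<A+B)) (ℚ.*-identityʳ ε))
  where
  0<A+B : 0ℚ < A + B
  0<A+B = ℚ.+-mono-< 0<A 0<B
  r : ℚ
  r = recip (A + B) 0<A+B

*-cauchy : ∀ x y → IsCauchy x → IsCauchy y → IsCauchy (λ n → x n * y n)
*-cauchy x y cx cy ε 0<ε = go (eventually-bounded x cx) (eventually-bounded y cy)
  where
  Bounded : (ℕ → ℚ) → Set
  Bounded z = Σ[ B ∈ ℚ ] 0ℚ < B × ∃[ N ] ∀ n → N ℕ.≤ n → ∣ z n ∣ ≤ B
  Close : (ℕ → ℚ) → ℚ → Set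
  Close z δ = ∃[ N ] ∀ m n → N ℕ.≤ m → N ℕ.≤ n → ∣ z m - z n ∣ ≤ δ
  close : ∀ {A B δ} → 0ℚ < B → 0ℚ < δ → A * δ + δ * B ≡ ε →
    (∃[ K ] ∀ n → K ℕ.≤ n → ∣ x n ∣ ≤ A) → (∃[ L ] ∀ n → L ℕ.≤ n → ∣ y n ∣ ≤ B) →
    Close x δ → Close y δ → Close (λ n → x n * y n) ε
  close 0<B 0<δ eq (K , bA) (L , bB) (M , ux) (N , uy) =
    (K ℕ.⊔ L) ℕ.⊔ (M ℕ.⊔ N) , λ m n ≤m ≤n → subst (∣ x m * y m - x n * y n ∣ ≤_) eq
      (product-estimate (ℚ.<⇒≤ 0<δ) (ℚ.<⇒≤ 0<B)
        (bA m (ℕ.m⊔n≤o⇒m≤o K L (ℕ.m⊔n≤o⇒m≤o _ (M ℕ.⊔ N) ≤m)))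
        (bB n (ℕ.m⊔n≤o⇒n≤o K L (ℕ.m⊔n≤o⇒m≤o _ (M ℕ.⊔ N) ≤n)))
        (uy m n (ℕ.m⊔n≤o⇒n≤o M N (ℕ.m⊔n≤o⇒n≤o (K ℕ.⊔ L) _ ≤m))
                (ℕ.m⊔n≤o⇒n≤o M N (ℕ.m⊔n≤o⇒n≤o (K ℕ.⊔ L) _ ≤n)))
        (ux m n (ℕ.m⊔n≤o⇒m≤o M N (ℕ.m⊔n≤o⇒n≤o (K ℕ.⊔ L) _ ≤m))
                (ℕ.m⊔n≤o⇒m≤o M N (ℕ.m⊔n≤o⇒n≤o (K ℕ.⊔ L) _ ≤n))))
  go : Bounded x → Bounded y → Close (λ n → x n * y n) ε
  go (A , 0<A , bA) (B , 0<B , bB) = let δ , 0<δ , eq = share 0<A 0<B 0<ε in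
    close 0<B 0<δ eq bA bB (cx δ 0<δ) (cy δ 0<δ)

_*ᴿ_ : ℝ → ℝ → ℝ
(x , cx) *ᴿ (y , cy) = (λ n → x n * y n) , *-cauchy x y cx cy

-- If y is bounded below by e > 0 from some index on, truncating y at e from
-- below changes only finitely many terms, and makes all of them invertible.
inv : (y : ℝ) → 0ᴿ <ᴿ y → ℝ
inv (y , cy) (e , 0<e , _) = z , one-sided⇒cauchy z go
  where
  t : ℕ → ℚ
  t n = y n ⊔ e
  0<t : ∀ n → 0ℚ < t n
  0<t n = ℚ.<-≤-trans 0<e (ℚ.p≤q⊔p (y n) e)
  z : ℕ → ℚ
  z n = recip (t n) (0<t n)
  i : ℚ
  i = recip e 0<e
  z≤i : ∀ n → z n ≤ i
  z≤i n = begin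
    z n               ≡⟨ sym (ℚ.*-identityʳ (z n)) ⟩
    z n * 1ℚ          ≡⟨ cong (z n *_) (sym (*-recip e 0<e)) ⟩
    z n * (e * i)     ≤⟨ ℚ.*-monoˡ-≤-nonNeg (z n) {{ℚ.nonNegative (ℚ.<⇒≤ (0<recip _ (0<t n)))}}
                           (ℚ.*-monoʳ-≤-nonNeg i {{ℚ.nonNegative (ℚ.<⇒≤ (0<recip e 0<e))}}
                             (ℚ.p≤q⊔p (y n) e)) ⟩
    z n * (t n * i)   ≡⟨ ring-swap (z n) (t n) i ⟩
    t n * z n * i     ≡⟨ cong (_* i) (*-recip (t n) (0<t n)) ⟩
    1ℚ * i            ≡⟨ ℚ.*-identityˡ i ⟩
    i                 ∎
    where open ℚ.≤-Reasoning
  go : ∀ ε → 0ℚ < ε → ∃[ N ] ∀ m n → N ℕ.≤ m → N ℕ.≤ n → z m ≤ z n + ε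
  go ε 0<ε = N , est
    where
    η : ℚ
    η = ε * (e * e)
    0<η : 0ℚ < η
    0<η = 0<* 0<ε (0<* 0<e 0<e)
    N : ℕ
    N = proj₁ (cauchy⇒one-sided y cy η 0<η)
    b : ∀ m n → N ℕ.≤ m → N ℕ.≤ n → y m ≤ y n + η
    b = proj₂ (cauchy⇒one-sided y cy η 0<η)
    t≤ : ∀ m n → N ℕ.≤ m → N ℕ.≤ n → t n ≤ t m + η
    t≤ m n N≤m N≤n = ℚ.⊔-lub
      (ℚ.≤-trans (b n m N≤n N≤m) (ℚ.+-monoˡ-≤ η (ℚ.p≤p⊔q (y m) e)))
      (ℚ.≤-trans (ℚ.p≤q⊔p (y m) e) (p≤p+q (ℚ.<⇒≤ 0<η)))
    est : ∀ m n → N ℕ.≤ m → N ℕ.≤ n → z m ≤ z n + ε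
    est m n N≤m N≤n = begin
      z m
        ≡⟨ sym (ℚ.*-identityʳ (z m)) ⟩
      z m * 1ℚ
        ≡⟨ cong (z m *_) (sym (*-recip (t n) (0<t n))) ⟩
      z m * (t n * z n)
        ≤⟨ ℚ.*-monoˡ-≤-nonNeg (z m) {{nn m}} (ℚ.*-monoʳ-≤-nonNeg (z n) {{nn n}} (t≤ m n N≤m N≤n)) ⟩
      z m * ((t m + η) * z n)
        ≡⟨ ring-inv (z m) (t m) η (z n) ⟩
      t m * z m * z n + η * (z m * z n)
        ≡⟨ cong (λ u → u * z n + η * (z m * z n)) (*-recip (t m) (0<t m)) ⟩
      1ℚ * z n + η * (z m * z n)
        ≡⟨ cong (_+ η * (z m * z n)) (ℚ.*-identityˡ (z n)) ⟩
      z n + η * (z m * z n)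
        ≤⟨ ℚ.+-monoʳ-≤ (z n) (ℚ.*-monoˡ-≤-nonNeg η {{ℚ.nonNegative (ℚ.<⇒≤ 0<η)}}
             (*-mono-≤ (ℚ.<⇒≤ (0<recip _ (0<t m))) (ℚ.<⇒≤ (0<recip e 0<e)) (z≤i m) (z≤i n))) ⟩
      z n + η * (i * i)
        ≡⟨ cong (_+_ (z n)) (ring-pair ε e i) ⟩
      z n + ε * ((e * i) * (e * i))
        ≡⟨ cong (λ u → z n + ε * (u * u)) (*-recip e 0<e) ⟩
      z n + ε * (1ℚ * 1ℚ)
        ≡⟨ cong (_+_ (z n)) (ℚ.*-identityʳ ε) ⟩
      z n + ε ∎
      where
      open ℚ.≤-Reasoning
      nn : ∀ k → NonNegative (z k)
      nn k = ℚ.nonNegative (ℚ.<⇒≤ (0<recip _ (0<t k)))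

------------------------------------------------------------------------
-- Square roots

largest : {P : Pred ℕ 0ℓ} → Decidable P → ℕ → ℕ
largest P? zero    = zero
largest P? (suc b) with P? (suc b)
... | yes _ = suc b
... | no  _ = largest P? b

largest-holds : {P : Pred ℕ 0ℓ} (P? : Decidable P) → P 0 → ∀ b → P (largest P? b)
largest-holds P? p0 zero    = p0
largest-holds P? p0 (suc b) with P? (suc b)
... | yes p = p
... | no  _ = largest-holds P? p0 b

largest-max : {P : Pred ℕ 0ℓ} (P? : Decidable P) → ∀ b → ¬ P (suc b) → ¬ P (suc (largest P? b))
largest-max P? zero    ¬p = ¬p
largest-max P? (suc b) ¬p with P? (suc b)
... | yes _  = ¬p
... | no ¬p′ = largest-max P? b ¬p′

grid : ℕ → ℕ → ℚ
grid n j = + j ℚ./ suc n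

unit : ℕ → ℚ
unit n = grid n 1

grid-suc : ∀ n j → grid n (suc j) ≡ grid n j + unit n
grid-suc n j = ℚ.toℚᵘ-injective (begin
  ℚ.toℚᵘ (grid n (suc j))                 ≈⟨ ℚ.toℚᵘ-fromℚᵘ (ℚᵘ.mkℚᵘ (+ suc j) n) ⟩
  ℚᵘ.mkℚᵘ (+ suc j) n                     ≈⟨ ℚᵘ.*≡* cross ⟩
  ℚᵘ.mkℚᵘ (+ j) n ℚᵘ.+ ℚᵘ.mkℚᵘ (+ 1) n   ≈⟨ ℚᵘ.+-cong
      (ℚᵘ.≃-sym (ℚ.toℚᵘ-fromℚᵘ (ℚᵘ.mkℚᵘ (+ j) n))) (ℚᵘ.≃-sym (ℚ.toℚᵘ-fromℚᵘ (ℚᵘ.mkℚᵘ (+ 1) n))) ⟩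
  ℚ.toℚᵘ (grid n j) ℚᵘ.+ ℚ.toℚᵘ (unit n)  ≈⟨ ℚᵘ.≃-sym (ℚ.toℚᵘ-homo-+ (grid n j) (unit n)) ⟩
  ℚ.toℚᵘ (grid n j + unit n)              ∎)
  where
  open ℚᵘ.≃-Reasoning
  s : ℤ
  s = + suc n
  cross : + suc j ℤ.* (s ℤ.* s) ≡ (+ j ℤ.* s ℤ.+ + 1 ℤ.* s) ℤ.* s
  cross = trans (sym (ℤ.*-assoc (+ suc j) s s)) (cong (ℤ._* s)
    (trans (cong (ℤ._* s) (ℤ.+-comm (+ 1) (+ j))) (ℤ.*-distribʳ-+ s (+ j) (+ 1))))

0≤grid : ∀ n j → 0ℚ ≤ grid n j
0≤grid n j = ℚ.nonNegative⁻¹ (grid n j) {{ℚ.normalize-nonNeg j (suc n)}}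

0<unit : ∀ n → 0ℚ < unit n
0<unit n = ℚ.positive⁻¹ (unit n) {{ℚ.normalize-pos 1 (suc n)}}

bound : ℕ → ℚ → ℕ
bound n q = ℤ.∣ ℚ.↥ q ∣ ℕ.* suc n

≤grid : ∀ n q → q ≤ grid n (bound n q)
≤grid n q@(mkℚ a d _) = ℚ.toℚᵘ-cancel-≤ (ℚᵘ.≤-trans (ℚᵘ.*≤* cross)
  (ℚᵘ.≤-reflexive (ℚᵘ.≃-sym (ℚ.toℚᵘ-fromℚᵘ (ℚᵘ.mkℚᵘ (+ bound n q) n)))))
  where
  a≤∣a∣ : ∀ a → a ℤ.≤ + ℤ.∣ a ∣
  a≤∣a∣ (+ _)    = ℤ.≤-refl
  a≤∣a∣ -[1+ _ ] = ℤ.-≤+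
  cross : a ℤ.* + suc n ℤ.≤ + (ℤ.∣ a ∣ ℕ.* suc n) ℤ.* + suc d
  cross = ℤ.≤-trans (ℤ.*-monoʳ-≤-nonNeg (+ suc n) (a≤∣a∣ a))
    (subst₂ ℤ._≤_ (ℤ.pos-* ℤ.∣ a ∣ (suc n)) (ℤ.pos-* b (suc d)) (ℤ.+≤+ (ℕ.m≤m*n b (suc d))))
    where
    b : ℕ
    b = ℤ.∣ a ∣ ℕ.* suc n

unit-small : ∀ ε → 0ℚ < ε → ∃[ N ] ∀ n → N ℕ.≤ n → unit n ≤ ε
unit-small (mkℚ (+ zero) _ _) (ℚ.*<* (ℤ.+<+ ()))
unit-small (mkℚ -[1+ _ ] _ _) (ℚ.*<* ())
unit-small (mkℚ +[1+ a ] d _) _ = d , λ n d≤n → ℚ.toℚᵘ-cancel-≤ (ℚᵘ.≤-trans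
  (ℚᵘ.≤-reflexive (ℚ.toℚᵘ-fromℚᵘ (ℚᵘ.mkℚᵘ (+ 1) n)))
  (ℚᵘ.*≤* (ℤ.+≤+ (ℕ.*-mono-≤ (ℕ.s≤s (ℕ.z≤n {a})) (ℕ.s≤s d≤n)))))

-- The largest multiple of 1/(n+1) whose square is at most max(q,0).
root-index : ℕ → ℚ → ℕ
root-index n q = largest (λ j → grid n j * grid n j ℚ.≤? q ⊔ 0ℚ) (bound n (q ⊔ 0ℚ + 1ℚ))

root : ℕ → ℚ → ℚ
root n q = grid n (root-index n q)

root²≤ : ∀ n q → root n q * root n q ≤ q ⊔ 0ℚ
root²≤ n q = largest-holds {P = λ j → grid n j * grid n j ≤ q ⊔ 0ℚ} _
  (subst (_≤ q ⊔ 0ℚ) (sym (trans (cong (λ u → u * u) (ℚ.0/n≡0 (suc n))) (ℚ.*-zeroˡ 0ℚ)))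
    (ℚ.p≤q⊔p q 0ℚ))
  (bound n (q ⊔ 0ℚ + 1ℚ))

<root+unit² : ∀ n q → q ⊔ 0ℚ < (root n q + unit n) * (root n q + unit n)
<root+unit² n q = subst (λ u → q⁺ < u * u) (grid-suc n (root-index n q))
  (ℚ.≰⇒> (largest-max {P = λ j → grid n j * grid n j ≤ q⁺} _ B λ le → ℚ.<-irrefl refl (ℚ.<-≤-trans q⁺< le)))
  where
  q⁺ : ℚ
  q⁺ = q ⊔ 0ℚ
  B : ℕ
  B = bound n (q⁺ + 1ℚ)
  u : ℚ
  u = grid n (suc B)
  q⁺+1≤u : q⁺ + 1ℚ ≤ u
  q⁺+1≤u = ℚ.≤-trans (≤grid n (q⁺ + 1ℚ))
    (subst (grid n B ≤_) (sym (grid-suc n B)) (p≤p+q (ℚ.<⇒≤ (0<unit n))))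
  1≤u : 1ℚ ≤ u
  1≤u = ℚ.≤-trans (subst (_≤ q⁺ + 1ℚ) (ℚ.+-identityˡ 1ℚ) (ℚ.+-monoˡ-≤ 1ℚ (ℚ.p≤q⊔p q 0ℚ))) q⁺+1≤u
  q⁺< : q⁺ < u * u
  q⁺< = ℚ.<-≤-trans
    (subst (_< q⁺ + 1ℚ) (ℚ.+-identityʳ q⁺) (ℚ.+-monoʳ-< q⁺ 0<1))
    (ℚ.≤-trans q⁺+1≤u (subst (_≤ u * u) (ℚ.*-identityʳ u)
      (ℚ.*-monoˡ-≤-nonNeg u {{ℚ.nonNegative (0≤grid n (suc B))}} 1≤u)))

-- √ x is the nonnegative square root of max(x,0).
√ : ℝ → ℝ
√ (x , cx) = (λ n → root n (x n)) , one-sided⇒cauchy _ go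
  where
  go : ∀ ε → 0ℚ < ε → ∃[ N ] ∀ m n → N ℕ.≤ m → N ℕ.≤ n → root m (x m) ≤ root n (x n) + ε
  go ε 0<ε = M ℕ.⊔ N , λ m n N≤m N≤n → ℚ.≮⇒≥ (absurd m n
      (ℕ.m⊔n≤o⇒m≤o M N N≤m) (ℕ.m⊔n≤o⇒m≤o M N N≤n) (ℕ.m⊔n≤o⇒n≤o M N N≤n))
    where
    δ : ℚ
    δ = ½ * ε
    0<δ : 0ℚ < δ
    0<δ = 0<½* ε 0<ε
    η : ℚ
    η = δ * δ
    0<η : 0ℚ < η
    0<η = 0<* 0<δ 0<δ
    cx′ = cauchy⇒one-sided x cx η 0<η
    M N : ℕ
    M = proj₁ cx′
    N = proj₁ (unit-small δ 0<δ)
    absurd : ∀ m n → M ℕ.≤ m → M ℕ.≤ n → N ℕ.≤ n → ¬ (root n (x n) + ε < root m (x m))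
    absurd m n M≤m M≤n N≤n s+ε<s′ = ℚ.<-irrefl refl (begin-strict
      s′ * s′               ≤⟨ root²≤ m (x m) ⟩
      x m ⊔ 0ℚ              ≤⟨ ℚ.⊔-lub
                                 (ℚ.≤-trans (proj₂ cx′ m n M≤m M≤n) (ℚ.+-monoˡ-≤ η (ℚ.p≤p⊔q (x n) 0ℚ)))
                                 (ℚ.≤-trans (ℚ.p≤q⊔p (x n) 0ℚ) (p≤p+q (ℚ.<⇒≤ 0<η))) ⟩
      (x n ⊔ 0ℚ) + η        <⟨ ℚ.+-monoˡ-< η (<root+unit² n (x n)) ⟩
      t * t + δ * δ         ≤⟨ p≤p+q (ℚ.+-mono-≤ 0≤tδ 0≤tδ) ⟩
      t * t + δ * δ + (t * δ + t * δ)
                            ≡⟨ ring-square t δ ⟩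
      (t + δ) * (t + δ)     ≤⟨ *-mono-≤ 0≤t+δ 0≤s′ t+δ≤s′ t+δ≤s′ ⟩
      s′ * s′               ∎)
      where
      open ℚ.≤-Reasoning
      s s′ t : ℚ
      s  = root n (x n)
      s′ = root m (x m)
      t  = s + unit n
      0≤t : 0ℚ ≤ t
      0≤t = ℚ.≤-trans (0≤grid n (root-index n (x n))) (p≤p+q (ℚ.<⇒≤ (0<unit n)))
      0≤tδ : 0ℚ ≤ t * δ
      0≤tδ = 0≤* 0≤t (ℚ.<⇒≤ 0<δ)
      0≤s′ : 0ℚ ≤ s′
      0≤s′ = 0≤grid m (root-index m (x m))
      0≤t+δ : 0ℚ ≤ t + δ
      0≤t+δ = ℚ.≤-trans 0≤t (p≤p+q (ℚ.<⇒≤ 0<δ))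
      t+δ≤s′ : t + δ ≤ s′
      t+δ≤s′ = ℚ.≤-trans (ℚ.+-monoˡ-≤ δ (ℚ.+-monoʳ-≤ s (proj₂ (unit-small δ 0<δ) n N≤n)))
        (subst (_≤ s′) (trans (cong (_+_ s) (sym (½+½ ε))) (sym (ℚ.+-assoc s δ δ))) (ℚ.<⇒≤ s+ε<s′))

------------------------------------------------------------------------
-- Euclidean distortion

‖_‖ : ∀ {n} → Vector ℝ n → ℝ
‖ v ‖ = √ (foldr _+ᴿ_ 0ᴿ (λ i → v i *ᴿ v i))

HasDistortion : {X : Set} (N : ℕ) (d : X → X → ℝ) (ϱ : X → Vector ℝ N) (D : ℝ) → Set
HasDistortion N d ϱ D = ∀ x y →
  let ‖ϱx-ϱy‖ = ‖ (λ i → ϱ x i -ᴿ ϱ y i) ‖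
  in d x y ≤ᴿ ‖ϱx-ϱy‖ × ‖ϱx-ϱy‖ ≤ᴿ D *ᴿ d x y

Embeds : {X : Set} (N : ℕ) (d : X → X → ℝ) (D : ℝ) → Set
Embeds {X} N d D = Σ[ ϱ ∈ (X → Vector ℝ N) ] HasDistortion N d ϱ D

-- Nonnegativity of D is automatic as soon as X has two points; it makes the
-- least distortion of a one-point space 0 instead of leaving it undefined.
IsLeastDistortion : {X : Set} (N : ℕ) (d : X → X → ℝ) (D : ℝ) → Set
IsLeastDistortion N d D =
  0ᴿ ≤ᴿ D × Embeds N d D × (∀ D′ → 0ᴿ ≤ᴿ D′ → Embeds N d D′ → D ≤ᴿ D′)

------------------------------------------------------------------------
-- Graphs

record Graph : Set₁ where
  field
    Vertex  : Set
    order   : ℕ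
    finite  : Fin order ↔ Vertex
    Adj     : Vertex → Vertex → Set
    adj?    : ∀ x y → Dec (Adj x y)
    symm    : ∀ {x y} → Adj x y → Adj y x
    irrefl  : ∀ {x} → ¬ Adj x x

  vertices : List Vertex
  vertices = map (Inverse.to finite) (allFin order)

  degree : Vertex → ℕ
  degree x = length (filter (adj? x) vertices)

  commonNeighbours : Vertex → Vertex → ℕ
  commonNeighbours x y = length (filter (λ z → adj? x z ×-dec adj? y z) vertices)

  -- Vertices may repeat; this does not affect the length of a shortest path.
  data Path : Vertex → Vertex → ℕ → Set where
    stop : ∀ {x} → Path x x 0
    step : ∀ {x y z ℓ} → Adj x y → Path y z ℓ → Path x z (suc ℓ)

  -- Such a d exists precisely when the graph is connected, and is then unique.
  IsShortestPathMetric : (Vertex → Vertex → ℕ) → Set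
  IsShortestPathMetric d = ∀ x y →
    Path x y (d x y) × (∀ {ℓ} → Path x y ℓ → d x y ℕ.≤ ℓ)

open Graph

HasDiameter : Graph → ℕ → Set
HasDiameter G m = Σ[ d ∈ (Vertex G → Vertex G → ℕ) ] IsShortestPathMetric G d
  × (∀ x y → d x y ℕ.≤ m) × (∃[ x ] ∃[ y ] d x y ≡ m)

-- The graph is connected, and its least distortion is D.
c₂[_]≃_ : Graph → ℝ → Set
c₂[ G ]≃ D = Σ[ d ∈ (Vertex G → Vertex G → ℕ) ] IsShortestPathMetric G d
  × IsLeastDistortion (order G) (λ x y → fromℕ (d x y)) D

record IsStronglyRegular (G : Graph) (ν k l μ : ℕ) : Set where
  field
    order≡ν     : order G ≡ ν
    regular     : ∀ x → degree G x ≡ k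
    adjacent    : ∀ x y → Adj G x y → commonNeighbours G x y ≡ l
    nonadjacent : ∀ x y → x ≢ y → ¬ Adj G x y → commonNeighbours G x y ≡ μ

vec-finite : ∀ q n → Fin (q ℕ.^ n) ↔ Vec (Fin q) n
vec-finite q zero    = mk↔ₛ′ (λ _ → []) (λ _ → zero) (λ { [] → refl }) (λ { zero → refl })
vec-finite q (suc n) = mk↔ₛ′
  (λ (x , i) → x ∷ to i) (λ { (x ∷ v) → x , from v })
  (λ { (x ∷ v) → cong (x ∷_) (strictlyInverseˡ v) }) (λ (x , i) → cong (x ,_) (strictlyInverseʳ i))
  ↔-∘ *↔× {q} {q ℕ.^ n}
  where open Inverse (vec-finite q n)

Hamming : (q n : ℕ) → Graph
Hamming q n = record
  { Vertex = Vec (Fin q) n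
  ; order  = q ℕ.^ n
  ; finite = vec-finite q n
  ; Adj    = λ x y → ∃[ i ] lookup x i ≢ lookup y i × (∀ j → j ≢ i → lookup x j ≡ lookup y j)
  ; adj?   = λ x y → any? λ i → ¬? (lookup x i Fin.≟ lookup y i)
               ×-dec all? (λ j → ¬? (j Fin.≟ i) →-dec (lookup x j Fin.≟ lookup y j))
  ; symm   = λ (i , ne , eq) → i , ne ∘ sym , λ j j≢i → sym (eq j j≢i)
  ; irrefl = λ (_ , ne , _) → ne refl
  }

infix 5 _-subsetsOf_

_-subsetsOf_ : ℕ → ℕ → Set
n -subsetsOf v = Σ[ p ∈ Subset v ] Subset.∣ p ∣ ≡ n

binomial : ℕ → ℕ → ℕ
binomial v       zero    = 1
binomial zero    (suc n) = 0
binomial (suc v) (suc n) = binomial v n ℕ.+ binomial v (suc n)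

binomial≡C : ∀ v n → binomial v n ≡ v C n
binomial≡C v       zero    = sym (trans (nCk≡nC[n∸k] {0} {v} ℕ.z≤n) (nCn≡1 v))
binomial≡C zero    (suc n) = sym (k>n⇒nCk≡0 {0} {suc n} ℕ.z<s)
binomial≡C (suc v) (suc n) =
  trans (cong₂ ℕ._+_ (binomial≡C v n) (binomial≡C v (suc n))) (nCk+nC[k+1]≡[n+1]C[k+1] v n)

subsets-≡ : ∀ {n v} {s t : n -subsetsOf v} → proj₁ s ≡ proj₁ t → s ≡ t
subsets-≡ {s = p , e} {t = .p , e′} refl = cong (p ,_) (ℕ.≡-irrelevant e e′)

subsets-finite : ∀ v n → Fin (binomial v n) ↔ (n -subsetsOf v)
subsets-finite zero zero = mk↔ₛ′
  (λ _ → [] , refl) (λ _ → zero) (λ { ([] , _) → subsets-≡ refl }) (λ { zero → refl })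
subsets-finite zero (suc n) = mk↔ₛ′ (λ ()) (λ { ([] , ()) }) (λ { ([] , ()) }) (λ ())
subsets-finite (suc v) zero = mk↔ₛ′
  (λ _ → outside ∷ proj₁ (to zero) , proj₂ (to zero)) (λ _ → zero)
  (λ { (inside ∷ p , ()) ; (outside ∷ p , e) → subsets-≡ (cong (outside ∷_) (cong proj₁ (unique (p , e)))) })
  (λ { zero → refl })
  where
  open Inverse (subsets-finite v zero)
  unique : ∀ s → to zero ≡ s
  unique s with from s | strictlyInverseˡ s
  ... | i | e = trans (cong to (Fin1 i)) e
    where
    Fin1 : ∀ i → zero ≡ i
    Fin1 zero = refl
subsets-finite (suc v) (suc n) = mk↔ₛ′ f g fg gf
  ↔-∘ +↔⊎ {binomial v n} {binomial v (suc n)}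
  where
  module A = Inverse (subsets-finite v n)
  module B = Inverse (subsets-finite v (suc n))
  f : Fin (binomial v n) ⊎ Fin (binomial v (suc n)) → suc n -subsetsOf suc v
  f (inj₁ i) = inside ∷ proj₁ (A.to i) , cong suc (proj₂ (A.to i))
  f (inj₂ i) = outside ∷ proj₁ (B.to i) , proj₂ (B.to i)
  g : suc n -subsetsOf suc v → Fin (binomial v n) ⊎ Fin (binomial v (suc n))
  g (inside ∷ p , e)  = inj₁ (A.from (p , ℕ.suc-injective e))
  g (outside ∷ p , e) = inj₂ (B.from (p , e))
  fg : ∀ s → f (g s) ≡ s
  fg (inside ∷ p , e)  = subsets-≡ (cong (λ s → inside ∷ proj₁ s) (A.strictlyInverseˡ _))
  fg (outside ∷ p , e) = subsets-≡ (cong (λ s → outside ∷ proj₁ s) (B.strictlyInverseˡ _))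
  gf : ∀ i → g (f i) ≡ i
  gf (inj₁ i) = cong inj₁ (trans (cong A.from (subsets-≡ refl)) (A.strictlyInverseʳ i))
  gf (inj₂ i) = cong inj₂ (B.strictlyInverseʳ i)

Johnson : (v n : ℕ) → Graph
Johnson v n = record
  { Vertex = n -subsetsOf v
  ; order  = v C n
  ; finite = subst (λ N → Fin N ↔ n -subsetsOf v) (binomial≡C v n) (subsets-finite v n)
  ; Adj    = λ (p , _) (q , _) → suc Subset.∣ p ∩ q ∣ ≡ n
  ; adj?   = λ (p , _) (q , _) → suc Subset.∣ p ∩ q ∣ ℕ.≟ n
  ; symm   = λ {(p , _)} {(q , _)} e → trans (cong (suc ∘ Subset.∣_∣) (∩-comm q p)) e
  ; irrefl = λ {(p , e)} a → ℕ.1+n≢n (trans (sym (cong (suc ∘ Subset.∣_∣) (∩-idem p))) (trans a (sym e)))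
  }

-- An embedding has distortion at most D exactly when its squared distances lie
-- between d² and D² d², so everything is about squared distances.
--
-- (a), (b): both graphs contain an isometric copy of the n-cube, for which Enflo's
-- inequality, that the squared diagonals sum to at most the squared edges, forces
-- n² ≤ n D².  Conversely, both graphs embed in a Boolean cube with all distances
-- doubled (one-hot encoding, characteristic vectors); scaled by √(n/2) this embedding
-- has squared distances n d, and d² ≤ n d ≤ n d².
--
-- (c): let r > s be the eigenvalues other than k of the adjacency matrix A.  The matrix
-- ν(rI − A) + (k − r)J is positive semidefinite with zero row sums, so for every
-- embedding ϱ the sum of its entries times ‖ϱx − ϱy‖² is at most 0; with
-- ‖ϱx − ϱy‖² ≤ D² on edges and ≥ 4 elsewhere this is the lower bound.  The rows of a
-- multiple of the projection onto the r-eigenspace attain it.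
module Submission where

import Data.Nat.Properties as ℕ
open import Algebra.Bundles using (CommutativeRing)
import Algebra.Properties.Semiring.Sum
open import Algebra.Properties.CommutativeSemigroup ℕ.+-commutativeSemigroup using (interchange)
import Algebra.Solver.Ring
open import Algebra.Solver.Ring.AlmostCommutativeRing
  using (fromCommutativeRing; _-Raw-AlmostCommutative⟶_; Induced-equivalence)
open import Data.Bool as Bool using (Bool; true; false; not; if_then_else_)
open import Data.Fin as Fin using (Fin; zero; suc)
import Data.Fin.Properties as Fin
open import Data.Fin.Subset as Subset using (Subset; _∩_)
open import Data.Fin.Subset.Properties using (∩-comm; ∩-idem; ∣p∩q∣≤∣p∣)
open import Data.Integer using (+_)
open import Data.List using (filter; length; tabulate)
open import Data.List.Properties using (map-tabulate)
open import Data.Maybe using (just; nothing)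
open import Data.Nat as ℕ using (ℕ; zero; suc; z≤n; s≤s)
open import Data.Product using (Σ-syntax; ∃-syntax; _×_; _,_; proj₁; proj₂)
open import Data.Rational as ℚ using (ℚ; 0ℚ; 1ℚ; ½)
import Data.Rational.Properties as ℚ
open import Data.Rational.Solver using (module +-*-Solver)
open import Data.Sum using (_⊎_; inj₁; inj₂)
open import Data.Vec as Vec using (Vec; []; _∷_; _++_; lookup; replicate)
open import Data.Vec.Functional using (Vector; foldr)
open import Defs
open import Function using (_∘_; id; Inverse)
open import Level using (0ℓ)
open import Relation.Binary.Bundles using (Poset)
open import Relation.Binary.Definitions using (DecidableEquality; WeaklyDecidable)
open import Relation.Binary.PropositionalEquality
  using (_≡_; _≢_; refl; sym; trans; cong; cong₂; subst; subst₂; module ≡-Reasoning)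
import Relation.Binary.Reasoning.PartialOrder
import Relation.Binary.Reasoning.Setoid
open import Relation.Binary.Structures using (IsPartialOrder)
open import Relation.Nullary using (¬_; Dec; yes; no; does; contradiction; _×-dec_)

-- The numbers r and s are the roots of θ² = (λ - μ)θ + (k - μ), so the radicand in r is the
-- discriminant Δ = (λ - μ)² + 4(k - μ), and (c) is proved with this Δ. It equals ν for the
-- pentagon, but for the Petersen graph Δ = 9 while ν = 10. The target dimension is exactly the
-- number of vertices. The nq one-hot coordinates and the v coordinates of characteristic vectors
-- therefore have to fit into q^n and C(v, n) dimensions and are padded with zeros; the rows of a ν
-- by ν matrix fit as they are. In (c) no eigenvector is computed. The quadratic equation for A and
-- its row sums make the square of each extremal matrix a multiple of that matrix, which yields
-- semidefiniteness as a sum of squares and distances between rows in terms of entries. The two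
-- bounds meet because the lower bound for D² equals 4(-s - 1)/(-s), four times the ratio of the
-- squared row distances of adjacent and nonadjacent vertices.

-- Hamming distance of words

module _ {A : Set} (_≟_ : DecidableEquality A) where

  mismatch : A → A → ℕ
  mismatch x y = if does (x ≟ y) then 0 else 1

  hamming : ∀ {n} → Vec A n → Vec A n → ℕ
  hamming []       []       = 0
  hamming (x ∷ xs) (y ∷ ys) = mismatch x y ℕ.+ hamming xs ys

  mismatch-refl : ∀ x → mismatch x x ≡ 0
  mismatch-refl x with x ≟ x
  ... | yes _  = refl
  ... | no x≢x = contradiction refl x≢x

  hamming-refl : ∀ {n} (x : Vec A n) → hamming x x ≡ 0
  hamming-refl []       = refl
  hamming-refl (x ∷ xs) = cong₂ ℕ._+_ (mismatch-refl x) (hamming-refl xs)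

hammingᵇ : ∀ {n} → Vec Bool n → Vec Bool n → ℕ
hammingᵇ = hamming Bool._≟_

hamming-not : ∀ {n} (x : Vec Bool n) → hammingᵇ x (Vec.map not x) ≡ n
hamming-not []          = refl
hamming-not (false ∷ x) = cong suc (hamming-not x)
hamming-not (true ∷ x)  = cong suc (hamming-not x)

-- The ordered ring of Cauchy reals

Eventually : (ℕ → Set) → Set
Eventually P = ∃[ N ] ∀ n → N ℕ.≤ n → P n

eventually-map : ∀ {P Q : ℕ → Set} → (∀ n → P n → Q n) → Eventually P → Eventually Q
eventually-map f (N , p) = N , λ n N≤n → f n (p n N≤n)

eventually-zip : ∀ {P Q R : ℕ → Set} → (∀ n → P n → Q n → R n) →
  Eventually P → Eventually Q → Eventually R
eventually-zip f (M , p) (N , q) = M ℕ.⊔ N , λ n le →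
  f n (p n (ℕ.m⊔n≤o⇒m≤o M N le)) (q n (ℕ.m⊔n≤o⇒n≤o M N le))

0≤½ : 0ℚ ℚ.≤ ½
0≤½ = ℚ.<⇒≤ (ℚ.positive⁻¹ ½)

module _ where
  open import Data.Rational using (_+_; _*_; _-_; -_; ∣_∣)
  open +-*-Solver

  0≤p-q⇒q≤p : ∀ {p q} → 0ℚ ℚ.≤ p - q → q ℚ.≤ p
  0≤p-q⇒q≤p {p} {q} h = subst₂ ℚ._≤_ (ℚ.+-identityʳ q) (ring-cancel q p) (ℚ.+-monoʳ-≤ q h)

  q≤p⇒0≤p-q : ∀ {p q} → q ℚ.≤ p → 0ℚ ℚ.≤ p - q
  q≤p⇒0≤p-q {p} {q} h = subst (ℚ._≤ p - q) (ℚ.+-inverseʳ q) (ℚ.+-monoˡ-≤ (- q) h)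

  0≤p² : ∀ p → 0ℚ ℚ.≤ p * p
  0≤p² p with ℚ.∣p∣≡p∨∣p∣≡-p p
  ... | inj₁ e = subst (λ u → 0ℚ ℚ.≤ u * u) e (0≤* (ℚ.0≤∣p∣ p) (ℚ.0≤∣p∣ p))
  ... | inj₂ e = subst (0ℚ ℚ.≤_) (trans (cong (λ u → u * u) e) (neg² p)) (0≤* (ℚ.0≤∣p∣ p) (ℚ.0≤∣p∣ p))
    where
    neg² : ∀ p → - p * - p ≡ p * p
    neg² = solve 1 (λ p → :- p :* :- p := p :* p) refl

≤-pointwise : ∀ x y → (∀ n → seq x n ℚ.≤ seq y n) → x ≤ᴿ y
≤-pointwise x y h ε 0<ε = 0 , λ n _ → ℚ.≤-trans (h n) (p≤p+q (ℚ.<⇒≤ 0<ε))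

≃-pointwise : ∀ x y → (∀ n → seq x n ≡ seq y n) → x ≃ᴿ y
≃-pointwise x y h = ≤-pointwise x y (ℚ.≤-reflexive ∘ h) , ≤-pointwise y x (ℚ.≤-reflexive ∘ sym ∘ h)

≤ᴿ-trans : ∀ x y z → x ≤ᴿ y → y ≤ᴿ z → x ≤ᴿ z
≤ᴿ-trans x y z x≤y y≤z ε 0<ε = eventually-zip
  (λ n p q → ℚ.≤-trans p (subst (seq y n ℚ.+ ½ ℚ.* ε ℚ.≤_)
    (trans (ℚ.+-assoc (seq z n) _ _) (cong (seq z n ℚ.+_) (½+½ ε))) (ℚ.+-monoˡ-≤ (½ ℚ.* ε) q)))
  (x≤y _ (0<½* ε 0<ε)) (y≤z _ (0<½* ε 0<ε))

≃ᴿ-trans : ∀ x y z → x ≃ᴿ y → y ≃ᴿ z → x ≃ᴿ z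
≃ᴿ-trans x y z (x≤y , y≤x) (y≤z , z≤y) = ≤ᴿ-trans x y z x≤y y≤z , ≤ᴿ-trans z y x z≤y y≤x

+ᴿ-mono-≤ : ∀ x y u v → x ≤ᴿ y → u ≤ᴿ v → x +ᴿ u ≤ᴿ y +ᴿ v
+ᴿ-mono-≤ x y u v x≤y u≤v ε 0<ε = eventually-zip
  (λ n p q → subst (seq x n ℚ.+ seq u n ℚ.≤_)
    (trans (ring-add (seq y n) (seq v n) _) (cong (seq y n ℚ.+ seq v n ℚ.+_) (½+½ ε)))
    (ℚ.+-mono-≤ p q))
  (x≤y _ (0<½* ε 0<ε)) (u≤v _ (0<½* ε 0<ε))

-ᴿ-antimono-≤ : ∀ x y → x ≤ᴿ y → -ᴿ y ≤ᴿ -ᴿ x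
-ᴿ-antimono-≤ x y x≤y ε 0<ε = eventually-map (λ n p → 0≤p-q⇒q≤p
  (subst (0ℚ ℚ.≤_) (rearrange (seq x n) (seq y n) ε) (q≤p⇒0≤p-q p))) (x≤y ε 0<ε)
  where
  open import Data.Rational using (_+_; _*_; _-_; -_; ∣_∣)
  open +-*-Solver
  rearrange : ∀ a b e → b + e - a ≡ - a + e - - b
  rearrange = solve 3 (λ a b e → b :+ e :- a := :- a :+ e :- :- b) refl

+ᴿ-cong : ∀ x y u v → x ≃ᴿ y → u ≃ᴿ v → x +ᴿ u ≃ᴿ y +ᴿ v
+ᴿ-cong x y u v (x≤y , y≤x) (u≤v , v≤u) = +ᴿ-mono-≤ x y u v x≤y u≤v , +ᴿ-mono-≤ y x v u y≤x v≤u

-- Monotonicity would depend on the sign of z. From equality, |x - y| ≤ ε/B holds eventually, with B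
-- a bound of |z|, and the sign does not matter.
*ᴿ-congˡ-≤ : ∀ x y z → x ≃ᴿ y → x *ᴿ z ≤ᴿ y *ᴿ z
*ᴿ-congˡ-≤ x y z (x≤y , y≤x) ε 0<ε = bounded (eventually-bounded (seq z) (cauchy z))
  where
  open import Data.Rational using (_+_; _*_; _-_; -_; ∣_∣)
  open +-*-Solver
  shift : ∀ a b c → a * c ≡ b * c + (a - b) * c
  shift = solve 3 (λ a b c → a :* c := b :* c :+ (a :- b) :* c) refl
  bounded : (Σ[ B ∈ ℚ ] 0ℚ ℚ.< B × Eventually λ n → ∣ seq z n ∣ ℚ.≤ B) →
    Eventually λ n → seq x n * seq z n ℚ.≤ seq y n * seq z n + ε
  bounded (B , 0<B , z≤B) = eventually-zip estimate
    (eventually-zip close (x≤y δ 0<δ) (y≤x δ 0<δ)) z≤B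
    where
    δ : ℚ
    δ = ε * recip B 0<B
    0<δ : 0ℚ ℚ.< δ
    0<δ = 0<* 0<ε (0<recip B 0<B)
    δB≡ε : δ * B ≡ ε
    δB≡ε = trans (ℚ.*-assoc ε _ B) (trans (cong (ε *_)
      (trans (ℚ.*-comm _ B) (*-recip B 0<B))) (ℚ.*-identityʳ ε))
    close : ∀ n → seq x n ℚ.≤ seq y n + δ → seq y n ℚ.≤ seq x n + δ → ∣ seq x n - seq y n ∣ ℚ.≤ δ
    close n p q = ∣∣≤ (p≤q+r⇒p-q≤r p)
      (subst (ℚ._≤ δ) (ring-flip (seq x n) (seq y n)) (p≤q+r⇒p-q≤r q))
    estimate : ∀ n → ∣ seq x n - seq y n ∣ ℚ.≤ δ → ∣ seq z n ∣ ℚ.≤ B →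
      seq x n * seq z n ℚ.≤ seq y n * seq z n + ε
    estimate n p q = begin
      seq x n * seq z n                                ≡⟨ shift (seq x n) (seq y n) (seq z n) ⟩
      seq y n * seq z n + (seq x n - seq y n) * seq z n
        ≤⟨ ℚ.+-monoʳ-≤ (seq y n * seq z n) (begin
          (seq x n - seq y n) * seq z n         ≤⟨ p≤∣p∣ _ ⟩
          ∣ (seq x n - seq y n) * seq z n ∣     ≡⟨ ℚ.∣p*q∣≡∣p∣*∣q∣ (seq x n - seq y n) (seq z n) ⟩
          ∣ seq x n - seq y n ∣ * ∣ seq z n ∣   ≤⟨ *-mono-≤ (ℚ.0≤∣p∣ (seq x n - seq y n)) (ℚ.<⇒≤ 0<B) p q ⟩
          δ * B                                 ≡⟨ δB≡ε ⟩
          ε                                     ∎) ⟩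
      seq y n * seq z n + ε                            ∎
      where open ℚ.≤-Reasoning

*ᴿ-congˡ : ∀ x y z → x ≃ᴿ y → x *ᴿ z ≃ᴿ y *ᴿ z
*ᴿ-congˡ x y z (x≤y , y≤x) = *ᴿ-congˡ-≤ x y z (x≤y , y≤x) , *ᴿ-congˡ-≤ y x z (y≤x , x≤y)

*ᴿ-comm : ∀ x y → x *ᴿ y ≃ᴿ y *ᴿ x
*ᴿ-comm x y = ≃-pointwise (x *ᴿ y) (y *ᴿ x) λ n → ℚ.*-comm (seq x n) (seq y n)

*ᴿ-cong : ∀ x y u v → x ≃ᴿ y → u ≃ᴿ v → x *ᴿ u ≃ᴿ y *ᴿ v
*ᴿ-cong x y u v x≃y u≃v = ≃ᴿ-trans (x *ᴿ u) (y *ᴿ u) (y *ᴿ v) (*ᴿ-congˡ x y u x≃y)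
  (≃ᴿ-trans (y *ᴿ u) (u *ᴿ y) (y *ᴿ v) (*ᴿ-comm y u)
    (≃ᴿ-trans (u *ᴿ y) (v *ᴿ y) (y *ᴿ v) (*ᴿ-congˡ u v y u≃v) (*ᴿ-comm v y)))

ℝ-commutativeRing : CommutativeRing 0ℓ 0ℓ
ℝ-commutativeRing = record
  { Carrier = ℝ ; _≈_ = _≃ᴿ_ ; _+_ = _+ᴿ_ ; _*_ = _*ᴿ_ ; -_ = -ᴿ_ ; 0# = 0ᴿ ; 1# = fromℕ 1
  ; isCommutativeRing = record
    { isRing = record
      { +-isAbelianGroup = record
        { isGroup = record
          { isMonoid = record
            { isSemigroup = record
              { isMagma = record
                { isEquivalence = record
                  { refl = λ {x} → ≃-pointwise x x λ _ → refl
                  ; sym = λ (p , q) → q , p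
                  ; trans = λ {x} {y} {z} → ≃ᴿ-trans x y z }
                ; ∙-cong = λ {x} {y} {u} {v} → +ᴿ-cong x y u v }
              ; assoc = λ x y z → ≃-pointwise (x +ᴿ y +ᴿ z) (x +ᴿ (y +ᴿ z))
                  λ n → ℚ.+-assoc (seq x n) (seq y n) (seq z n) }
            ; identity = (λ x → ≃-pointwise (0ᴿ +ᴿ x) x λ n → ℚ.+-identityˡ (seq x n))
                       , (λ x → ≃-pointwise (x +ᴿ 0ᴿ) x λ n → ℚ.+-identityʳ (seq x n)) }
          ; inverse = (λ x → ≃-pointwise (-ᴿ x +ᴿ x) 0ᴿ λ n → ℚ.+-inverseˡ (seq x n))
                    , (λ x → ≃-pointwise (x +ᴿ -ᴿ x) 0ᴿ λ n → ℚ.+-inverseʳ (seq x n))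
          ; ⁻¹-cong = λ {x} {y} (x≤y , y≤x) → -ᴿ-antimono-≤ y x y≤x , -ᴿ-antimono-≤ x y x≤y }
        ; comm = λ x y → ≃-pointwise (x +ᴿ y) (y +ᴿ x) λ n → ℚ.+-comm (seq x n) (seq y n) }
      ; *-cong = λ {x} {y} {u} {v} → *ᴿ-cong x y u v
      ; *-assoc = λ x y z → ≃-pointwise (x *ᴿ y *ᴿ z) (x *ᴿ (y *ᴿ z))
          λ n → ℚ.*-assoc (seq x n) (seq y n) (seq z n)
      ; *-identity = (λ x → ≃-pointwise (fromℕ 1 *ᴿ x) x λ n → ℚ.*-identityˡ (seq x n))
                   , (λ x → ≃-pointwise (x *ᴿ fromℕ 1) x λ n → ℚ.*-identityʳ (seq x n))
      ; distrib = (λ x y z → ≃-pointwise (x *ᴿ (y +ᴿ z)) (x *ᴿ y +ᴿ x *ᴿ z)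
                    λ n → ℚ.*-distribˡ-+ (seq x n) (seq y n) (seq z n))
                , (λ x y z → ≃-pointwise ((y +ᴿ z) *ᴿ x) (y *ᴿ x +ᴿ z *ᴿ x)
                    λ n → ℚ.*-distribʳ-+ (seq x n) (seq y n) (seq z n)) }
    ; *-comm = *ᴿ-comm } }

-- Nonnegativity only makes the terms eventually at least -δ, so the estimate starts from (x + δ)(y
-- + δ) ≥ 0; the shifts are paid for by upper bounds A of |x| and B of |y|.
*ᴿ-nonNeg : ∀ x y → 0ᴿ ≤ᴿ x → 0ᴿ ≤ᴿ y → 0ᴿ ≤ᴿ x *ᴿ y
*ᴿ-nonNeg x y 0≤x 0≤y ε 0<ε =
  bounded (eventually-bounded (seq x) (cauchy x)) (eventually-bounded (seq y) (cauchy y))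
  where
  open import Data.Rational using (_+_; _*_; _-_; -_; ∣_∣)
  open +-*-Solver
  Bounded : ℝ → Set
  Bounded z = Σ[ B ∈ ℚ ] 0ℚ ℚ.< B × Eventually λ n → ∣ seq z n ∣ ℚ.≤ B
  rearrange : ∀ a b A B δ → (a + δ) * (b + δ) + δ * (A - a) + δ * (B - b)
    ≡ a * b + (A * δ + δ * (B + δ))
  rearrange = solve 5 (λ a b A B δ → (a :+ δ) :* (b :+ δ) :+ δ :* (A :- a) :+ δ :* (B :- b)
    := a :* b :+ (A :* δ :+ δ :* (B :+ δ))) refl
  bounded : Bounded x → Bounded y → Eventually λ n → 0ℚ ℚ.≤ seq x n * seq y n + ε
  bounded (A , 0<A , x≤A) (B , 0<B , y≤B) = shared (share 0<A (ℚ.+-mono-< 0<B 0<1) 0<ε)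
   where
   shared : (Σ[ η ∈ ℚ ] 0ℚ ℚ.< η × A * η + η * (B + 1ℚ) ≡ ε) →
     Eventually λ n → 0ℚ ℚ.≤ seq x n * seq y n + ε
   shared (η , 0<η , eq) = eventually-zip estimate
    (eventually-zip (λ _ → _,_) (0≤x δ 0<δ) (0≤y δ 0<δ)) (eventually-zip (λ _ → _,_) x≤A y≤B)
    where
    -- The cap at 1 gives B + δ ≤ B + 1, so the error Aδ + δ(B + δ) is at most Aη + η(B + 1) = ε.
    δ : ℚ
    δ = η ℚ.⊓ 1ℚ
    0<δ : 0ℚ ℚ.< δ
    0<δ with ℚ.⊓-sel η 1ℚ
    ... | inj₁ e = subst (0ℚ ℚ.<_) (sym e) 0<η
    ... | inj₂ e = subst (0ℚ ℚ.<_) (sym e) 0<1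
    0≤δ : 0ℚ ℚ.≤ δ
    0≤δ = ℚ.<⇒≤ 0<δ
    small : A * δ + δ * (B + δ) ℚ.≤ ε
    small = subst (A * δ + δ * (B + δ) ℚ.≤_) eq (ℚ.+-mono-≤
      (ℚ.*-monoˡ-≤-nonNeg A {{ℚ.nonNegative (ℚ.<⇒≤ 0<A)}} (ℚ.p⊓q≤p η 1ℚ))
      (*-mono-≤ 0≤δ (ℚ.<⇒≤ (ℚ.+-mono-< 0<B 0<1)) (ℚ.p⊓q≤p η 1ℚ) (ℚ.+-monoʳ-≤ B (ℚ.p⊓q≤q η 1ℚ))))
    estimate : ∀ n → (0ℚ ℚ.≤ seq x n + δ × 0ℚ ℚ.≤ seq y n + δ) →
      (∣ seq x n ∣ ℚ.≤ A × ∣ seq y n ∣ ℚ.≤ B) → 0ℚ ℚ.≤ seq x n * seq y n + ε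
    estimate n (p , q) (u , v) = ℚ.≤-trans
      (subst (0ℚ ℚ.≤_) (rearrange (seq x n) (seq y n) A B δ)
        (ℚ.+-mono-≤ (ℚ.+-mono-≤ (0≤* p q)
          (0≤* 0≤δ (q≤p⇒0≤p-q (ℚ.≤-trans (p≤∣p∣ _) u))))
          (0≤* 0≤δ (q≤p⇒0≤p-q (ℚ.≤-trans (p≤∣p∣ _) v)))))
      (ℚ.+-monoʳ-≤ (seq x n * seq y n) small)

½≤-of-1≤ : ∀ {p} → 1ℚ ℚ.≤ p ℚ.+ ½ → ½ ℚ.≤ p
½≤-of-1≤ {p} h = subst₂ ℚ._≤_ refl (cancel p) (ℚ.+-monoˡ-≤ (ℚ.- ½) h)
  where
  open import Data.Rational using (_+_; _*_; _-_; -_; ∣_∣)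
  open +-*-Solver
  cancel : ∀ p → p + ½ - ½ ≡ p
  cancel = solve 1 (λ p → p :+ con ½ :- con ½ := p) refl

-- Since c is eventually at least ½, a gap ε between x and y would remain a gap of at least ε/2
-- after multiplication. The hypothesis 1 ≤ c stands in for positivity: it supplies a rational lower
-- bound, is stable under products, and holds for every factor cancelled later.
*ᴿ-cancelˡ-≤ : ∀ c x y → fromℕ 1 ≤ᴿ c → c *ᴿ x ≤ᴿ c *ᴿ y → x ≤ᴿ y
*ᴿ-cancelˡ-≤ c x y 1≤c cx≤cy ε 0<ε = eventually-zip estimate
  (1≤c ½ (ℚ.positive⁻¹ ½)) (cx≤cy (½ ℚ.* ε) (0<½* ε 0<ε))
  where
  open import Data.Rational using (_+_; _*_; _-_; -_; ∣_∣)
  estimate : ∀ n → 1ℚ ℚ.≤ seq c n + ½ → seq c n * seq x n ℚ.≤ seq c n * seq y n + ½ * ε →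
    seq x n ℚ.≤ seq y n + ε
  estimate n h le = ℚ.≮⇒≥ λ lt → ℚ.<-irrefl refl (begin-strict
    seq c n * seq x n             ≤⟨ le ⟩
    seq c n * seq y n + ½ * ε     ≤⟨ ℚ.+-monoʳ-≤ (seq c n * seq y n)
                                       (ℚ.*-monoʳ-≤-nonNeg ε {{ℚ.nonNegative (ℚ.<⇒≤ 0<ε)}} ½≤c) ⟩
    seq c n * seq y n + seq c n * ε ≡⟨ sym (ℚ.*-distribˡ-+ (seq c n) (seq y n) ε) ⟩
    seq c n * (seq y n + ε)       <⟨ ℚ.*-monoʳ-<-pos (seq c n) {{ℚ.positive (ℚ.<-≤-trans (ℚ.positive⁻¹ ½) ½≤c)}} lt ⟩
    seq c n * seq x n             ∎)
    where
    open ℚ.≤-Reasoning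
    ½≤c : ½ ℚ.≤ seq c n
    ½≤c = ½≤-of-1≤ h

square-cancel-≤ᴿ : ∀ x y → 0ᴿ ≤ᴿ y → x *ᴿ x ≤ᴿ y *ᴿ y → x ≤ᴿ y
square-cancel-≤ᴿ x y 0≤y x²≤y² ε 0<ε = eventually-zip estimate
  (0≤y δ 0<δ) (x²≤y² (δ ℚ.* δ) (0<* 0<δ 0<δ))
  where
  open import Data.Rational using (_+_; _*_; _-_; -_; ∣_∣)
  open +-*-Solver
  -- Two halvings give ε = 4δ. With y ≥ -δ, (y + 4δ)² = y² + 8δ(y + δ) + 8δ² ≥ y² + δ² ≥ x², which
  -- contradicts x > y + ε.
  δ e : ℚ
  δ = ½ * (½ * ε)
  e = δ + δ + (δ + δ)
  0<δ : 0ℚ ℚ.< δ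
  0<δ = 0<½* (½ * ε) (0<½* ε 0<ε)
  0≤δ : 0ℚ ℚ.≤ δ
  0≤δ = ℚ.<⇒≤ 0<δ
  0<e : 0ℚ ℚ.< e
  0<e = ℚ.+-mono-< (ℚ.+-mono-< 0<δ 0<δ) (ℚ.+-mono-< 0<δ 0<δ)
  e≡ε : e ≡ ε
  e≡ε = trans (cong₂ _+_ (½+½ (½ * ε)) (½+½ (½ * ε))) (½+½ ε)
  expand : ∀ b δ → let e = δ + δ + (δ + δ) in
    b * b + δ * δ + ((b + δ) * (e + e) + (δ * e + δ * δ + δ * (δ + δ))) ≡ (b + e) * (b + e)
  expand = solve 2 (λ b δ → let e = δ :+ δ :+ (δ :+ δ) in
    b :* b :+ δ :* δ :+ ((b :+ δ) :* (e :+ e) :+ (δ :* e :+ δ :* δ :+ δ :* (δ :+ δ)))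
      := (b :+ e) :* (b :+ e)) refl
  square-< : ∀ {p q} → 0ℚ ℚ.≤ p → p ℚ.< q → p * p ℚ.< q * q
  square-< {p} {q} 0≤p p<q = ℚ.≤-<-trans
    (ℚ.*-monoˡ-≤-nonNeg p {{ℚ.nonNegative 0≤p}} (ℚ.<⇒≤ p<q))
    (ℚ.*-monoˡ-<-pos q {{ℚ.positive (ℚ.≤-<-trans 0≤p p<q)}} p<q)
  estimate : ∀ n → 0ℚ ℚ.≤ seq y n + δ → seq x n * seq x n ℚ.≤ seq y n * seq y n + δ * δ →
    seq x n ℚ.≤ seq y n + ε
  estimate n h le = subst (λ u → seq x n ℚ.≤ seq y n + u) e≡ε (ℚ.≮⇒≥ λ lt →
    ℚ.<-irrefl refl (begin-strict
      seq x n * seq x n              ≤⟨ le ⟩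
      seq y n * seq y n + δ * δ      ≤⟨ p≤p+q (ℚ.+-mono-≤ (0≤* h (ℚ.+-mono-≤ 0≤e 0≤e))
                                          (ℚ.+-mono-≤ (ℚ.+-mono-≤ (0≤* 0≤δ 0≤e) (0≤* 0≤δ 0≤δ))
                                            (0≤* 0≤δ (ℚ.+-mono-≤ 0≤δ 0≤δ)))) ⟩
      seq y n * seq y n + δ * δ + ((seq y n + δ) * (e + e) + (δ * e + δ * δ + δ * (δ + δ)))
                                     ≡⟨ expand (seq y n) δ ⟩
      (seq y n + e) * (seq y n + e)  <⟨ square-< 0≤y+e lt ⟩
      seq x n * seq x n              ∎))
    where
    open ℚ.≤-Reasoning
    0≤e : 0ℚ ℚ.≤ e
    0≤e = ℚ.<⇒≤ 0<e
    0≤y+e : 0ℚ ℚ.≤ seq y n + e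
    0≤y+e = ℚ.≤-trans h (ℚ.+-monoʳ-≤ (seq y n) (ℚ.≤-trans (p≤p+q 0≤δ) (p≤p+q (ℚ.+-mono-≤ 0≤δ 0≤δ))))

-- Square roots and inverses

0≤√ : ∀ x → 0ᴿ ≤ᴿ √ x
0≤√ x = ≤-pointwise 0ᴿ (√ x) λ n → 0≤grid n (root-index n (seq x n))

-- The n-th term a of `√ x` is the last grid point with a² ≤ max(x, 0), so max(x, 0) < (a + u)² for
-- the mesh u = 1/(n + 1). Once u ≤ δ and u ≤ 1, the excess au + u(a + u) is at most Bδ + δ(B + 1) =
-- ε. The hypothesis makes the truncation at 0 harmless in the limit.
√-square : ∀ x → 0ᴿ ≤ᴿ x → √ x *ᴿ √ x ≃ᴿ x
√-square x 0≤x = below , above (eventually-bounded (seq (√ x)) (cauchy (√ x)))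
  where
  open import Data.Rational using (_+_; _*_; _-_; -_; ∣_∣)
  below : √ x *ᴿ √ x ≤ᴿ x
  below ε 0<ε = eventually-map (λ n h → ℚ.≤-trans (root²≤ n (seq x n))
    (ℚ.⊔-lub {seq x n + ε} {seq x n} {0ℚ} (p≤p+q (ℚ.<⇒≤ 0<ε)) h)) (0≤x ε 0<ε)
  above : (Σ[ B ∈ ℚ ] 0ℚ ℚ.< B × Eventually λ n → ∣ seq (√ x) n ∣ ℚ.≤ B) → x ≤ᴿ √ x *ᴿ √ x
  above (B , 0<B , √x≤B) ε 0<ε = shared (share 0<B (ℚ.+-mono-< 0<B 0<1) 0<ε)
   where
   shared : (Σ[ δ ∈ ℚ ] 0ℚ ℚ.< δ × B * δ + δ * (B + 1ℚ) ≡ ε) →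
     Eventually λ n → seq x n ℚ.≤ seq (√ x) n * seq (√ x) n + ε
   shared (δ , 0<δ , eq) = eventually-zip estimate √x≤B
    (eventually-zip (λ _ → _,_) (unit-small δ 0<δ) (unit-small 1ℚ 0<1))
    where
    open +-*-Solver
    0≤δ : 0ℚ ℚ.≤ δ
    0≤δ = ℚ.<⇒≤ 0<δ
    expand : ∀ a u → (a + u) * (a + u) ≡ a * a + (a * u + u * (a + u))
    expand = solve 2 (λ a u → (a :+ u) :* (a :+ u) := a :* a :+ (a :* u :+ u :* (a :+ u))) refl
    estimate : ∀ n → ∣ root n (seq x n) ∣ ℚ.≤ B → (unit n ℚ.≤ δ × unit n ℚ.≤ 1ℚ) →
      seq x n ℚ.≤ root n (seq x n) * root n (seq x n) + ε
    estimate n h (u≤δ , u≤1) = begin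
      seq x n                    ≤⟨ ℚ.p≤p⊔q (seq x n) 0ℚ ⟩
      seq x n ℚ.⊔ 0ℚ             <⟨ <root+unit² n (seq x n) ⟩
      (a + u) * (a + u)          ≡⟨ expand a u ⟩
      a * a + (a * u + u * (a + u))
        ≤⟨ ℚ.+-monoʳ-≤ (a * a) (ℚ.+-mono-≤ (*-mono-≤ 0≤a 0≤δ a≤B u≤δ)
             (*-mono-≤ 0≤u (ℚ.<⇒≤ (ℚ.+-mono-< 0<B 0<1)) u≤δ (ℚ.+-mono-≤ a≤B u≤1))) ⟩
      a * a + (B * δ + δ * (B + 1ℚ)) ≡⟨ cong (_+_ (a * a)) eq ⟩
      a * a + ε                  ∎
      where
      open ℚ.≤-Reasoning
      a u : ℚ
      a = root n (seq x n)
      u = unit n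
      0≤a : 0ℚ ℚ.≤ a
      0≤a = 0≤grid n (root-index n (seq x n))
      0≤u : 0ℚ ℚ.≤ u
      0≤u = ℚ.<⇒≤ (0<unit n)
      a≤B : a ℚ.≤ B
      a≤B = ℚ.≤-trans (p≤∣p∣ a) h

1≤⇒0< : ∀ x → fromℕ 1 ≤ᴿ x → 0ᴿ <ᴿ x
1≤⇒0< x 1≤x = ½ , ℚ.positive⁻¹ ½ , eventually-map
  (λ n h → subst (ℚ._≤ seq x n) (sym (ℚ.+-identityˡ ½)) (½≤-of-1≤ h)) (1≤x ½ (ℚ.positive⁻¹ ½))

-- Truncation at e changes nothing from the index on where x ≥ e, and there the product is exactly
-- 1.
inv-inverse : ∀ x (0<x : 0ᴿ <ᴿ x) → x *ᴿ inv x 0<x ≃ᴿ fromℕ 1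
inv-inverse x 0<x@(e , 0<e , e≤x) = le , ge
  where
  open import Data.Rational using (_+_; _*_; _-_; -_; ∣_∣)
  eq : Eventually λ n → seq x n * seq (inv x 0<x) n ≡ 1ℚ
  eq = eventually-map (λ n h → trans
    (cong (_* seq (inv x 0<x) n) (sym (ℚ.p≥q⇒p⊔q≡p (subst (ℚ._≤ seq x n) (ℚ.+-identityˡ e) h))))
    (*-recip (seq x n ℚ.⊔ e) (ℚ.<-≤-trans 0<e (ℚ.p≤q⊔p (seq x n) e)))) e≤x
  le : x *ᴿ inv x 0<x ≤ᴿ fromℕ 1
  le ε 0<ε = eventually-map (λ n h → ℚ.≤-trans (ℚ.≤-reflexive h) (p≤p+q (ℚ.<⇒≤ 0<ε))) eq
  ge : fromℕ 1 ≤ᴿ x *ᴿ inv x 0<x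
  ge ε 0<ε = eventually-map (λ n h → ℚ.≤-trans (ℚ.≤-reflexive (sym h)) (p≤p+q (ℚ.<⇒≤ 0<ε))) eq

-- Ordered algebras over the rationals

-- Arguments over this interface never unfold Cauchy sequences. Roots and inverses are left out;
-- they enter as variables with an equation such as σ * σ ≈ S or c * i ≈ 1ᴿ.
record OrderedAlgebra : Set₁ where
  infix 4 _≤_
  field
    commutativeRing : CommutativeRing 0ℓ 0ℓ
  open CommutativeRing commutativeRing public
  field
    _≤_             : Carrier → Carrier → Set
    isPartialOrder  : IsPartialOrder _≈_ _≤_
    ι               : ℚ → Carrier
    ι-+             : ∀ p q → ι (p ℚ.+ q) ≈ ι p + ι q
    ι-*             : ∀ p q → ι (p ℚ.* q) ≈ ι p * ι q
    ι-neg           : ∀ p → ι (ℚ.- p) ≈ - ι p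
    ι-0             : ι 0ℚ ≈ 0#
    ι-1             : ι 1ℚ ≈ 1#
    ι-mono-≤        : ∀ {p q} → p ℚ.≤ q → ι p ≤ ι q
    +-mono-≤        : ∀ {x y u v} → x ≤ y → u ≤ v → x + u ≤ y + v
    *-nonNeg        : ∀ {x y} → 0# ≤ x → 0# ≤ y → 0# ≤ x * y
    square-nonNeg   : ∀ x → 0# ≤ x * x
    *-cancelˡ-≤     : ∀ {c x y} → ι 1ℚ ≤ c → c * x ≤ c * y → x ≤ y
    square-cancel-≤ : ∀ {x y} → 0# ≤ y → x * x ≤ y * y → x ≤ y

module Theory (𝓡 : OrderedAlgebra) where

  open OrderedAlgebra 𝓡
    renaming (Carrier to C; refl to ≈-refl; sym to ≈-sym; trans to ≈-trans)
    hiding (zero)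
  open Algebra.Properties.Semiring.Sum semiring public
    using (sum; sum-cong-≋; sum-replicate-zero; ∑-distrib-+; ∑-comm; *-distribˡ-sum; *-distribʳ-sum)

  poset : Poset 0ℓ 0ℓ 0ℓ
  poset = record { isPartialOrder = isPartialOrder }

  open Poset poset using (antisym)
    renaming (refl to ≤-refl; trans to ≤-trans; reflexive to ≤-reflexive)

  module ≤-Reasoning = Relation.Binary.Reasoning.PartialOrder poset
  module ≈-Reasoning = Relation.Binary.Reasoning.Setoid setoid

  -- Rational coefficients let the solver cancel ½ and ¼. It knows constants only as images under
  -- `ι`, hence the recurrent exchange of `0#` and `1#` for `ι 0ℚ` and `1ᴿ`.
  ι-morphism : ℚ.+-*-rawRing -Raw-AlmostCommutative⟶ fromCommutativeRing commutativeRing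
  ι-morphism = record
    { ⟦_⟧ = ι ; +-homo = ι-+ ; *-homo = ι-* ; -‿homo = ι-neg ; 0-homo = ι-0 ; 1-homo = ι-1 }

  ι-≟ : WeaklyDecidable (Induced-equivalence ι-morphism)
  ι-≟ p q with p ℚ.≟ q
  ... | yes refl = just ≈-refl
  ... | no _     = nothing

  open Algebra.Solver.Ring ℚ.+-*-rawRing (fromCommutativeRing commutativeRing) ι-morphism ι-≟
    using (solve; con; _:=_; _:+_; _:*_; _:-_; :-_)

  ιℕ : ℕ → C
  ιℕ n = ι (+ n ℚ./ 1)

  1ᴿ 2ᴿ 4ᴿ : C
  1ᴿ = ι 1ℚ
  2ᴿ = ι (+ 2 ℚ./ 1)
  4ᴿ = ι (+ 4 ℚ./ 1)

  ιℕ-suc : ∀ n → ιℕ (suc n) ≈ ιℕ n + 1ᴿ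
  ιℕ-suc n = ≈-trans (reflexive (cong ι (grid-suc 0 n))) (ι-+ (grid 0 n) 1ℚ)

  ιℕ-nonNeg : ∀ n → 0# ≤ ιℕ n
  ιℕ-nonNeg n = ≤-trans (≤-reflexive (≈-sym ι-0)) (ι-mono-≤ (0≤grid 0 n))

  -- Reduces an inequality to a certificate: a visibly nonnegative difference and a ring identity
  -- for the solver.
  ≤-from-+ : ∀ {x y d} → 0# ≤ d → x + d ≈ y → x ≤ y
  ≤-from-+ {x} 0≤d e = ≤-trans (≤-reflexive (≈-sym (+-identityʳ x)))
    (≤-trans (+-mono-≤ ≤-refl 0≤d) (≤-reflexive e))

  0≤y-x : ∀ {x y} → x ≤ y → 0# ≤ y - x
  0≤y-x {x} x≤y = ≤-trans (≤-reflexive (≈-sym (-‿inverseʳ x))) (+-mono-≤ x≤y ≤-refl)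

  +-nonNeg : ∀ {x y} → 0# ≤ x → 0# ≤ y → 0# ≤ x + y
  +-nonNeg 0≤x 0≤y = ≤-trans (≤-reflexive (≈-sym (+-identityʳ 0#))) (+-mono-≤ 0≤x 0≤y)

  *-monoˡ-≤ : ∀ {c x y} → 0# ≤ c → x ≤ y → c * x ≤ c * y
  *-monoˡ-≤ {c} {x} {y} 0≤c x≤y = ≤-from-+ (*-nonNeg 0≤c (0≤y-x x≤y))
    (solve 3 (λ c x y → c :* x :+ c :* (y :- x) := c :* y) ≈-refl c x y)

  0≤1 : 0# ≤ 1ᴿ
  0≤1 = ιℕ-nonNeg 1

  1ᴿ*x≈x : ∀ x → 1ᴿ * x ≈ x
  1ᴿ*x≈x x = ≈-trans (*-congʳ ι-1) (*-identityˡ x)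

  1≤* : ∀ {x y} → 1ᴿ ≤ x → 1ᴿ ≤ y → 1ᴿ ≤ x * y
  1≤* {x} {y} 1≤x 1≤y = ≤-trans 1≤x (≤-trans
    (≤-reflexive (≈-sym (≈-trans (*-comm x 1ᴿ) (1ᴿ*x≈x x)))) (*-monoˡ-≤ (≤-trans 0≤1 1≤x) 1≤y))

  *-cancelˡ-≈ : ∀ {c x y} → 1ᴿ ≤ c → c * x ≈ c * y → x ≈ y
  *-cancelˡ-≈ 1≤c e = antisym (*-cancelˡ-≤ 1≤c (≤-reflexive e))
    (*-cancelˡ-≤ 1≤c (≤-reflexive (≈-sym e)))

  ιℕ-+ : ∀ m n → ιℕ (m ℕ.+ n) ≈ ιℕ m + ιℕ n
  ιℕ-+ zero    n = ≈-trans (≈-sym (+-identityˡ _)) (+-congʳ (≈-sym ι-0))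
  ιℕ-+ (suc m) n = begin
    ιℕ (suc (m ℕ.+ n))    ≈⟨ ιℕ-suc (m ℕ.+ n) ⟩
    ιℕ (m ℕ.+ n) + 1ᴿ     ≈⟨ +-congʳ (ιℕ-+ m n) ⟩
    ιℕ m + ιℕ n + 1ᴿ      ≈⟨ solve 3 (λ x y z → x :+ y :+ z := x :+ z :+ y) ≈-refl (ιℕ m) (ιℕ n) 1ᴿ ⟩
    ιℕ m + 1ᴿ + ιℕ n      ≈⟨ +-congʳ (ιℕ-suc m) ⟨
    ιℕ (suc m) + ιℕ n     ∎
    where open ≈-Reasoning

  ιℕ-mono-≤ : ∀ {m n} → m ℕ.≤ n → ιℕ m ≤ ιℕ n
  ιℕ-mono-≤ {m} {n} m≤n = ≤-from-+ (ιℕ-nonNeg (n ℕ.∸ m))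
    (≈-trans (≈-sym (ιℕ-+ m (n ℕ.∸ m))) (reflexive (cong ιℕ (ℕ.m+[n∸m]≡n m≤n))))

  sum-mono-≤ : ∀ {n} {f g : Vector C n} → (∀ i → f i ≤ g i) → sum f ≤ sum g
  sum-mono-≤ {zero}  h = ≤-refl
  sum-mono-≤ {suc n} h = +-mono-≤ (h zero) (sum-mono-≤ (h ∘ suc))

  sum-nonNeg : ∀ {n} {f : Vector C n} → (∀ i → 0# ≤ f i) → 0# ≤ sum f
  sum-nonNeg {n} h = ≤-trans (≤-reflexive (≈-sym (sum-replicate-zero n))) (sum-mono-≤ h)

  sum-const : ∀ n x → sum {n} (λ _ → x) ≈ ιℕ n * x
  sum-const zero    x = ≈-sym (≈-trans (*-congʳ ι-0) (zeroˡ x))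
  sum-const (suc n) x = begin
    x + sum {n} (λ _ → x)   ≈⟨ +-cong (≈-sym (1ᴿ*x≈x x)) (sum-const n x) ⟩
    1ᴿ * x + ιℕ n * x       ≈⟨ solve 3 (λ a b x → a :* x :+ b :* x := (b :+ a) :* x) ≈-refl 1ᴿ (ιℕ n) x ⟩
    (ιℕ n + 1ᴿ) * x         ≈⟨ *-congʳ (ιℕ-suc n) ⟨
    ιℕ (suc n) * x          ∎
    where open ≈-Reasoning

  -- Squared Euclidean distances

  squaredDifference : ∀ {n} → Vector C n → Vector C n → Vector C n
  squaredDifference u v i = (u i - v i) * (u i - v i)

  dist² : ∀ {n} → Vector C n → Vector C n → C
  dist² u v = sum (squaredDifference u v)

  dist²-nonNeg : ∀ {n} (u v : Vector C n) → 0# ≤ dist² u v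
  dist²-nonNeg u v = sum-nonNeg λ i → square-nonNeg (u i - v i)

  dist²-sym : ∀ {n} (u v : Vector C n) → dist² u v ≈ dist² v u
  dist²-sym u v = sum-cong-≋ λ i →
    solve 2 (λ x y → (x :- y) :* (x :- y) := (y :- x) :* (y :- x)) ≈-refl (u i) (v i)

  dist²-refl : ∀ {n} (u : Vector C n) → dist² u u ≈ 0#
  dist²-refl {n} u = ≈-trans (sum-cong-≋ λ i →
    ≈-trans (*-congʳ (-‿inverseʳ (u i))) (zeroˡ _)) (sum-replicate-zero n)

  -- In each coordinate, sides minus diagonals is the square of (a - b) + (c - d).
  quadrilateral : ∀ {n} (a b c d : Vector C n) →
    dist² a c + dist² b d ≤ (dist² a b + dist² b c) + (dist² c d + dist² d a)
  quadrilateral a b c d = begin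
    dist² a c + dist² b d  ≈⟨ ∑-distrib-+ (sq a c) (sq b d) ⟨
    sum (λ i → sq a c i + sq b d i)
      ≤⟨ sum-mono-≤ (λ i → ≤-from-+ (square-nonNeg ((a i - b i) + (c i - d i)))
           (four-point (a i) (b i) (c i) (d i))) ⟩
    sum (λ i → (sq a b i + sq b c i) + (sq c d i + sq d a i))
      ≈⟨ ∑-distrib-+ (λ i → sq a b i + sq b c i) (λ i → sq c d i + sq d a i) ⟩
    sum (λ i → sq a b i + sq b c i) + sum (λ i → sq c d i + sq d a i)
      ≈⟨ +-cong (∑-distrib-+ (sq a b) (sq b c)) (∑-distrib-+ (sq c d) (sq d a)) ⟩
    (dist² a b + dist² b c) + (dist² c d + dist² d a) ∎
    where
    open ≤-Reasoning
    sq : ∀ {n} → Vector C n → Vector C n → Vector C n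
    sq = squaredDifference
    four-point : ∀ a b c d →
      (a - c) * (a - c) + (b - d) * (b - d) + ((a - b) + (c - d)) * ((a - b) + (c - d))
      ≈ ((a - b) * (a - b) + (b - c) * (b - c)) + ((c - d) * (c - d) + (d - a) * (d - a))
    four-point = solve 4 (λ a b c d →
      (a :- c) :* (a :- c) :+ (b :- d) :* (b :- d) :+ ((a :- b) :+ (c :- d)) :* ((a :- b) :+ (c :- d))
      := ((a :- b) :* (a :- b) :+ (b :- c) :* (b :- c)) :+ ((c :- d) :* (c :- d) :+ (d :- a) :* (d :- a))) ≈-refl

  -- This is the degenerate quadrilateral a, b, c, b.
  dist²-triangle : ∀ {n} (a b c : Vector C n) →
    dist² a c ≤ 2ᴿ * dist² a b + 2ᴿ * dist² b c
  dist²-triangle a b c = begin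
    dist² a c                          ≈⟨ +-identityʳ _ ⟨
    dist² a c + 0#                     ≈⟨ +-congˡ (dist²-refl b) ⟨
    dist² a c + dist² b b              ≤⟨ quadrilateral a b c b ⟩
    (dist² a b + dist² b c) + (dist² c b + dist² b a)
      ≈⟨ +-congˡ (+-cong (dist²-sym c b) (dist²-sym b a)) ⟩
    (dist² a b + dist² b c) + (dist² b c + dist² a b)
      ≈⟨ solve 2 (λ x y → (x :+ y) :+ (y :+ x) := con (+ 2 ℚ./ 1) :* x :+ con (+ 2 ℚ./ 1) :* y) ≈-refl
           (dist² a b) (dist² b c) ⟩
    2ᴿ * dist² a b + 2ᴿ * dist² b c ∎
    where open ≤-Reasoning

  dist²-scale : ∀ {n} t (u v : Vector C n) →
    dist² (λ i → t * u i) (λ i → t * v i) ≈ t * t * dist² u v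
  dist²-scale t u v = ≈-trans
    (sum-cong-≋ λ i → solve 3 (λ t x y →
      (t :* x :- t :* y) :* (t :* x :- t :* y) := t :* t :* ((x :- y) :* (x :- y))) ≈-refl t (u i) (v i))
    (≈-sym (*-distribˡ-sum (t * t) (λ i → (u i - v i) * (u i - v i))))

  -- Sums over the Boolean cube and Enflo's inequality

  sumᶜ : ∀ n → (Vec Bool n → C) → C
  sumᶜ zero    f = f []
  sumᶜ (suc n) f = sumᶜ n (f ∘ (false ∷_)) + sumᶜ n (f ∘ (true ∷_))

  sumᶜ-mono-≤ : ∀ n {f g : Vec Bool n → C} → (∀ x → f x ≤ g x) → sumᶜ n f ≤ sumᶜ n g
  sumᶜ-mono-≤ zero    h = h []
  sumᶜ-mono-≤ (suc n) h = +-mono-≤ (sumᶜ-mono-≤ n (h ∘ (false ∷_))) (sumᶜ-mono-≤ n (h ∘ (true ∷_)))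

  sumᶜ-+ : ∀ n (f g : Vec Bool n → C) → sumᶜ n (λ x → f x + g x) ≈ sumᶜ n f + sumᶜ n g
  sumᶜ-+ zero    f g = ≈-refl
  sumᶜ-+ (suc n) f g = ≈-trans (+-cong (sumᶜ-+ n _ _) (sumᶜ-+ n _ _))
    (solve 4 (λ a b c d → (a :+ b) :+ (c :+ d) := (a :+ c) :+ (b :+ d)) ≈-refl _ _ _ _)

  -- The number 2^n of vertices stays an unevaluated sum of ones; it is only ever cancelled, for
  -- which `1≤sumᶜ` is enough.
  sumᶜ-const : ∀ n x → sumᶜ n (λ _ → x) ≈ sumᶜ n (λ _ → 1ᴿ) * x
  sumᶜ-const zero    x = ≈-sym (1ᴿ*x≈x x)
  sumᶜ-const (suc n) x = ≈-trans (+-cong (sumᶜ-const n x) (sumᶜ-const n x)) (≈-sym (distribʳ x _ _))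

  1≤sumᶜ : ∀ n → 1ᴿ ≤ sumᶜ n (λ _ → 1ᴿ)
  1≤sumᶜ zero    = ≤-refl
  1≤sumᶜ (suc n) = ≤-from-+ (+-nonNeg (0≤y-x (1≤sumᶜ n)) (≤-trans 0≤1 (1≤sumᶜ n)))
    (solve 2 (λ o s → o :+ ((s :- o) :+ s) := s :+ s) ≈-refl 1ᴿ _)

  -- Enflo's inequality, by applying the quadrilateral inequality to the points
  -- 0x, 1x, 1x′, 0x′, where x′ is antipodal to x.
  diagonals≤edges : ∀ n {N} (f : Vec Bool n → Vector C N) E →
    (∀ x y → hammingᵇ x y ≡ 1 → dist² (f x) (f y) ≤ E) →
    sumᶜ n (λ x → dist² (f x) (f (Vec.map not x))) ≤ sumᶜ n (λ _ → ιℕ n * E)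
  diagonals≤edges zero    f E edge = ≤-reflexive (begin
    dist² (f []) (f []) ≈⟨ dist²-refl (f []) ⟩
    0#                  ≈⟨ zeroˡ E ⟨
    0# * E              ≈⟨ *-congʳ ι-0 ⟨
    ιℕ 0 * E            ∎)
    where open ≈-Reasoning
  diagonals≤edges (suc n) f E edge = begin
    sumᶜ n (λ x → dist² (g x) (h (x ′))) + sumᶜ n (λ x → dist² (h x) (g (x ′)))
      ≈⟨ sumᶜ-+ n _ _ ⟨
    sumᶜ n (λ x → dist² (g x) (h (x ′)) + dist² (h x) (g (x ′)))
      ≤⟨ sumᶜ-mono-≤ n side ⟩
    sumᶜ n (λ x → (E + E) + (dist² (g x) (g (x ′)) + dist² (h x) (h (x ′))))
      ≈⟨ ≈-trans (sumᶜ-+ n _ _) (+-congˡ (sumᶜ-+ n _ _)) ⟩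
    sumᶜ n (λ _ → E + E) + (sumᶜ n (λ x → dist² (g x) (g (x ′))) + sumᶜ n (λ x → dist² (h x) (h (x ′))))
      ≤⟨ +-mono-≤ ≤-refl (+-mono-≤
           (diagonals≤edges n g E (λ x y → edge (false ∷ x) (false ∷ y)))
           (diagonals≤edges n h E (λ x y → edge (true ∷ x) (true ∷ y)))) ⟩
    sumᶜ n (λ _ → E + E) + (sumᶜ n (λ _ → ιℕ n * E) + sumᶜ n (λ _ → ιℕ n * E))
      ≈⟨ +-cong (sumᶜ-const n _) (+-cong (sumᶜ-const n _) (sumᶜ-const n _)) ⟩
    S * (E + E) + (S * (ιℕ n * E) + S * (ιℕ n * E))
      ≈⟨ solve 3 (λ S n E → S :* (E :+ E) :+ (S :* (n :* E) :+ S :* (n :* E))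
           := S :* ((n :+ con 1ℚ) :* E) :+ S :* ((n :+ con 1ℚ) :* E)) ≈-refl S (ιℕ n) E ⟩
    S * ((ιℕ n + 1ᴿ) * E) + S * ((ιℕ n + 1ᴿ) * E)
      ≈⟨ +-cong (*-congˡ (*-congʳ (ιℕ-suc n))) (*-congˡ (*-congʳ (ιℕ-suc n))) ⟨
    S * (ιℕ (suc n) * E) + S * (ιℕ (suc n) * E)
      ≈⟨ +-cong (sumᶜ-const n _) (sumᶜ-const n _) ⟨
    sumᶜ n (λ _ → ιℕ (suc n) * E) + sumᶜ n (λ _ → ιℕ (suc n) * E) ∎
    where
    open ≤-Reasoning
    _′ : ∀ {n} → Vec Bool n → Vec Bool n
    x ′ = Vec.map not x
    g h : Vec Bool n → Vector C _
    g x = f (false ∷ x)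
    h x = f (true ∷ x)
    S : C
    S = sumᶜ n (λ _ → 1ᴿ)
    -- Two of the four sides are cube edges and cost E each; the other two are diagonals of opposite
    -- facets, left to the induction.
    side : ∀ x → dist² (g x) (h (x ′)) + dist² (h x) (g (x ′))
      ≤ (E + E) + (dist² (g x) (g (x ′)) + dist² (h x) (h (x ′)))
    side x = begin
      dist² (g x) (h (x ′)) + dist² (h x) (g (x ′))
        ≤⟨ quadrilateral (g x) (h x) (h (x ′)) (g (x ′)) ⟩
      (dist² (g x) (h x) + dist² (h x) (h (x ′))) + (dist² (h (x ′)) (g (x ′)) + dist² (g (x ′)) (g x))
        ≤⟨ +-mono-≤ (+-mono-≤ (edge _ _ (cong suc (hamming-refl Bool._≟_ x))) ≤-refl)
             (+-mono-≤ (edge _ _ (cong suc (hamming-refl Bool._≟_ (x ′))))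
               (≤-reflexive (dist²-sym (g (x ′)) (g x)))) ⟩
      (E + dist² (h x) (h (x ′))) + (E + dist² (g x) (g (x ′)))
        ≈⟨ solve 3 (λ E a b → (E :+ b) :+ (E :+ a) := (E :+ E) :+ (a :+ b)) ≈-refl E _ _ ⟩
      (E + E) + (dist² (g x) (g (x ′)) + dist² (h x) (h (x ′))) ∎

  -- Summing over all x gives 2^n n² ≤ 2^n n E, and both 2^n and n cancel. At n = 0 there is no n to
  -- cancel, and 0 ≤ E is the claim.
  cube-distortion : ∀ n {N} (f : Vec Bool n → Vector C N) E → 0# ≤ E →
    (∀ x y → hammingᵇ x y ≡ 1 → dist² (f x) (f y) ≤ E) →
    (∀ x → ιℕ n * ιℕ n ≤ dist² (f x) (f (Vec.map not x))) →
    ιℕ n ≤ E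
  cube-distortion zero    f E 0≤E edge diagonal = ≤-trans (≤-reflexive ι-0) 0≤E
  cube-distortion (suc n) f E 0≤E edge diagonal =
    *-cancelˡ-≤ (ιℕ-mono-≤ (s≤s (z≤n {n}))) (*-cancelˡ-≤ (1≤sumᶜ (suc n)) (begin
      sumᶜ (suc n) (λ _ → 1ᴿ) * (ιℕ (suc n) * ιℕ (suc n)) ≈⟨ sumᶜ-const (suc n) _ ⟨
      sumᶜ (suc n) (λ _ → ιℕ (suc n) * ιℕ (suc n))        ≤⟨ sumᶜ-mono-≤ (suc n) diagonal ⟩
      sumᶜ (suc n) (λ x → dist² (f x) (f (Vec.map not x))) ≤⟨ diagonals≤edges (suc n) f E edge ⟩
      sumᶜ (suc n) (λ _ → ιℕ (suc n) * E)                 ≈⟨ sumᶜ-const (suc n) _ ⟩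
      sumᶜ (suc n) (λ _ → 1ᴿ) * (ιℕ (suc n) * E)          ∎))
    where open ≤-Reasoning

  -- Double sums and the Kronecker delta

  sum₂ : ∀ {n} → (Fin n → Fin n → C) → C
  sum₂ F = sum λ i → sum λ j → F i j

  sum₂-cong : ∀ {n} {F G : Fin n → Fin n → C} → (∀ i j → F i j ≈ G i j) → sum₂ F ≈ sum₂ G
  sum₂-cong h = sum-cong-≋ λ i → sum-cong-≋ (h i)

  sum₂-mono-≤ : ∀ {n} {F G : Fin n → Fin n → C} → (∀ i j → F i j ≤ G i j) → sum₂ F ≤ sum₂ G
  sum₂-mono-≤ h = sum-mono-≤ λ i → sum-mono-≤ (h i)

  sum₂-+ : ∀ {n} (F G : Fin n → Fin n → C) → sum₂ (λ i j → F i j + G i j) ≈ sum₂ F + sum₂ G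
  sum₂-+ F G = ≈-trans (sum-cong-≋ λ i → ∑-distrib-+ (F i) (G i)) (∑-distrib-+ (sum ∘ F) (sum ∘ G))

  sum₂-* : ∀ {n} c (F : Fin n → Fin n → C) → sum₂ (λ i j → c * F i j) ≈ c * sum₂ F
  sum₂-* c F = ≈-trans (sum-cong-≋ λ i → ≈-sym (*-distribˡ-sum c (F i)))
    (≈-sym (*-distribˡ-sum c (λ i → sum (F i))))

  sum₂-sum : ∀ {m n} (F : Fin n → Fin n → Fin m → C) →
    sum₂ (λ i j → sum (F i j)) ≈ sum (λ c → sum₂ (λ i j → F i j c))
  sum₂-sum F = ≈-trans (sum-cong-≋ λ i → ∑-comm (F i)) (∑-comm (λ i c → sum λ j → F i j c))

  sum₂-const : ∀ n x → sum₂ {n} (λ _ _ → x) ≈ ιℕ n * (ιℕ n * x)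
  sum₂-const n x = ≈-trans (sum-cong-≋ {n} λ _ → sum-const n x) (sum-const n _)

  sum-*-sum : ∀ {n} (f g : Vector C n) → sum f * sum g ≈ sum₂ (λ i j → f i * g j)
  sum-*-sum f g = ≈-trans (*-distribʳ-sum (sum g) f) (sum-cong-≋ λ i → *-distribˡ-sum (f i) g)

  δ : ∀ {n} → Fin n → Fin n → C
  δ i j = if does (i Fin.≟ j) then 1ᴿ else 0#

  δ-refl : ∀ {n} (i : Fin n) → δ i i ≈ 1ᴿ
  δ-refl zero    = ≈-refl
  δ-refl (suc i) = δ-refl i

  δ-≢ : ∀ {n} {i j : Fin n} → i ≢ j → δ i j ≈ 0#
  δ-≢ {i = i} {j} i≢j with i Fin.≟ j
  ... | yes i≡j = contradiction i≡j i≢j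
  ... | no _    = ≈-refl

  sum-0 : ∀ {n} {f : Vector C n} → (∀ i → f i ≈ 0#) → sum f ≈ 0#
  sum-0 {n} h = ≈-trans (sum-cong-≋ h) (sum-replicate-zero n)

  sum-δ : ∀ {n} i (f : Vector C n) → sum (λ j → δ i j * f j) ≈ f i
  sum-δ zero f = ≈-trans (+-cong (1ᴿ*x≈x (f zero)) (sum-0 λ j → zeroˡ (f (suc j)))) (+-identityʳ _)
  sum-δ (suc i) f = ≈-trans (+-cong (zeroˡ (f zero)) (sum-δ i (f ∘ suc))) (+-identityˡ _)

  sum-δ-1 : ∀ {n} (i : Fin n) → sum (λ j → δ i j) ≈ 1ᴿ
  sum-δ-1 {suc n} zero = ≈-trans (+-congˡ (sum-0 {n} λ _ → ≈-refl)) (+-identityʳ _)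
  sum-δ-1 {suc n} (suc i) = ≈-trans (+-identityˡ _) (sum-δ-1 i)

  sum₂-δ : ∀ n x → sum₂ {n} (λ i j → δ i j * x) ≈ ιℕ n * x
  sum₂-δ n x = ≈-trans (sum-cong-≋ {n} λ i → sum-δ i (λ _ → x)) (sum-const n x)

  -- Spectral matrices of a strongly regular graph

  -- For a strongly regular graph with adjacency matrix a and eigenvalues k, r, s,
  -- matrix r is a positive multiple of the projection onto the s-eigenspace, and
  -- matrix s a negative multiple of the projection onto the r-eigenspace.
  module StronglyRegular {N : ℕ} (a : Fin N → Fin N → C) (k μ : C)
    (a-sym : ∀ i j → a i j ≈ a j i)
    (a-irrefl : ∀ i → a i i ≈ 0#)
    (a-row : ∀ i → sum (a i) ≈ k) where

    ν : C
    ν = ιℕ N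

    -- a² = (k − μ) I + (λ − μ) a + μ J, with rs = μ − k and r + s = λ − μ.
    HasEigenvalues : C → C → Set
    HasEigenvalues r s = ∀ i j →
      sum (λ z → a i z * a j z) ≈ - (r * s) * δ i j + (r + s) * a i j + μ

    swap-eigenvalues : ∀ {r s} → HasEigenvalues r s → HasEigenvalues s r
    swap-eigenvalues h i j = ≈-trans (h i j)
      (+-congʳ (+-cong (*-congʳ (-‿cong (*-comm _ _))) (*-congʳ (+-comm _ _))))

    -- This is ν(θI - A) + (k - θ)J. The coefficient of J makes the row sums vanish, so for an
    -- eigenvalue θ the matrix kills the all-ones vector and the θ-eigenspace, and on the remaining
    -- eigenspace, of eigenvalue σ, it multiplies by ν(θ - σ).
    matrix : C → Fin N → Fin N → C
    matrix θ i j = ν * θ * δ i j + (- ν) * a i j + (k - θ)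

    δ-sym : ∀ (i j : Fin N) → δ i j ≈ δ j i
    δ-sym i j with i Fin.≟ j
    ... | yes refl = ≈-sym (δ-refl i)
    ... | no i≢j   = ≈-sym (δ-≢ (i≢j ∘ sym))

    matrix-sym : ∀ θ i j → matrix θ i j ≈ matrix θ j i
    matrix-sym θ i j = +-congʳ (+-cong (*-congˡ (δ-sym i j)) (*-congˡ (a-sym i j)))

    matrix-row : ∀ θ i → sum (matrix θ i) ≈ 0#
    matrix-row θ i = begin
      sum (λ j → ν * θ * δ i j + (- ν) * a i j + (k - θ))
        ≈⟨ ≈-trans (∑-distrib-+ {N} _ _) (+-congʳ (∑-distrib-+ {N} _ _)) ⟩
      sum (λ j → ν * θ * δ i j) + sum (λ j → (- ν) * a i j) + sum {N} (λ _ → k - θ)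
        ≈⟨ +-cong (+-cong (≈-sym (*-distribˡ-sum (ν * θ) (δ i))) (≈-sym (*-distribˡ-sum (- ν) (a i))))
             (sum-const N (k - θ)) ⟩
      ν * θ * sum (δ i) + (- ν) * sum (a i) + ν * (k - θ)
        ≈⟨ +-congʳ (+-cong (*-congˡ (≈-trans (sum-δ-1 i) ι-1)) (*-congˡ (a-row i))) ⟩
      ν * θ * 1# + (- ν) * k + ν * (k - θ)
        ≈⟨ +-congʳ (+-congʳ (*-identityʳ _)) ⟩
      ν * θ + (- ν) * k + ν * (k - θ)
        ≈⟨ solve 3 (λ ν θ k → ν :* θ :+ (:- ν) :* k :+ ν :* (k :- θ) := con 0ℚ) ≈-refl ν θ k ⟩
      ι 0ℚ ≈⟨ ι-0 ⟩
      0# ∎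
      where open ≈-Reasoning

    -- Applying the equation for A² to the all-ones vector gives k² = -rs + (r + s)k + νμ. The index
    -- selects the row that is summed.
    νμ≈ : ∀ {r s} → HasEigenvalues r s → Fin N → ν * μ ≈ (k - r) * (k - s)
    νμ≈ {r} {s} square i = begin
      ν * μ
        ≈⟨ solve 5 (λ ν μ k r s → ν :* μ := (:- (r :* s) :+ (r :+ s) :* k :+ ν :* μ) :+ (r :* s :- (r :+ s) :* k))
             ≈-refl ν μ k r s ⟩
      (- (r * s) + (r + s) * k + ν * μ) + (r * s - (r + s) * k)
        ≈⟨ +-congʳ (≈-trans (≈-sym right) left) ⟩
      k * k + (r * s - (r + s) * k)
        ≈⟨ solve 3 (λ k r s → k :* k :+ (r :* s :- (r :+ s) :* k) := (k :- r) :* (k :- s)) ≈-refl k r s ⟩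
      (k - r) * (k - s) ∎
      where
      open ≈-Reasoning
      left : sum (λ j → sum (λ z → a i z * a j z)) ≈ k * k
      left = begin
        sum (λ j → sum (λ z → a i z * a j z))  ≈⟨ ∑-comm (λ j z → a i z * a j z) ⟩
        sum (λ z → sum (λ j → a i z * a j z))
          ≈⟨ sum-cong-≋ (λ z → ≈-trans (≈-sym (*-distribˡ-sum (a i z) (λ j → a j z)))
               (*-congˡ (≈-trans (sum-cong-≋ λ j → a-sym j z) (a-row z)))) ⟩
        sum (λ z → a i z * k)                  ≈⟨ *-distribʳ-sum k (a i) ⟨
        sum (a i) * k                          ≈⟨ *-congʳ (a-row i) ⟩
        k * k                                  ∎
      right : sum (λ j → sum (λ z → a i z * a j z)) ≈ - (r * s) + (r + s) * k + ν * μ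
      right = begin
        sum (λ j → sum (λ z → a i z * a j z))  ≈⟨ sum-cong-≋ (square i) ⟩
        sum (λ j → - (r * s) * δ i j + (r + s) * a i j + μ)
          ≈⟨ ≈-trans (∑-distrib-+ {N} _ _) (+-congʳ (∑-distrib-+ {N} _ _)) ⟩
        sum (λ j → - (r * s) * δ i j) + sum (λ j → (r + s) * a i j) + sum {N} (λ _ → μ)
          ≈⟨ +-cong (+-cong (≈-sym (*-distribˡ-sum (- (r * s)) (δ i))) (≈-sym (*-distribˡ-sum (r + s) (a i))))
               (sum-const N μ) ⟩
        - (r * s) * sum (δ i) + (r + s) * sum (a i) + ν * μ
          ≈⟨ +-congʳ (+-cong (≈-trans (*-congˡ (≈-trans (sum-δ-1 i) ι-1)) (*-identityʳ _)) (*-congˡ (a-row i))) ⟩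
        - (r * s) + (r + s) * k + ν * μ ∎

    -- The matrix is ν(r - s) times a projection. Expanding with the equation for A² leaves a defect
    -- ν(νμ - (k - r)(k - s)), which `νμ≈` removes.
    matrix-square : ∀ {r s} → HasEigenvalues r s → ∀ i j →
      sum (λ z → matrix r i z * matrix r j z) ≈ ν * (r - s) * matrix r i j
    matrix-square {r} {s} square i j = begin
      sum (λ z → matrix r i z * matrix r j z)
        -- The expansion pulls each δ to the front of its term, so that `sum-δ` collapses these
        -- sums; what remains are the row sums, the common-neighbour sum and a constant.
        ≈⟨ sum-cong-≋ (λ z → expand α β γ (δ i z) (δ j z) (a i z) (a j z)) ⟩
      sum (λ z → δ i z * (α * matrix r j z) + (δ j z * (α * (β * a i z + γ))
        + (β * β * (a i z * a j z) + (β * γ * a i z + (β * γ * a j z + γ * γ)))))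
        ≈⟨ ≈-trans (∑-distrib-+ {N} _ _) (+-cong (sum-δ i _)
             (≈-trans (∑-distrib-+ {N} _ _) (+-cong (sum-δ j _)
               (≈-trans (∑-distrib-+ {N} _ _) (+-cong (scaled (β * β) (square i j))
                 (≈-trans (∑-distrib-+ {N} _ _) (+-cong (scaled (β * γ) (a-row i))
                   (≈-trans (∑-distrib-+ {N} _ _) (+-cong (scaled (β * γ) (a-row j)) (sum-const N (γ * γ))))))))))) ⟩
      α * matrix r j i + (α * (β * a i j + γ)
        + (β * β * (- (r * s) * δ i j + (r + s) * a i j + μ) + (β * γ * k + (β * γ * k + ν * (γ * γ)))))
        ≈⟨ +-congʳ (*-congˡ (matrix-sym r j i)) ⟩
      α * matrix r i j + (α * (β * a i j + γ)
        + (β * β * (- (r * s) * δ i j + (r + s) * a i j + μ) + (β * γ * k + (β * γ * k + ν * (γ * γ)))))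
        ≈⟨ collect ν k μ r s (δ i j) (a i j) ⟩
      ν * (r - s) * matrix r i j + ν * (ν * μ - (k - r) * (k - s))
        ≈⟨ +-congˡ (≈-trans (*-congˡ (≈-trans (+-congʳ (νμ≈ square i)) (-‿inverseʳ _))) (zeroʳ ν)) ⟩
      ν * (r - s) * matrix r i j + 0#
        ≈⟨ +-identityʳ _ ⟩
      ν * (r - s) * matrix r i j ∎
      where
      open ≈-Reasoning
      α β γ : C
      α = ν * r
      β = - ν
      γ = k - r
      scaled : ∀ c {f : Vector C N} {x} → sum f ≈ x → sum (λ z → c * f z) ≈ c * x
      scaled c {f} e = ≈-trans (≈-sym (*-distribˡ-sum c f)) (*-congˡ e)
      expand : ∀ α β γ d e x y → (α * d + β * x + γ) * (α * e + β * y + γ)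
        ≈ d * (α * (α * e + β * y + γ)) + (e * (α * (β * x + γ))
          + (β * β * (x * y) + (β * γ * x + (β * γ * y + γ * γ))))
      expand = solve 7 (λ α β γ d e x y → (α :* d :+ β :* x :+ γ) :* (α :* e :+ β :* y :+ γ)
        := d :* (α :* (α :* e :+ β :* y :+ γ)) :+ (e :* (α :* (β :* x :+ γ))
          :+ (β :* β :* (x :* y) :+ (β :* γ :* x :+ (β :* γ :* y :+ γ :* γ))))) ≈-refl
      collect : ∀ ν k μ r s d x →
        let α = ν * r ; β = - ν ; γ = k - r ; m = ν * r * d + (- ν) * x + (k - r) in
        α * m + (α * (β * x + γ)
          + (β * β * (- (r * s) * d + (r + s) * x + μ) + (β * γ * k + (β * γ * k + ν * (γ * γ)))))
        ≈ ν * (r - s) * m + ν * (ν * μ - (k - r) * (k - s))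
      collect = solve 7 (λ ν k μ r s d x →
        let α = ν :* r ; β = :- ν ; γ = k :- r ; m = ν :* r :* d :+ (:- ν) :* x :+ (k :- r) in
        α :* m :+ (α :* (β :* x :+ γ)
          :+ (β :* β :* (:- (r :* s) :* d :+ (r :+ s) :* x :+ μ) :+ (β :* γ :* k :+ (β :* γ :* k :+ ν :* (γ :* γ)))))
        := ν :* (r :- s) :* m :+ ν :* (ν :* μ :- (k :- r) :* (k :- s))) ≈-refl

    matrix-diagonal : ∀ θ i → matrix θ i i ≈ ν * θ + (k - θ)
    matrix-diagonal θ i = +-congʳ (≈-trans
      (+-cong (≈-trans (*-congˡ (≈-trans (δ-refl i) ι-1)) (*-identityʳ _)) (≈-trans (*-congˡ (a-irrefl i)) (zeroʳ _)))
      (+-identityʳ _))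

    matrix-offDiagonal : ∀ θ {i j} → i ≢ j → matrix θ i j ≈ (- ν) * a i j + (k - θ)
    matrix-offDiagonal θ i≢j = +-congʳ (≈-trans (+-congʳ (≈-trans (*-congˡ (δ-≢ i≢j)) (zeroʳ _))) (+-identityˡ _))

    -- By `matrix-square` with the eigenvalues exchanged, the rows of `matrix s` have Gram matrix
    -- ν(s - r) times `matrix s`. The distance thus depends on two diagonal entries and one
    -- off-diagonal entry, the latter fixed by adjacency.
    row-dist² : ∀ {r s} → HasEigenvalues r s → ∀ {i j} → i ≢ j →
      dist² (matrix s i) (matrix s j) ≈ 2ᴿ * (ν * ν) * (r - s) * (- s - a i j)
    row-dist² {r} {s} square {i} {j} i≢j = begin
      sum (λ z → (m i z - m j z) * (m i z - m j z))
        ≈⟨ sum-cong-≋ (λ z → solve 2 (λ x y → (x :- y) :* (x :- y)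
             := (x :* x :+ y :* y) :+ (:- con (+ 2 ℚ./ 1)) :* (x :* y)) ≈-refl (m i z) (m j z)) ⟩
      sum (λ z → (m i z * m i z + m j z * m j z) + (- 2ᴿ) * (m i z * m j z))
        ≈⟨ ≈-trans (∑-distrib-+ {N} _ _) (+-cong (∑-distrib-+ {N} _ _) (≈-sym (*-distribˡ-sum {N} (- 2ᴿ) _))) ⟩
      (sum (λ z → m i z * m i z) + sum (λ z → m j z * m j z)) + (- 2ᴿ) * sum (λ z → m i z * m j z)
        ≈⟨ +-cong (+-cong (sq i i) (sq j j)) (*-congˡ (sq i j)) ⟩
      (ν * (s - r) * m i i + ν * (s - r) * m j j) + (- 2ᴿ) * (ν * (s - r) * m i j)
        ≈⟨ +-cong (+-cong (*-congˡ (matrix-diagonal s i)) (*-congˡ (matrix-diagonal s j)))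
             (*-congˡ (*-congˡ (matrix-offDiagonal s i≢j))) ⟩
      (ν * (s - r) * (ν * s + (k - s)) + ν * (s - r) * (ν * s + (k - s)))
        + (- 2ᴿ) * (ν * (s - r) * ((- ν) * a i j + (k - s)))
        ≈⟨ solve 5 (λ ν r s k x →
             (ν :* (s :- r) :* (ν :* s :+ (k :- s)) :+ ν :* (s :- r) :* (ν :* s :+ (k :- s)))
               :+ (:- con (+ 2 ℚ./ 1)) :* (ν :* (s :- r) :* ((:- ν) :* x :+ (k :- s)))
             := con (+ 2 ℚ./ 1) :* (ν :* ν) :* (r :- s) :* (:- s :- x)) ≈-refl ν r s k (a i j) ⟩
      2ᴿ * (ν * ν) * (r - s) * (- s - a i j) ∎
      where
      open ≈-Reasoning
      m : Fin N → Fin N → C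
      m = matrix s
      sq : ∀ i j → sum (λ z → m i z * m j z) ≈ ν * (s - r) * m i j
      sq = matrix-square (swap-eigenvalues square)

    -- Expanding the square, the terms in f i alone and in f j alone vanish because rows and columns
    -- sum to zero.
    matrix-form : ∀ θ (f : Vector C N) → sum₂ (λ i j → matrix θ i j * ((f i - f j) * (f i - f j)))
      ≈ (- 2ᴿ) * sum₂ (λ i j → matrix θ i j * (f i * f j))
    matrix-form θ f = begin
      sum₂ (λ i j → m i j * ((f i - f j) * (f i - f j)))
        ≈⟨ sum₂-cong (λ i j → solve 3 (λ m x y → m :* ((x :- y) :* (x :- y))
             := m :* (x :* x) :+ (m :* (y :* y) :+ (:- con (+ 2 ℚ./ 1)) :* (m :* (x :* y))))
             ≈-refl (m i j) (f i) (f j)) ⟩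
      sum₂ (λ i j → m i j * (f i * f i) + (m i j * (f j * f j) + (- 2ᴿ) * (m i j * (f i * f j))))
        ≈⟨ ≈-trans (sum₂-+ {N} _ _) (+-congˡ (≈-trans (sum₂-+ {N} _ _) (+-congˡ (sum₂-* {N} (- 2ᴿ) _)))) ⟩
      sum₂ (λ i j → m i j * (f i * f i)) + (sum₂ (λ i j → m i j * (f j * f j)) + (- 2ᴿ) * Q)
        ≈⟨ +-cong row (+-congʳ (≈-trans (∑-comm (λ i j → m i j * (f j * f j)))
             (≈-trans (sum₂-cong λ i j → *-congʳ (matrix-sym θ j i)) row))) ⟩
      0# + (0# + (- 2ᴿ) * Q)
        ≈⟨ ≈-trans (+-identityˡ _) (+-identityˡ _) ⟩
      (- 2ᴿ) * Q ∎
      where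
      open ≈-Reasoning
      m : Fin N → Fin N → C
      m = matrix θ
      Q : C
      Q = sum₂ (λ i j → m i j * (f i * f j))
      row : sum₂ (λ i j → m i j * (f i * f i)) ≈ 0#
      row = sum-0 λ i → ≈-trans (≈-sym (*-distribʳ-sum (f i * f i) (m i)))
        (≈-trans (*-congʳ (matrix-row θ i)) (zeroˡ _))

    -- With M for `matrix r`, the squared norm of Mf is the quadratic form of M² at f, a multiple of
    -- the form of M. This exhibits M as positive semidefinite when ν(r - s) ≥ 1.
    matrix-sumOfSquares : ∀ {r s} → HasEigenvalues r s → ∀ (f : Vector C N) →
      sum (λ z → sum (λ i → matrix r i z * f i) * sum (λ i → matrix r i z * f i))
      ≈ ν * (r - s) * sum₂ (λ i j → matrix r i j * (f i * f j))
    matrix-sumOfSquares {r} {s} square f = begin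
      sum (λ z → sum (λ i → m i z * f i) * sum (λ i → m i z * f i))
        ≈⟨ sum-cong-≋ (λ z → sum-*-sum (λ i → m i z * f i) (λ i → m i z * f i)) ⟩
      sum (λ z → sum₂ (λ i j → (m i z * f i) * (m j z * f j)))
        ≈⟨ sum₂-sum (λ i j z → (m i z * f i) * (m j z * f j)) ⟨
      sum₂ (λ i j → sum (λ z → (m i z * f i) * (m j z * f j)))
        ≈⟨ sum₂-cong (λ i j → ≈-trans (sum-cong-≋ λ z →
             solve 4 (λ m x n y → (m :* x) :* (n :* y) := (m :* n) :* (x :* y)) ≈-refl (m i z) (f i) (m j z) (f j))
             (≈-trans (≈-sym (*-distribʳ-sum (f i * f j) (λ z → m i z * m j z)))
               (≈-trans (*-congʳ (matrix-square square i j)) (*-assoc _ _ _)))) ⟩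
      sum₂ (λ i j → ν * (r - s) * (m i j * (f i * f j)))
        ≈⟨ sum₂-* {N} _ _ ⟩
      ν * (r - s) * sum₂ (λ i j → m i j * (f i * f j)) ∎
      where
      open ≈-Reasoning
      m : Fin N → Fin N → C
      m = matrix r

    matrix-energy≤0 : ∀ {r s} → HasEigenvalues r s → 1ᴿ ≤ ν → 1ᴿ ≤ r - s → ∀ (f : Vector C N) →
      sum₂ (λ i j → matrix r i j * ((f i - f j) * (f i - f j))) ≤ 0#
    matrix-energy≤0 {r} {s} square 1≤ν 1≤r-s f = begin
      sum₂ (λ i j → matrix r i j * ((f i - f j) * (f i - f j))) ≈⟨ matrix-form r f ⟩
      (- 2ᴿ) * Q      ≤⟨ ≤-from-+ (*-nonNeg (ιℕ-nonNeg 2) 0≤Q)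
                           (≈-trans (solve 2 (λ t q → (:- t) :* q :+ t :* q := con 0ℚ) ≈-refl 2ᴿ Q) ι-0) ⟩
      0#              ∎
      where
      open ≤-Reasoning
      Q : C
      Q = sum₂ (λ i j → matrix r i j * (f i * f j))
      0≤Q : 0# ≤ Q
      0≤Q = *-cancelˡ-≤ (1≤* 1≤ν 1≤r-s) (begin
        ν * (r - s) * 0#  ≈⟨ zeroʳ _ ⟩
        0#                ≤⟨ sum-nonNeg (λ z → square-nonNeg (sum (λ i → matrix r i z * f i))) ⟩
        _                 ≈⟨ matrix-sumOfSquares square f ⟩
        ν * (r - s) * Q   ∎)

    -- The sign of each entry of `matrix r` selects the usable bound: on edges the entry -(ν - k +
    -- r) calls for the upper bound E, elsewhere off the diagonal k - r calls for the lower bound 4.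
    -- A row has k entries of the first kind and ν - k - 1 of the second.
    distortion-bound : ∀ {r s} → HasEigenvalues r s → 1ᴿ ≤ ν → 1ᴿ ≤ r - s →
      0# ≤ k - r → 0# ≤ ν - k + r → ∀ {d} (ϱ : Fin N → Vector C d) E →
      (∀ {i j} → i ≢ j → (a i j ≈ 1ᴿ × dist² (ϱ i) (ϱ j) ≤ E) ⊎ (a i j ≈ 0# × 4ᴿ ≤ dist² (ϱ i) (ϱ j))) →
      4ᴿ * (ν - k - 1ᴿ) * (k - r) ≤ k * (ν - k + r) * E
    distortion-bound {r} {s} square 1≤ν 1≤r-s 0≤k-r 0≤ν-k+r {d} ϱ E sep =
      ≤-from-+ (0≤y-x total≤0) (≈-trans (+-congˡ (+-congʳ (≈-sym ι-0)))
        (solve 5 (λ n k r E f → f :* (n :- k :- con 1ℚ) :* (k :- r)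
          :+ (con 0ℚ :- (f :* (n :- k :- con 1ℚ) :* (k :- r) :- k :* (n :- k :+ r) :* E))
          := k :* (n :- k :+ r) :* E) ≈-refl ν k r E 4ᴿ))
      where
      open ≤-Reasoning
      D : Fin N → Fin N → C
      D i j = dist² (ϱ i) (ϱ j)
      A B : C
      A = 4ᴿ * (k - r)
      B = (ν - k + r) * E
      -- The combination of 1, δ and a with value 0 on the diagonal, -B on edges and A on
      -- nonadjacent pairs; in this form its total follows from row sums.
      weight : Fin N → Fin N → C
      weight i j = A + ((- A) * δ i j + (- (A + B)) * a i j)
      pointwise : ∀ i j → weight i j ≤ matrix r i j * D i j
      pointwise i j with i Fin.≟ j
      ... | yes refl = ≤-reflexive (begin-equality
        A + ((- A) * 1ᴿ + (- (A + B)) * a i i)  ≈⟨ +-congˡ (+-congˡ (*-congˡ (≈-trans (a-irrefl i) (≈-sym ι-0)))) ⟩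
        A + ((- A) * 1ᴿ + (- (A + B)) * ι 0ℚ)
          ≈⟨ solve 2 (λ a b → a :+ ((:- a) :* con 1ℚ :+ (:- (a :+ b)) :* con 0ℚ) := con 0ℚ) ≈-refl A B ⟩
        ι 0ℚ                                    ≈⟨ ι-0 ⟩
        0#                                      ≈⟨ zeroʳ _ ⟨
        (ν * r * 1ᴿ + (- ν) * a i i + (k - r)) * 0# ≈⟨ *-congˡ (dist²-refl (ϱ i)) ⟨
        (ν * r * 1ᴿ + (- ν) * a i i + (k - r)) * D i i ∎)
      ... | no i≢j with sep i≢j
      ... | inj₁ (a≈1 , D≤E) = begin
        A + ((- A) * 0# + (- (A + B)) * a i j)  ≈⟨ +-congˡ (+-cong (*-congˡ (≈-sym ι-0)) (*-congˡ a≈1)) ⟩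
        A + ((- A) * ι 0ℚ + (- (A + B)) * 1ᴿ)
          ≈⟨ solve 2 (λ a b → a :+ ((:- a) :* con 0ℚ :+ (:- (a :+ b)) :* con 1ℚ) := :- b) ≈-refl A B ⟩
        - ((ν - k + r) * E)                     ≤⟨ ≤-from-+ (*-nonNeg 0≤ν-k+r (0≤y-x D≤E))
          (solve 5 (λ n k r E D → :- ((n :- k :+ r) :* E) :+ (n :- k :+ r) :* (E :- D)
            := (n :* r :* con 0ℚ :+ (:- n) :* con 1ℚ :+ (k :- r)) :* D) ≈-refl ν k r E (D i j)) ⟩
        (ν * r * ι 0ℚ + (- ν) * 1ᴿ + (k - r)) * D i j
          ≈⟨ *-congʳ (+-congʳ (+-cong (*-congˡ ι-0) (*-congˡ (≈-sym a≈1)))) ⟩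
        (ν * r * 0# + (- ν) * a i j + (k - r)) * D i j ∎
      ... | inj₂ (a≈0 , 4≤D) = begin
        A + ((- A) * 0# + (- (A + B)) * a i j)
          ≈⟨ +-congˡ (+-cong (*-congˡ (≈-sym ι-0)) (*-congˡ (≈-trans a≈0 (≈-sym ι-0)))) ⟩
        A + ((- A) * ι 0ℚ + (- (A + B)) * ι 0ℚ)
          ≈⟨ solve 2 (λ a b → a :+ ((:- a) :* con 0ℚ :+ (:- (a :+ b)) :* con 0ℚ) := a) ≈-refl A B ⟩
        4ᴿ * (k - r)
          ≤⟨ ≤-from-+ (*-nonNeg 0≤k-r (0≤y-x 4≤D))
            (solve 5 (λ n k r f D → f :* (k :- r) :+ (k :- r) :* (D :- f)
              := (n :* r :* con 0ℚ :+ (:- n) :* con 0ℚ :+ (k :- r)) :* D) ≈-refl ν k r 4ᴿ (D i j)) ⟩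
        (ν * r * ι 0ℚ + (- ν) * ι 0ℚ + (k - r)) * D i j
          ≈⟨ *-congʳ (+-congʳ (+-cong (*-congˡ ι-0) (*-congˡ (≈-trans ι-0 (≈-sym a≈0))))) ⟩
        (ν * r * 0# + (- ν) * a i j + (k - r)) * D i j ∎
      energy≤0 : sum₂ (λ i j → matrix r i j * D i j) ≤ 0#
      energy≤0 = begin
        sum₂ (λ i j → matrix r i j * D i j)
          ≈⟨ ≈-trans (sum₂-cong {N} λ i j → *-distribˡ-sum {d} (matrix r i j) _) (sum₂-sum {d} {N} _) ⟩
        sum (λ c → sum₂ (λ i j → matrix r i j * ((ϱ i c - ϱ j c) * (ϱ i c - ϱ j c))))
          ≤⟨ sum-mono-≤ {d} (λ c → matrix-energy≤0 square 1≤ν 1≤r-s (λ i → ϱ i c)) ⟩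
        sum {d} (λ _ → 0#)  ≈⟨ sum-0 {d} (λ _ → ≈-refl) ⟩
        0#                  ∎
      total : sum₂ weight ≈ ν * (4ᴿ * (ν - k - 1ᴿ) * (k - r) - k * (ν - k + r) * E)
      total = begin-equality
        sum₂ weight
          ≈⟨ ≈-trans (sum₂-+ {N} _ _) (+-cong (sum₂-const N A) (≈-trans (sum₂-+ {N} _ _)
               (+-cong (≈-trans (sum₂-cong {N} λ i j → *-comm (- A) (δ i j)) (sum₂-δ N (- A)))
                 (≈-trans (sum₂-* _ a) (*-congˡ (≈-trans (sum-cong-≋ a-row) (sum-const N k))))))) ⟩
        ν * (ν * A) + (ν * (- A) + (- (A + B)) * (ν * k))
          ≈⟨ solve 5 (λ n k r E f → let A = f :* (k :- r) ; B = (n :- k :+ r) :* E in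
               n :* (n :* A) :+ (n :* (:- A) :+ (:- (A :+ B)) :* (n :* k))
               := n :* (f :* (n :- k :- con 1ℚ) :* (k :- r) :- k :* (n :- k :+ r) :* E)) ≈-refl ν k r E 4ᴿ ⟩
        ν * (4ᴿ * (ν - k - 1ᴿ) * (k - r) - k * (ν - k + r) * E) ∎
      total≤0 : 4ᴿ * (ν - k - 1ᴿ) * (k - r) - k * (ν - k + r) * E ≤ 0#
      total≤0 = *-cancelˡ-≤ 1≤ν (begin
        _            ≈⟨ total ⟨
        sum₂ weight  ≤⟨ sum₂-mono-≤ pointwise ⟩
        sum₂ (λ i j → matrix r i j * D i j) ≤⟨ energy≤0 ⟩
        0#           ≈⟨ zeroʳ ν ⟨
        ν * 0#       ∎)

  -- Eigenvalue estimates and the extremal quotient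

  -- The bounds r ≥ 0 and s ≤ −1 come from comparing ρ² with (λ − μ)² and (λ − μ + 2)².
  module Eigenvalues (ν k l μ ρ : C) (0≤ρ : 0# ≤ ρ)
    (ρ² : ρ * ρ ≈ (l - μ) * (l - μ) + 4ᴿ * (k - μ))
    (0≤μ : 0# ≤ μ) (μ≤k : μ ≤ k) (l+1≤k : l + 1ᴿ ≤ k) (1≤k : 1ᴿ ≤ k) (k+1≤ν : k + 1ᴿ ≤ ν) where

    r s numerator denominator : C
    r = ι ½ * (l - μ + ρ)
    s = ι ½ * (l - μ - ρ)
    numerator = 4ᴿ * (ν - k - 1ᴿ) * (k - r)
    denominator = k * (ν - k + r)

    r+s≈ : r + s ≈ l - μ
    r+s≈ = solve 2 (λ w ρ → con ½ :* (w :+ ρ) :+ con ½ :* (w :- ρ) := w) ≈-refl (l - μ) ρ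

    -rs≈ : - (r * s) ≈ k - μ
    -rs≈ = begin
      - (r * s)
        ≈⟨ solve 2 (λ w ρ → :- ((con ½ :* (w :+ ρ)) :* (con ½ :* (w :- ρ)))
             := con (+ 1 ℚ./ 4) :* (ρ :* ρ :- w :* w)) ≈-refl (l - μ) ρ ⟩
      ι (+ 1 ℚ./ 4) * (ρ * ρ - (l - μ) * (l - μ))
        ≈⟨ *-congˡ (+-congʳ ρ²) ⟩
      ι (+ 1 ℚ./ 4) * ((l - μ) * (l - μ) + 4ᴿ * (k - μ) - (l - μ) * (l - μ))
        ≈⟨ solve 2 (λ w x → con (+ 1 ℚ./ 4) :* (w :* w :+ con (+ 4 ℚ./ 1) :* x :- w :* w) := x)
             ≈-refl (l - μ) (k - μ) ⟩
      k - μ ∎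
      where open ≈-Reasoning

    0≤half : ∀ {x} → 0# ≤ x → 0# ≤ ι ½ * x
    0≤half 0≤x = *-nonNeg (≤-trans (≤-reflexive (≈-sym ι-0)) (ι-mono-≤ (ℚ.<⇒≤ (ℚ.positive⁻¹ ½)))) 0≤x

    0≤r : 0# ≤ r
    0≤r = 0≤half (≤-trans (0≤y-x {x = - (l - μ)} (square-cancel-≤ 0≤ρ (begin
      - (l - μ) * - (l - μ)               ≤⟨ ≤-from-+ (*-nonNeg (ιℕ-nonNeg 4) (0≤y-x μ≤k))
        (solve 2 (λ w x → :- w :* :- w :+ x := w :* w :+ x) ≈-refl (l - μ) (4ᴿ * (k - μ))) ⟩
      (l - μ) * (l - μ) + 4ᴿ * (k - μ)    ≈⟨ ρ² ⟨
      ρ * ρ                               ∎)))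
      (≤-reflexive (solve 2 (λ w ρ → ρ :- :- w := w :+ ρ) ≈-refl (l - μ) ρ)))
      where open ≤-Reasoning

    1≤-s : 1ᴿ ≤ - s
    1≤-s = ≤-from-+ (0≤half (0≤y-x (square-cancel-≤ {l - μ + 2ᴿ} 0≤ρ (begin
      (l - μ + 2ᴿ) * (l - μ + 2ᴿ)         ≤⟨ ≤-from-+ (*-nonNeg (ιℕ-nonNeg 4) (0≤y-x l+1≤k))
        (solve 3 (λ l μ k → (l :- μ :+ con (+ 2 ℚ./ 1)) :* (l :- μ :+ con (+ 2 ℚ./ 1))
            :+ con (+ 4 ℚ./ 1) :* (k :- (l :+ con 1ℚ))
          := (l :- μ) :* (l :- μ) :+ con (+ 4 ℚ./ 1) :* (k :- μ)) ≈-refl l μ k) ⟩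
      (l - μ) * (l - μ) + 4ᴿ * (k - μ)    ≈⟨ ρ² ⟨
      ρ * ρ                               ∎))))
      (solve 2 (λ w ρ → con 1ℚ :+ con ½ :* (ρ :- (w :+ con (+ 2 ℚ./ 1))) := :- (con ½ :* (w :- ρ)))
        ≈-refl (l - μ) ρ)
      where open ≤-Reasoning

    1≤r-s : 1ᴿ ≤ r - s
    1≤r-s = ≤-trans 1≤-s (≤-from-+ 0≤r (+-comm (- s) r))

    1≤ν : 1ᴿ ≤ ν
    1≤ν = ≤-trans (≤-from-+ (≤-trans 0≤1 1≤k) (+-comm 1ᴿ k)) k+1≤ν

    1≤ν-k+r : 1ᴿ ≤ ν - k + r
    1≤ν-k+r = ≤-from-+ (+-nonNeg (0≤y-x k+1≤ν) 0≤r)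
      (solve 3 (λ n k r → con 1ℚ :+ ((n :- (k :+ con 1ℚ)) :+ r) := n :- k :+ r) ≈-refl ν k r)

    1≤denominator : 1ᴿ ≤ denominator
    1≤denominator = 1≤* 1≤k 1≤ν-k+r

    module _ (νμ : ν * μ ≈ (k - r) * (k - s)) where

      -- The product (k - r)(k - s) = νμ is nonnegative, and its second factor is at least 1.
      0≤k-r : 0# ≤ k - r
      0≤k-r = *-cancelˡ-≤ 1≤k-s (begin
        (k - s) * 0#       ≈⟨ zeroʳ _ ⟩
        0#                 ≤⟨ *-nonNeg (≤-trans 0≤1 1≤ν) 0≤μ ⟩
        ν * μ              ≈⟨ νμ ⟩
        (k - r) * (k - s)  ≈⟨ *-comm _ _ ⟩
        (k - s) * (k - r)  ∎)
        where
        open ≤-Reasoning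
        1≤k-s : 1ᴿ ≤ k - s
        1≤k-s = ≤-trans 1≤-s (≤-from-+ (≤-trans 0≤1 1≤k) (+-comm (- s) k))

      0≤numerator : 0# ≤ numerator
      0≤numerator = *-nonNeg (*-nonNeg (ιℕ-nonNeg 4) (≤-trans (0≤y-x k+1≤ν)
        (≤-reflexive (solve 3 (λ n k o → n :- (k :+ o) := n :- k :- o) ≈-refl ν k 1ᴿ)))) 0≤k-r

      -- This is where the two bounds meet: the quotient becomes 4(-s - 1)/(-s), which the rows of
      -- `matrix s` realise. The two sides differ by 4(ν(k + rs) - (k - r)(k - s)), which vanishes
      -- because k + rs = μ.
      numerator-denominator : (- s) * numerator ≈ 4ᴿ * (- s - 1ᴿ) * denominator
      numerator-denominator = begin
        (- s) * numerator
          ≈⟨ solve 4 (λ n k r s → (:- s) :* (con (+ 4 ℚ./ 1) :* (n :- k :- con 1ℚ) :* (k :- r))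
               := con (+ 4 ℚ./ 1) :* (:- s :- con 1ℚ) :* (k :* (n :- k :+ r))
                 :+ con (+ 4 ℚ./ 1) :* (n :* (k :- (:- (r :* s))) :- (k :- r) :* (k :- s))) ≈-refl ν k r s ⟩
        4ᴿ * (- s - 1ᴿ) * denominator + 4ᴿ * (ν * (k - - (r * s)) - (k - r) * (k - s))
          ≈⟨ +-congˡ (*-congˡ (+-congʳ (≈-trans (*-congˡ (≈-trans (+-congˡ (-‿cong -rs≈))
               (solve 2 (λ k μ → k :- (k :- μ) := μ) ≈-refl k μ))) νμ))) ⟩
        4ᴿ * (- s - 1ᴿ) * denominator + 4ᴿ * ((k - r) * (k - s) - (k - r) * (k - s))
          ≈⟨ ≈-trans (+-congˡ (≈-trans (*-congˡ (-‿inverseʳ _)) (zeroʳ _))) (+-identityʳ _) ⟩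
        4ᴿ * (- s - 1ᴿ) * denominator ∎
        where open ≈-Reasoning

      -- Here T is the squared scale and P is 2ν²(r - s): the scale that puts nonadjacent vertices
      -- at squared distance 4 puts adjacent ones at E. Division by -s and by the denominator is
      -- replaced by cancelling their product.
      adjacent-scale : ∀ {T P E} → T * (P * - s) ≈ 4ᴿ → denominator * E ≈ numerator →
        T * (P * (- s - 1ᴿ)) ≈ E
      adjacent-scale {T} {P} {E} T-scale E-def = *-cancelˡ-≈ (1≤* 1≤-s 1≤denominator) (begin
        (- s) * denominator * (T * (P * (- s - 1ᴿ)))
          ≈⟨ solve 5 (λ z d T P u → z :* d :* (T :* (P :* u)) := (T :* (P :* z)) :* u :* d)
               ≈-refl (- s) denominator T P (- s - 1ᴿ) ⟩
        (T * (P * - s)) * (- s - 1ᴿ) * denominator  ≈⟨ *-congʳ (*-congʳ T-scale) ⟩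
        4ᴿ * (- s - 1ᴿ) * denominator               ≈⟨ numerator-denominator ⟨
        (- s) * numerator                           ≈⟨ *-congˡ E-def ⟨
        (- s) * (denominator * E)                   ≈⟨ *-assoc _ _ _ ⟨
        (- s) * denominator * E                     ∎)
        where open ≈-Reasoning

  -- Quotients, indicators and counting

  *-quotient : ∀ {c i} x → c * i ≈ 1ᴿ → c * (x * i) ≈ x
  *-quotient {c} {i} x ci≈1 = begin
    c * (x * i)  ≈⟨ solve 3 (λ c x i → c :* (x :* i) := c :* i :* x) ≈-refl c x i ⟩
    c * i * x    ≈⟨ *-congʳ ci≈1 ⟩
    1ᴿ * x       ≈⟨ 1ᴿ*x≈x x ⟩
    x            ∎
    where open ≈-Reasoning

  quotient-nonNeg : ∀ {c i x} → 1ᴿ ≤ c → c * i ≈ 1ᴿ → 0# ≤ x → 0# ≤ x * i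
  quotient-nonNeg {c} {i} {x} 1≤c ci≈1 0≤x = *-cancelˡ-≤ 1≤c (begin
    c * 0#       ≈⟨ zeroʳ c ⟩
    0#           ≤⟨ 0≤x ⟩
    x            ≈⟨ *-quotient x ci≈1 ⟨
    c * (x * i)  ∎)
    where open ≤-Reasoning

  indicator : {P : Set} → Dec P → C
  indicator P? = if does P? then 1ᴿ else 0#

  0≤indicator : {P : Set} (P? : Dec P) → 0# ≤ indicator P?
  0≤indicator (yes _) = 0≤1
  0≤indicator (no _)  = ≤-refl

  indicator≤1 : {P : Set} (P? : Dec P) → indicator P? ≤ 1ᴿ
  indicator≤1 (yes _) = ≤-refl
  indicator≤1 (no _)  = 0≤1

  indicator-yes : {P : Set} (P? : Dec P) → P → indicator P? ≈ 1ᴿ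
  indicator-yes (yes _) _ = ≈-refl
  indicator-yes (no ¬p) p = contradiction p ¬p

  indicator-no : {P : Set} (P? : Dec P) → ¬ P → indicator P? ≈ 0#
  indicator-no (yes p) ¬p = contradiction p ¬p
  indicator-no (no _)  _  = ≈-refl

  indicator-× : {P Q : Set} (P? : Dec P) (Q? : Dec Q) →
    indicator (P? ×-dec Q?) ≈ indicator P? * indicator Q?
  indicator-× (yes _) (yes _) = ≈-sym (1ᴿ*x≈x 1ᴿ)
  indicator-× (yes _) (no _)  = ≈-sym (zeroʳ _)
  indicator-× (no _)  _       = ≈-sym (zeroˡ _)

  indicator-⇔ : {P Q : Set} (P? : Dec P) (Q? : Dec Q) → (P → Q) → (Q → P) → indicator P? ≈ indicator Q?
  indicator-⇔ (yes p) Q? f g = ≈-sym (indicator-yes Q? (f p))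
  indicator-⇔ (no ¬p) Q? f g = ≈-sym (indicator-no Q? (¬p ∘ g))

  -- Connects the list counts behind degrees and common neighbours with sums of matrix entries.
  sum-indicator : ∀ {n} {A : Set} {P : A → Set} (P? : ∀ x → Dec (P x)) (f : Fin n → A) →
    sum (λ i → indicator (P? (f i))) ≈ ιℕ (length (filter P? (tabulate f)))
  sum-indicator {zero}  P? f = ≈-sym ι-0
  sum-indicator {suc n} P? f with does (P? (f zero))
  ... | true  = begin
    1ᴿ + sum (λ i → indicator (P? (f (suc i))))  ≈⟨ +-congˡ (sum-indicator P? (f ∘ suc)) ⟩
    1ᴿ + ιℕ c                                    ≈⟨ +-comm 1ᴿ (ιℕ c) ⟩
    ιℕ c + 1ᴿ                                    ≈⟨ ιℕ-suc c ⟨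
    ιℕ (suc c)                                   ∎
    where
    open ≈-Reasoning
    c : ℕ
    c = length (filter P? (tabulate (f ∘ suc)))
  ... | false = ≈-trans (+-congˡ (sum-indicator P? (f ∘ suc))) (+-identityˡ _)

  -- Distortion in terms of squared distances

  HasSquareDistortion : {X : Set} {N : ℕ} → (X → X → ℕ) → (X → Vector C N) → C → Set
  HasSquareDistortion d ϱ E = ∀ x y →
    ιℕ (d x y) * ιℕ (d x y) ≤ dist² (ϱ x) (ϱ y) × dist² (ϱ x) (ϱ y) ≤ E * (ιℕ (d x y) * ιℕ (d x y))

  1²≈ : ιℕ 1 * ιℕ 1 ≈ 1ᴿ
  1²≈ = 1ᴿ*x≈x 1ᴿ

  2²≈ : ιℕ 2 * ιℕ 2 ≈ 4ᴿ
  2²≈ = ≈-sym (ι-* (+ 2 ℚ./ 1) (+ 2 ℚ./ 1))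

  *1²≈ : ∀ E → E * (ιℕ 1 * ιℕ 1) ≈ E
  *1²≈ E = ≈-trans (*-congˡ 1²≈) (≈-trans (*-comm _ _) (1ᴿ*x≈x E))

  binaryEmbedding : ∀ {N} → C → Vec Bool N → Vector C N
  binaryEmbedding c u i = c * (if Vec.lookup u i then 1ᴿ else 0#)

  binaryEmbedding-dist² : ∀ {N} c (u v : Vec Bool N) →
    dist² (binaryEmbedding c u) (binaryEmbedding c v) ≈ c * c * ιℕ (hammingᵇ u v)
  binaryEmbedding-dist² c [] [] = ≈-sym (≈-trans (*-congˡ ι-0) (zeroʳ _))
  binaryEmbedding-dist² c (x ∷ u) (y ∷ v) = ≈-trans
    (+-cong (coordinate x y) (binaryEmbedding-dist² c u v))
    (≈-trans (≈-sym (distribˡ _ _ _)) (*-congˡ (≈-sym (ιℕ-+ (mismatch Bool._≟_ x y) (hammingᵇ u v)))))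
    where
    coordinate : ∀ x y → let b = λ z → if z then 1ᴿ else 0# in
      (c * b x - c * b y) * (c * b x - c * b y) ≈ c * c * ιℕ (mismatch Bool._≟_ x y)
    coordinate true true =
      solve 1 (λ c → (c :* con 1ℚ :- c :* con 1ℚ) :* (c :* con 1ℚ :- c :* con 1ℚ) := c :* c :* con 0ℚ) ≈-refl c
    coordinate false false = ≈-trans (≈-trans (*-congʳ (-‿inverseʳ _)) (zeroˡ _))
      (≈-sym (≈-trans (*-congˡ ι-0) (zeroʳ _)))
    coordinate true false = ≈-trans
      (*-cong (+-congˡ (-‿cong (*-congˡ (≈-sym ι-0)))) (+-congˡ (-‿cong (*-congˡ (≈-sym ι-0)))))
      (solve 1 (λ c → (c :* con 1ℚ :- c :* con 0ℚ) :* (c :* con 1ℚ :- c :* con 0ℚ) := c :* c :* con 1ℚ) ≈-refl c)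
    coordinate false true = ≈-trans
      (*-cong (+-congʳ (*-congˡ (≈-sym ι-0))) (+-congʳ (*-congˡ (≈-sym ι-0))))
      (solve 1 (λ c → (c :* con 0ℚ :- c :* con 1ℚ) :* (c :* con 0ℚ :- c :* con 1ℚ) := c :* c :* con 1ℚ) ≈-refl c)

  -- Points at distance e are mapped to points at squared distance n e, and e² ≤ n e ≤ n e².
  binaryEmbedding-distortion : ∀ {X : Set} {N} (d : X → X → ℕ) n (φ : X → Vec Bool N) →
    (∀ x y → hammingᵇ (φ x) (φ y) ≡ d x y ℕ.+ d x y) → (∀ x y → d x y ℕ.≤ n) →
    ∀ {c} → c * c ≈ ι ½ * ιℕ n → Σ[ ϱ ∈ (X → Vector C N) ] HasSquareDistortion d ϱ (ιℕ n)
  binaryEmbedding-distortion d n φ isometric d≤n {c} c² = (binaryEmbedding c ∘ φ) , λ x y →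
    let
      e = d x y
      open ≤-Reasoning
    in
    (begin
      ιℕ e * ιℕ e  ≤⟨ *-monoˡ-≤ (ιℕ-nonNeg e) (ιℕ-mono-≤ (d≤n x y)) ⟩
      ιℕ e * ιℕ n  ≈⟨ *-comm _ _ ⟩
      ιℕ n * ιℕ e  ≈⟨ distance x y ⟨
      dist² (binaryEmbedding c (φ x)) (binaryEmbedding c (φ y)) ∎) ,
    (begin
      dist² (binaryEmbedding c (φ x)) (binaryEmbedding c (φ y)) ≈⟨ distance x y ⟩
      ιℕ n * ιℕ e           ≤⟨ *-monoˡ-≤ (ιℕ-nonNeg n) (e≤e² e) ⟩
      ιℕ n * (ιℕ e * ιℕ e)  ∎)
    where
    distance : ∀ x y → dist² (binaryEmbedding c (φ x)) (binaryEmbedding c (φ y)) ≈ ιℕ n * ιℕ (d x y)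
    distance x y = begin
      dist² (binaryEmbedding c (φ x)) (binaryEmbedding c (φ y)) ≈⟨ binaryEmbedding-dist² c (φ x) (φ y) ⟩
      c * c * ιℕ (hammingᵇ (φ x) (φ y))
        ≈⟨ *-cong c² (≈-trans (reflexive (cong ιℕ (isometric x y))) (ιℕ-+ (d x y) (d x y))) ⟩
      ι ½ * ιℕ n * (ιℕ (d x y) + ιℕ (d x y))
        ≈⟨ solve 2 (λ n e → con ½ :* n :* (e :+ e) := n :* e) ≈-refl (ιℕ n) (ιℕ (d x y)) ⟩
      ιℕ n * ιℕ (d x y) ∎
      where open ≈-Reasoning
    e≤e² : ∀ e → ιℕ e ≤ ιℕ e * ιℕ e
    e≤e² zero    = ≤-reflexive (≈-trans ι-0 (≈-sym (≈-trans (*-congʳ ι-0) (zeroˡ _))))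
    e≤e² (suc e) = ≤-trans (≤-reflexive (≈-sym (≈-trans (*-comm _ _) (1ᴿ*x≈x _))))
      (*-monoˡ-≤ (ιℕ-nonNeg (suc e)) (ιℕ-mono-≤ (s≤s (z≤n {e}))))

  isometricCube-distortion : ∀ {X : Set} {N} (d : X → X → ℕ) n (γ : Vec Bool n → X) →
    (∀ x y → d (γ x) (γ y) ≡ hammingᵇ x y) →
    ∀ {ϱ : X → Vector C N} {E} → 0# ≤ E → HasSquareDistortion d ϱ E → ιℕ n ≤ E
  isometricCube-distortion d n γ isometric {ϱ} {E} 0≤E h = cube-distortion n (ϱ ∘ γ) E 0≤E
    (λ x y e → ≤-trans (proj₂ (h (γ x) (γ y)))
      (≤-reflexive (≈-trans (reflexive (cong (λ m → E * (ιℕ m * ιℕ m)) (trans (isometric x y) e))) (*1²≈ E))))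
    (λ x → ≤-trans (≤-reflexive (reflexive (sym (cong (λ m → ιℕ m * ιℕ m)
        (trans (isometric x (Vec.map not x)) (hamming-not x))))))
      (proj₁ (h (γ x) (γ (Vec.map not x)))))

  ≤-root : ∀ {σ S a} → 0# ≤ σ → σ * σ ≈ S → a * a ≤ S → a ≤ σ
  ≤-root 0≤σ σ² h = square-cancel-≤ 0≤σ (≤-trans h (≤-reflexive (≈-sym σ²)))

  square-mono-≤ : ∀ {x y} → 0# ≤ x → x ≤ y → x * x ≤ y * y
  square-mono-≤ 0≤x x≤y = ≤-trans (*-monoˡ-≤ 0≤x x≤y)
    (≤-trans (≤-reflexive (*-comm _ _)) (*-monoˡ-≤ (≤-trans 0≤x x≤y) x≤y))

  root-bounds⇒square-bounds : ∀ {a S σ D} → 0# ≤ a → 0# ≤ σ → σ * σ ≈ S →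
    a ≤ σ × σ ≤ D * a → a * a ≤ S × S ≤ D * D * (a * a)
  root-bounds⇒square-bounds {a} {D = D} 0≤a 0≤σ σ² (lo , hi) =
    ≤-trans (square-mono-≤ 0≤a lo) (≤-reflexive σ²) ,
    ≤-trans (≤-reflexive (≈-sym σ²)) (≤-trans (square-mono-≤ 0≤σ hi)
      (≤-reflexive (solve 2 (λ D a → (D :* a) :* (D :* a) := D :* D :* (a :* a)) ≈-refl D a)))

  square-bounds⇒root-bounds : ∀ {a S σ E D} → 0# ≤ a → 0# ≤ σ → 0# ≤ D → σ * σ ≈ S → D * D ≈ E →
    a * a ≤ S × S ≤ E * (a * a) → a ≤ σ × σ ≤ D * a
  square-bounds⇒root-bounds {a} {D = D} 0≤a 0≤σ 0≤D σ² D² (lo , hi) =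
    ≤-root 0≤σ σ² lo ,
    square-cancel-≤ (*-nonNeg 0≤D 0≤a) (≤-trans (≤-reflexive σ²) (≤-trans hi
      (≤-trans (≤-reflexive (*-congʳ (≈-sym D²)))
        (≤-reflexive (solve 2 (λ D a → D :* D :* (a :* a) := (D :* a) :* (D :* a)) ≈-refl D a)))))

  -- Strongly regular graphs of diameter two

  -- The pair at distance 2 is the source of the parameter inequalities: its nonadjacency gives μ ≤
  -- k, and the first edge towards its midpoint gives λ + 1 ≤ k.
  module StronglyRegularGraph (G : Graph) {k l m : ℕ}
    (srg : IsStronglyRegular G (Graph.order G) k l m)
    (d : Graph.Vertex G → Graph.Vertex G → ℕ) (metric : Graph.IsShortestPathMetric G d)
    (d≤2 : ∀ x y → d x y ℕ.≤ 2)
    {x₀ z₀ : Graph.Vertex G} (d₀≡2 : d x₀ z₀ ≡ 2) where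

    open Graph G
    open IsStronglyRegular srg
    open Inverse finite using (to; from; strictlyInverseˡ; strictlyInverseʳ)

    to-injective : ∀ {i j} → to i ≡ to j → i ≡ j
    to-injective {i} {j} e = trans (sym (strictlyInverseʳ i)) (trans (cong from e) (strictlyInverseʳ j))

    from-injective : ∀ {x y} → from x ≡ from y → x ≡ y
    from-injective {x} {y} e = trans (sym (strictlyInverseˡ x)) (trans (cong to e) (strictlyInverseˡ y))

    a : Fin order → Fin order → C
    a i j = indicator (adj? (to i) (to j))

    a-yes : ∀ {i j} → Adj (to i) (to j) → a i j ≈ 1ᴿ
    a-yes = indicator-yes (adj? _ _)

    a-no : ∀ {i j} → ¬ Adj (to i) (to j) → a i j ≈ 0#
    a-no = indicator-no (adj? _ _)

    count : {P : Vertex → Set} (P? : ∀ x → Dec (P x)) →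
      sum (λ i → indicator (P? (to i))) ≈ ιℕ (length (filter P? vertices))
    count P? = ≈-trans (sum-indicator P? to)
      (reflexive (cong (λ xs → ιℕ (length (filter P? xs))) (sym (map-tabulate id to))))

    a-sym : ∀ i j → a i j ≈ a j i
    a-sym i j = indicator-⇔ (adj? (to i) (to j)) (adj? (to j) (to i)) symm symm

    a-irrefl : ∀ i → a i i ≈ 0#
    a-irrefl i = a-no irrefl

    a-row : ∀ i → sum (a i) ≈ ιℕ k
    a-row i = ≈-trans (count (adj? (to i))) (reflexive (cong ιℕ (regular (to i))))

    a² : ∀ i j → sum (λ z → a i z * a j z) ≈ ιℕ (commonNeighbours (to i) (to j))
    a² i j = ≈-trans (sum-cong-≋ λ z → ≈-sym (indicator-× (adj? (to i) (to z)) (adj? (to j) (to z))))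
      (count (λ z → adj? (to i) z ×-dec adj? (to j) z))

    a-idempotent : ∀ i j → a i j * a i j ≈ a i j
    a-idempotent i j with adj? (to i) (to j)
    ... | yes _ = 1ᴿ*x≈x 1ᴿ
    ... | no _  = zeroʳ 0#

    open StronglyRegular a (ιℕ k) (ιℕ m) a-sym a-irrefl a-row public

    -- The entries of A² count common neighbours: k on the diagonal, λ on edges, μ elsewhere.
    hasEigenvalues : ∀ {r s} → r + s ≈ ιℕ l - ιℕ m → - (r * s) ≈ ιℕ k - ιℕ m → HasEigenvalues r s
    hasEigenvalues {r} {s} r+s -rs i j = ≈-trans (cases (i Fin.≟ j) (adj? (to i) (to j)))
      (+-congʳ (+-cong (*-congʳ (≈-sym -rs)) (*-congʳ (≈-sym r+s))))
      where
      open ≈-Reasoning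
      Claim : Set
      Claim = sum (λ z → a i z * a j z) ≈ (ιℕ k - ιℕ m) * δ i j + (ιℕ l - ιℕ m) * a i j + ιℕ m
      cases : Dec (i ≡ j) → Dec (Adj (to i) (to j)) → Claim
      cases (yes refl) _ = begin
        sum (λ z → a i z * a i z)  ≈⟨ ≈-trans (sum-cong-≋ (a-idempotent i)) (a-row i) ⟩
        ιℕ k
          ≈⟨ solve 3 (λ k l m → k := (k :- m) :* con 1ℚ :+ (l :- m) :* con 0ℚ :+ m) ≈-refl (ιℕ k) (ιℕ l) (ιℕ m) ⟩
        (ιℕ k - ιℕ m) * 1ᴿ + (ιℕ l - ιℕ m) * ι 0ℚ + ιℕ m
          ≈⟨ +-congʳ (+-cong (*-congˡ (≈-sym (δ-refl i))) (*-congˡ (≈-trans ι-0 (≈-sym (a-irrefl i))))) ⟩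
        (ιℕ k - ιℕ m) * δ i i + (ιℕ l - ιℕ m) * a i i + ιℕ m ∎
      cases (no i≢j) (yes adj) = begin
        sum (λ z → a i z * a j z)  ≈⟨ ≈-trans (a² i j) (reflexive (cong ιℕ (adjacent (to i) (to j) adj))) ⟩
        ιℕ l
          ≈⟨ solve 3 (λ k l m → l := (k :- m) :* con 0ℚ :+ (l :- m) :* con 1ℚ :+ m) ≈-refl (ιℕ k) (ιℕ l) (ιℕ m) ⟩
        (ιℕ k - ιℕ m) * ι 0ℚ + (ιℕ l - ιℕ m) * 1ᴿ + ιℕ m
          ≈⟨ +-congʳ (+-cong (*-congˡ (≈-trans ι-0 (≈-sym (δ-≢ i≢j)))) (*-congˡ (≈-sym (a-yes adj)))) ⟩
        (ιℕ k - ιℕ m) * δ i j + (ιℕ l - ιℕ m) * a i j + ιℕ m ∎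
      cases (no i≢j) (no ¬adj) = begin
        sum (λ z → a i z * a j z)
          ≈⟨ ≈-trans (a² i j) (reflexive (cong ιℕ (nonadjacent (to i) (to j) (i≢j ∘ to-injective) ¬adj))) ⟩
        ιℕ m
          ≈⟨ solve 3 (λ k l m → m := (k :- m) :* con 0ℚ :+ (l :- m) :* con 0ℚ :+ m) ≈-refl (ιℕ k) (ιℕ l) (ιℕ m) ⟩
        (ιℕ k - ιℕ m) * ι 0ℚ + (ιℕ l - ιℕ m) * ι 0ℚ + ιℕ m
          ≈⟨ +-congʳ (+-cong (*-congˡ (≈-trans ι-0 (≈-sym (δ-≢ i≢j)))) (*-congˡ (≈-trans ι-0 (≈-sym (a-no ¬adj))))) ⟩
        (ιℕ k - ιℕ m) * δ i j + (ιℕ l - ιℕ m) * a i j + ιℕ m ∎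

    data Relation (x y : Vertex) : Set where
      equal : x ≡ y → d x y ≡ 0 → Relation x y
      near  : x ≢ y → Adj x y → d x y ≡ 1 → Relation x y
      far   : x ≢ y → ¬ Adj x y → d x y ≡ 2 → Relation x y

    d-refl : ∀ x → d x x ≡ 0
    d-refl x = ℕ.n≤0⇒n≡0 (proj₂ (metric x x) stop)

    relation : ∀ x y → Relation x y
    relation x y = go (d x y) refl (d≤2 x y) (proj₁ (metric x y))
      where
      go : ∀ e → d x y ≡ e → e ℕ.≤ 2 → Path x y e → Relation x y
      go 0 e _ stop             = equal refl e
      go 1 e _ (step adj stop)  = near (λ { refl → irrefl adj }) adj e
      go 2 e _ _                = far
        (λ { refl → ℕ.0≢1+n (trans (sym (d-refl x)) e) })
        (λ adj → ℕ.<⇒≱ (s≤s (s≤s z≤n)) (subst (ℕ._≤ 1) e (proj₂ (metric x y) (step adj stop)))) e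
      go (suc (suc (suc _))) _ (s≤s (s≤s ())) _

    private
      two-steps : ∀ {x z} → Path x z 2 → ∃[ y ] Adj x y × Adj y z
      two-steps (step adj (step adj′ stop)) = _ , adj , adj′
      midpoint : ∃[ y ] Adj x₀ y × Adj y z₀
      midpoint = two-steps (subst (Path x₀ z₀) d₀≡2 (proj₁ (metric x₀ z₀)))
      y₀ : Vertex
      y₀ = proj₁ midpoint
      i₀ j₀ k₀ : Fin order
      i₀ = from x₀
      j₀ = from y₀
      k₀ = from z₀
      adj₀ : Adj (to i₀) (to j₀)
      adj₀ = subst₂ Adj (sym (strictlyInverseˡ x₀)) (sym (strictlyInverseˡ y₀)) (proj₁ (proj₂ midpoint))

    -- For f the indicator of common neighbours of i and j: these, together with j, are distinct
    -- neighbours of i, since f vanishes at j.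
    sum-a-δ≤ : ∀ {i j} → Adj (to i) (to j) → ∀ {f : Vector C order} →
      (∀ z → 0# ≤ f z) → (∀ z → f z ≤ a i z) → f j ≈ 0# → sum f + 1ᴿ ≤ ιℕ k
    sum-a-δ≤ {i} {j} adj {f} 0≤f f≤a fj≈0 = begin
      sum f + 1ᴿ               ≈⟨ +-congˡ (sum-δ-1 j) ⟨
      sum f + sum (δ j)        ≈⟨ ∑-distrib-+ f (δ j) ⟨
      sum (λ z → f z + δ j z)  ≤⟨ sum-mono-≤ pointwise ⟩
      sum (a i)                ≈⟨ a-row i ⟩
      ιℕ k                     ∎
      where
      open ≤-Reasoning
      pointwise : ∀ z → f z + δ j z ≤ a i z
      pointwise z with j Fin.≟ z
      ... | yes refl = ≤-reflexive (≈-trans (+-congʳ fj≈0) (≈-trans (+-identityˡ _) (≈-sym (a-yes adj))))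
      ... | no _     = ≤-trans (≤-reflexive (+-identityʳ _)) (f≤a z)

    a*a≤a : ∀ i j z → a i z * a j z ≤ a i z
    a*a≤a i j z = ≤-trans (*-monoˡ-≤ (0≤indicator (adj? (to i) (to z))) (indicator≤1 (adj? (to j) (to z))))
      (≤-reflexive (≈-trans (*-comm _ _) (1ᴿ*x≈x _)))

    l+1≤k : ιℕ l + 1ᴿ ≤ ιℕ k
    l+1≤k = ≤-trans
      (≤-reflexive (+-congʳ (≈-sym (≈-trans (a² i₀ j₀) (reflexive (cong ιℕ (adjacent _ _ adj₀)))))))
      (sum-a-δ≤ adj₀ (λ z → *-nonNeg (0≤indicator (adj? (to i₀) (to z))) (0≤indicator (adj? (to j₀) (to z))))
        (a*a≤a i₀ j₀) (≈-trans (*-congˡ (a-irrefl j₀)) (zeroʳ _)))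

    1≤k : 1ᴿ ≤ ιℕ k
    1≤k = ≤-trans (≤-from-+ (ιℕ-nonNeg l) (+-comm 1ᴿ (ιℕ l))) l+1≤k

    m≤k : ιℕ m ≤ ιℕ k
    m≤k with relation x₀ z₀
    ... | equal _ e = contradiction (trans (sym e) d₀≡2) λ ()
    ... | near _ _ e = contradiction (trans (sym e) d₀≡2) λ ()
    ... | far x≢z ¬adj _ = begin
      ιℕ m                          ≡⟨ cong ιℕ (nonadjacent x₀ z₀ x≢z ¬adj) ⟨
      ιℕ (commonNeighbours x₀ z₀)
        ≡⟨ cong ιℕ (cong₂ commonNeighbours (strictlyInverseˡ x₀) (strictlyInverseˡ z₀)) ⟨
      ιℕ (commonNeighbours (to i₀) (to k₀)) ≈⟨ a² i₀ k₀ ⟨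
      sum (λ z → a i₀ z * a k₀ z)   ≤⟨ sum-mono-≤ (a*a≤a i₀ k₀) ⟩
      sum (a i₀)                    ≈⟨ a-row i₀ ⟩
      ιℕ k                          ∎
      where open ≤-Reasoning

    k+1≤ν : ιℕ k + 1ᴿ ≤ ν
    k+1≤ν = begin
      ιℕ k + 1ᴿ                 ≈⟨ +-cong (a-row i₀) (sum-δ-1 i₀) ⟨
      sum (a i₀) + sum (δ i₀)   ≈⟨ ∑-distrib-+ (a i₀) (δ i₀) ⟨
      sum (λ z → a i₀ z + δ i₀ z) ≤⟨ sum-mono-≤ pointwise ⟩
      sum {order} (λ _ → 1ᴿ)    ≈⟨ sum-const order 1ᴿ ⟩
      ν * 1ᴿ                    ≈⟨ ≈-trans (*-comm _ _) (1ᴿ*x≈x ν) ⟩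
      ν                         ∎
      where
      open ≤-Reasoning
      pointwise : ∀ z → a i₀ z + δ i₀ z ≤ 1ᴿ
      pointwise z with i₀ Fin.≟ z
      ... | yes refl = ≤-reflexive (≈-trans (+-congʳ (a-irrefl i₀)) (+-identityˡ _))
      ... | no _     = ≤-trans (≤-reflexive (+-identityʳ _)) (indicator≤1 (adj? (to i₀) (to z)))

    discriminant : C
    discriminant = (ιℕ l - ιℕ m) * (ιℕ l - ιℕ m) + 4ᴿ * (ιℕ k - ιℕ m)

    0≤discriminant : 0# ≤ discriminant
    0≤discriminant = +-nonNeg (square-nonNeg _) (*-nonNeg (ιℕ-nonNeg 4) (0≤y-x m≤k))

    module Spectrum (ρ : C) (0≤ρ : 0# ≤ ρ) (ρ² : ρ * ρ ≈ discriminant) where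

      open Eigenvalues ν (ιℕ k) (ιℕ l) (ιℕ m) ρ 0≤ρ ρ² (ιℕ-nonNeg m) m≤k l+1≤k 1≤k k+1≤ν public

      eigenvalues : HasEigenvalues r s
      eigenvalues = hasEigenvalues r+s≈ -rs≈

      numerator≤ : ∀ {D} (ϱ : Vertex → Vector C D) {E} → HasSquareDistortion d ϱ E →
        numerator ≤ denominator * E
      numerator≤ ϱ {E} h = distortion-bound eigenvalues 1≤ν 1≤r-s (0≤k-r (νμ≈ eigenvalues i₀))
        (≤-trans 0≤1 1≤ν-k+r) (ϱ ∘ to) E λ {i} {j} i≢j → separation i≢j (relation (to i) (to j)) (h (to i) (to j))
        where
        separation : ∀ {i j} → i ≢ j → Relation (to i) (to j) →
          (ιℕ (d (to i) (to j)) * ιℕ (d (to i) (to j)) ≤ dist² (ϱ (to i)) (ϱ (to j))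
            × dist² (ϱ (to i)) (ϱ (to j)) ≤ E * (ιℕ (d (to i) (to j)) * ιℕ (d (to i) (to j)))) →
          (a i j ≈ 1ᴿ × dist² (ϱ (to i)) (ϱ (to j)) ≤ E) ⊎ (a i j ≈ 0# × 4ᴿ ≤ dist² (ϱ (to i)) (ϱ (to j)))
        separation i≢j (equal e _) _ = contradiction (to-injective e) i≢j
        separation i≢j (near _ adj e) (_ , le) rewrite e = inj₁ (a-yes adj , ≤-trans le (≤-reflexive (*1²≈ E)))
        separation i≢j (far _ ¬adj e) (le , _) rewrite e = inj₂ (a-no ¬adj , ≤-trans (≤-reflexive (≈-sym 2²≈)) le)

      spectralScale : C
      spectralScale = 2ᴿ * (ν * ν) * (r - s)

      1≤spectralScale*-s : 1ᴿ ≤ spectralScale * - s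
      1≤spectralScale*-s = 1≤* (1≤* (1≤* (ιℕ-mono-≤ (s≤s (z≤n {1}))) (1≤* 1≤ν 1≤ν)) 1≤r-s) 1≤-s

      spectralEmbedding : C → Vertex → Vector C order
      spectralEmbedding t x i = t * matrix s (from x) i

      0≤spectralNumerator : 0# ≤ numerator
      0≤spectralNumerator = 0≤numerator (νμ≈ eigenvalues i₀)

      quotient≤ : ∀ {D} (ϱ : Vertex → Vector C D) {E E′} → denominator * E ≈ numerator →
        HasSquareDistortion d ϱ E′ → E ≤ E′
      quotient≤ ϱ E-def h = *-cancelˡ-≤ 1≤denominator (≤-trans (≤-reflexive E-def) (numerator≤ ϱ h))

      module _ {t E : C} (t-scale : t * t * (spectralScale * - s) ≈ 4ᴿ) (E-def : denominator * E ≈ numerator) where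

        private
          ϱ : Vertex → Vector C order
          ϱ = spectralEmbedding t

        spectralEmbedding-dist² : ∀ {x y} → x ≢ y →
          dist² (ϱ x) (ϱ y) ≈ t * t * (spectralScale * (- s - a (from x) (from y)))
        spectralEmbedding-dist² {x} {y} x≢y = ≈-trans (dist²-scale t (matrix s (from x)) (matrix s (from y)))
          (*-congˡ (row-dist² eigenvalues (x≢y ∘ from-injective)))

        spectralEmbedding-near : ∀ {x y} → x ≢ y → Adj x y → dist² (ϱ x) (ϱ y) ≈ E
        spectralEmbedding-near {x} {y} x≢y adj = ≈-trans (spectralEmbedding-dist² x≢y) (≈-trans
          (*-congˡ (*-congˡ (+-congˡ (-‿cong (a-yes
            (subst₂ Adj (sym (strictlyInverseˡ x)) (sym (strictlyInverseˡ y)) adj))))))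
          (adjacent-scale (νμ≈ eigenvalues i₀) t-scale E-def))

        spectralEmbedding-far : ∀ {x y} → x ≢ y → ¬ Adj x y → dist² (ϱ x) (ϱ y) ≈ 4ᴿ
        spectralEmbedding-far {x} {y} x≢y ¬adj = ≈-trans (spectralEmbedding-dist² x≢y) (≈-trans
          (*-congˡ (*-congˡ (≈-trans (+-congˡ (-‿cong (≈-trans (a-no
            (¬adj ∘ subst₂ Adj (strictlyInverseˡ x) (strictlyInverseˡ y))) (≈-sym ι-0))))
            (solve 1 (λ s → :- s :- con 0ℚ := :- s) ≈-refl s))))
          t-scale)

        -- The embedded x₀ and z₀ have squared distance 4 and a common neighbour at squared distance
        -- E from each, so 4 ≤ 2E + 2E. The bound keeps edges from being contracted and makes 4
        -- admissible as an upper value at distance 2.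
        1≤E : 1ᴿ ≤ E
        1≤E = *-cancelˡ-≤ (ιℕ-mono-≤ (s≤s (z≤n {3}))) (begin
          4ᴿ * 1ᴿ                        ≈⟨ ≈-trans (*-comm _ _) (1ᴿ*x≈x 4ᴿ) ⟩
          4ᴿ                             ≤⟨ far₀ (relation x₀ z₀) ⟩
          dist² (ϱ x₀) (ϱ z₀)            ≤⟨ dist²-triangle (ϱ x₀) (ϱ y₀) (ϱ z₀) ⟩
          2ᴿ * dist² (ϱ x₀) (ϱ y₀) + 2ᴿ * dist² (ϱ y₀) (ϱ z₀)
            ≈⟨ +-cong (*-congˡ (adjacent-dist (proj₁ (proj₂ midpoint))))
                 (*-congˡ (adjacent-dist (proj₂ (proj₂ midpoint)))) ⟩
          2ᴿ * E + 2ᴿ * E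
            ≈⟨ solve 1 (λ E → con (+ 2 ℚ./ 1) :* E :+ con (+ 2 ℚ./ 1) :* E := con (+ 4 ℚ./ 1) :* E) ≈-refl E ⟩
          4ᴿ * E                         ∎)
          where
          open ≤-Reasoning
          adjacent-dist : ∀ {x y} → Adj x y → dist² (ϱ x) (ϱ y) ≈ E
          adjacent-dist adj = spectralEmbedding-near (λ { refl → irrefl adj }) adj
          far₀ : Relation x₀ z₀ → 4ᴿ ≤ dist² (ϱ x₀) (ϱ z₀)
          far₀ (equal _ e)      = contradiction (trans (sym e) d₀≡2) λ ()
          far₀ (near _ _ e)     = contradiction (trans (sym e) d₀≡2) λ ()
          far₀ (far x≢z ¬adj _) = ≤-reflexive (≈-sym (spectralEmbedding-far x≢z ¬adj))

        spectralEmbedding-distortion : Σ[ ϱ ∈ (Vertex → Vector C order) ] HasSquareDistortion d ϱ E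
        spectralEmbedding-distortion = ϱ , λ x y → cases x y (relation x y)
          where
          open ≤-Reasoning
          Bounds : Vertex → Vertex → ℕ → Set
          Bounds x y e = ιℕ e * ιℕ e ≤ dist² (ϱ x) (ϱ y) × dist² (ϱ x) (ϱ y) ≤ E * (ιℕ e * ιℕ e)
          cases : ∀ x y → Relation x y → Bounds x y (d x y)
          cases x y (equal refl e) = subst (Bounds x y) (sym e) (
           ≤-reflexive (≈-trans (≈-trans (*-congʳ ι-0) (zeroˡ _)) (≈-sym (dist²-refl (ϱ x)))) ,
           ≤-reflexive (≈-trans (dist²-refl (ϱ x))
             (≈-sym (≈-trans (*-congˡ (≈-trans (*-congʳ ι-0) (zeroˡ _))) (zeroʳ E)))))
          cases x y (near x≢y adj e) = subst (Bounds x y) (sym e) (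
           ≤-trans (≤-reflexive 1²≈) (≤-trans 1≤E (≤-reflexive (≈-sym (spectralEmbedding-near x≢y adj)))) ,
           ≤-reflexive (≈-trans (spectralEmbedding-near x≢y adj) (≈-sym (*1²≈ E))))
          cases x y (far x≢y ¬adj e) = subst (Bounds x y) (sym e) (
           ≤-reflexive (≈-trans 2²≈ (≈-sym (spectralEmbedding-far x≢y ¬adj))) ,
           (begin
             dist² (ϱ x) (ϱ y)      ≈⟨ spectralEmbedding-far x≢y ¬adj ⟩
             4ᴿ                     ≈⟨ ≈-trans (*-comm _ _) (1ᴿ*x≈x 4ᴿ) ⟨
             4ᴿ * 1ᴿ                ≤⟨ *-monoˡ-≤ (ιℕ-nonNeg 4) 1≤E ⟩
             4ᴿ * E                 ≈⟨ ≈-trans (*-comm _ _) (*-congˡ (≈-sym 2²≈)) ⟩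
             E * (ιℕ 2 * ιℕ 2)      ∎))

-- The Hamming graph: metric and cube embeddings

module _ {A : Set} (_≟_ : DecidableEquality A) where

  mismatch≤1 : ∀ x y → mismatch _≟_ x y ℕ.≤ 1
  mismatch≤1 x y with does (x ≟ y)
  ... | true  = z≤n
  ... | false = ℕ.≤-refl

  hamming≤n : ∀ {n} (x y : Vec A n) → hamming _≟_ x y ℕ.≤ n
  hamming≤n []       []       = z≤n
  hamming≤n (x ∷ xs) (y ∷ ys) = ℕ.+-mono-≤ (mismatch≤1 x y) (hamming≤n xs ys)

  hamming≡0⇒≡ : ∀ {n} (x y : Vec A n) → hamming _≟_ x y ≡ 0 → x ≡ y
  hamming≡0⇒≡ [] [] _ = refl
  hamming≡0⇒≡ (x ∷ xs) (y ∷ ys) e with x ≟ y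
  ... | yes refl = cong (x ∷_) (hamming≡0⇒≡ xs ys e)
  ... | no _     = contradiction e λ ()

  hamming-++ : ∀ {m n} (u v : Vec A m) (x y : Vec A n) →
    hamming _≟_ (u ++ x) (v ++ y) ≡ hamming _≟_ u v ℕ.+ hamming _≟_ x y
  hamming-++ []      []      x y = refl
  hamming-++ (a ∷ u) (b ∷ v) x y =
    trans (cong (mismatch _≟_ a b ℕ.+_) (hamming-++ u v x y)) (sym (ℕ.+-assoc (mismatch _≟_ a b) _ _))

  hamming-cong : ∀ {n} (x y z : Vec A n) → (∀ j → lookup x j ≡ lookup y j) →
    hamming _≟_ x z ≡ hamming _≟_ y z
  hamming-cong [] [] [] _ = refl
  hamming-cong (x ∷ xs) (y ∷ ys) (z ∷ zs) e = cong₂ ℕ._+_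
    (cong (λ a → mismatch _≟_ a z) (e zero)) (hamming-cong xs ys zs (e ∘ suc))

  hamming-change : ∀ {n} i (x y z : Vec A n) → (∀ j → j ≢ i → lookup x j ≡ lookup y j) →
    hamming _≟_ x z ℕ.≤ suc (hamming _≟_ y z)
  hamming-change zero (x ∷ xs) (y ∷ ys) (z ∷ zs) e = ℕ.+-mono-≤ (mismatch≤1 x z)
    (ℕ.≤-trans (ℕ.≤-reflexive (hamming-cong xs ys zs λ j → e (suc j) λ ())) (ℕ.m≤n+m _ (mismatch _≟_ y z)))
  hamming-change (suc i) (x ∷ xs) (y ∷ ys) (z ∷ zs) e rewrite e zero (λ ()) =
    ℕ.≤-trans (ℕ.+-monoʳ-≤ (mismatch _≟_ y z)
      (hamming-change i xs ys zs λ j j≢i → e (suc j) (j≢i ∘ Fin.suc-injective)))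
      (ℕ.≤-reflexive (ℕ.+-suc (mismatch _≟_ y z) _))

-- Fills words up to the prescribed dimension; constant coordinates change neither Hamming distances
-- nor, the filler being `false`, sizes of subsets.
pad : ∀ {m n} → m ℕ.≤ n → Vec Bool m → Vec Bool n
pad z≤n       []      = replicate _ false
pad (s≤s m≤n) (b ∷ u) = b ∷ pad m≤n u

hamming-pad : ∀ {m n} (m≤n : m ℕ.≤ n) u v → hammingᵇ (pad m≤n u) (pad m≤n v) ≡ hammingᵇ u v
hamming-pad {n = n} z≤n [] []         = hamming-refl Bool._≟_ (replicate n false)
hamming-pad (s≤s m≤n) (a ∷ u) (b ∷ v) = cong (mismatch Bool._≟_ a b ℕ.+_) (hamming-pad m≤n u v)

module _ {q : ℕ} where

  hammingᶠ : ∀ {n} → Vec (Fin q) n → Vec (Fin q) n → ℕ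
  hammingᶠ = hamming Fin._≟_

  open Graph

  cons-path : ∀ {n} a {x y : Vec (Fin q) n} {ℓ} →
    Path (Hamming q n) x y ℓ → Path (Hamming q (suc n)) (a ∷ x) (a ∷ y) ℓ
  cons-path a stop = stop
  cons-path a (step (i , ne , eq) p) = step
    (suc i , ne , λ { zero _ → refl ; (suc j) j≢i → eq j (j≢i ∘ cong suc) }) (cons-path a p)

  hamming-path : ∀ {n} (x y : Vec (Fin q) n) → Path (Hamming q n) x y (hammingᶠ x y)
  hamming-path [] [] = stop
  hamming-path (a ∷ x) (b ∷ y) with a Fin.≟ b
  ... | yes refl = cons-path a (hamming-path x y)
  ... | no a≢b   = step (zero , a≢b , λ { zero 0≢0 → contradiction refl 0≢0 ; (suc j) _ → refl })
    (cons-path b (hamming-path x y))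

  hamming-shortest : ∀ {n} {x y : Vec (Fin q) n} {ℓ} → Path (Hamming q n) x y ℓ → hammingᶠ x y ℕ.≤ ℓ
  hamming-shortest {x = x} stop = ℕ.≤-reflexive (hamming-refl Fin._≟_ x)
  hamming-shortest {x = x} {z} (step {y = y} (i , _ , eq) p) =
    ℕ.≤-trans (hamming-change Fin._≟_ i x y z eq) (s≤s (hamming-shortest p))

  hamming-metric : ∀ n → IsShortestPathMetric (Hamming q n) hammingᶠ
  hamming-metric n x y = hamming-path x y , hamming-shortest

oneHot : ∀ {q} → Fin q → Vec Bool q
oneHot zero    = true ∷ replicate _ false
oneHot (suc i) = false ∷ oneHot i

oneHots : ∀ {q n} → Vec (Fin q) n → Vec Bool (n ℕ.* q)
oneHots []      = []
oneHots (a ∷ x) = oneHot a ++ oneHots x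

hamming-oneHot-replicate : ∀ {q} (b : Fin q) → hammingᵇ (replicate q false) (oneHot b) ≡ 1
hamming-oneHot-replicate {suc q} zero = cong suc (hamming-refl Bool._≟_ (replicate q false))
hamming-oneHot-replicate (suc b)      = hamming-oneHot-replicate b

hamming-replicate-oneHot : ∀ {q} (a : Fin q) → hammingᵇ (oneHot a) (replicate q false) ≡ 1
hamming-replicate-oneHot {suc q} zero = cong suc (hamming-refl Bool._≟_ (replicate q false))
hamming-replicate-oneHot (suc a)      = hamming-replicate-oneHot a

hamming-oneHot : ∀ {q} (a b : Fin q) →
  hammingᵇ (oneHot a) (oneHot b) ≡ mismatch Fin._≟_ a b ℕ.+ mismatch Fin._≟_ a b
hamming-oneHot {suc q} zero zero = hamming-refl Bool._≟_ (replicate q false)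
hamming-oneHot zero    (suc b) = cong suc (hamming-oneHot-replicate b)
hamming-oneHot (suc a) zero    = cong suc (hamming-replicate-oneHot a)
hamming-oneHot (suc a) (suc b) = hamming-oneHot a b

hamming-oneHots : ∀ {q n} (x y : Vec (Fin q) n) →
  hammingᵇ (oneHots x) (oneHots y) ≡ hammingᶠ x y ℕ.+ hammingᶠ x y
hamming-oneHots []      []      = refl
hamming-oneHots (a ∷ x) (b ∷ y) = trans (hamming-++ Bool._≟_ (oneHot a) (oneHot b) (oneHots x) (oneHots y))
  (trans (cong₂ ℕ._+_ (hamming-oneHot a b) (hamming-oneHots x y))
    (interchange (mismatch Fin._≟_ a b) (mismatch Fin._≟_ a b) (hammingᶠ x y) (hammingᶠ x y)))

n<q^n : ∀ {q} n → 2 ℕ.≤ q → n ℕ.< q ℕ.^ n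
n<q^n zero _ = s≤s z≤n
n<q^n {q} (suc n) 2≤q = begin-strict
  suc n                   <⟨ s≤s (s≤s (ℕ.m≤m+n n n)) ⟩
  suc (suc (n ℕ.+ n))     ≡⟨ cong suc (ℕ.+-suc n n) ⟨
  suc n ℕ.+ suc n         ≤⟨ ℕ.+-mono-≤ (n<q^n n 2≤q) (n<q^n n 2≤q) ⟩
  q ℕ.^ n ℕ.+ q ℕ.^ n     ≡⟨ cong (q ℕ.^ n ℕ.+_) (ℕ.+-identityʳ _) ⟨
  2 ℕ.* q ℕ.^ n           ≤⟨ ℕ.*-monoˡ-≤ (q ℕ.^ n) 2≤q ⟩
  q ℕ.* q ℕ.^ n           ∎
  where open ℕ.≤-Reasoning

-- The room for nq one-hot coordinates in dimension q^n. For a positive exponent one factor q splits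
-- off, and `n<q^n` covers the rest.
n*q≤q^n : ∀ {q} n → 2 ℕ.≤ q → n ℕ.* q ℕ.≤ q ℕ.^ n
n*q≤q^n zero    _ = z≤n
n*q≤q^n {q} (suc n) 2≤q = subst (ℕ._≤ q ℕ.* q ℕ.^ n) (ℕ.*-comm q (suc n)) (ℕ.*-monoʳ-≤ q (n<q^n n 2≤q))

module _ {q : ℕ} where

  digit : Bool → Fin (suc (suc q))
  digit false = zero
  digit true  = suc zero

  mismatch-digit : ∀ a b → mismatch Fin._≟_ (digit a) (digit b) ≡ mismatch Bool._≟_ a b
  mismatch-digit false false = refl
  mismatch-digit false true  = refl
  mismatch-digit true  false = refl
  mismatch-digit true  true  = refl

  hamming-digits : ∀ {n} (x y : Vec Bool n) → hammingᶠ (Vec.map digit x) (Vec.map digit y) ≡ hammingᵇ x y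
  hamming-digits []      []      = refl
  hamming-digits (a ∷ x) (b ∷ y) = cong₂ ℕ._+_ (mismatch-digit a b) (hamming-digits x y)

-- The metric of the Johnson graph

open Subset using (∣_∣)

∣∷∣-cong : ∀ {u v} b (p : Subset u) (p′ : Subset v) → ∣ p ∣ ≡ ∣ p′ ∣ → ∣ b ∷ p ∣ ≡ ∣ b ∷ p′ ∣
∣∷∣-cong true  _ _ = cong suc
∣∷∣-cong false _ _ = id

∣∷∣-suc : ∀ {u v} b (p : Subset u) (p′ : Subset v) → ∣ p ∣ ≡ suc ∣ p′ ∣ → ∣ b ∷ p ∣ ≡ suc ∣ b ∷ p′ ∣
∣∷∣-suc true  _ _ = cong suc
∣∷∣-suc false _ _ = id

-- First half of a geodesic step from p towards q: an element of p outside q is dropped. The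
-- equation p ∩ p⁻ ≡ p⁻ encodes p⁻ ⊆ p.
remove-outside : ∀ {v} (p q : Subset v) → ∣ p ∩ q ∣ ℕ.< ∣ p ∣ →
  Σ[ p⁻ ∈ Subset v ] suc ∣ p⁻ ∣ ≡ ∣ p ∣ × p ∩ p⁻ ≡ p⁻ × p⁻ ∩ q ≡ p ∩ q
remove-outside [] [] ()
remove-outside (true ∷ p) (false ∷ q) _ = false ∷ p , refl , cong (false ∷_) (∩-idem p) , refl
remove-outside (true ∷ p) (true ∷ q) (s≤s lt) with remove-outside p q lt
... | p⁻ , size , sub , meet = true ∷ p⁻ , cong suc size , cong (true ∷_) sub , cong (true ∷_) meet
remove-outside (false ∷ p) (b ∷ q) lt with remove-outside p q lt
... | p⁻ , size , sub , meet = false ∷ p⁻ , size , cong (false ∷_) sub , cong (false ∷_) meet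

-- Second half of the step: the element gained lies in q but not in p, so it leaves the intersection
-- with p alone and enlarges that with q.
add-inside : ∀ {v} (p p⁻ q : Subset v) → p ∩ p⁻ ≡ p⁻ → ∣ p ∩ q ∣ ℕ.< ∣ q ∣ →
  Σ[ p′ ∈ Subset v ] ∣ p′ ∣ ≡ suc ∣ p⁻ ∣ × ∣ p ∩ p′ ∣ ≡ ∣ p ∩ p⁻ ∣ × ∣ p′ ∩ q ∣ ≡ suc ∣ p⁻ ∩ q ∣
add-inside [] [] [] _ ()
add-inside (false ∷ p) (false ∷ p⁻) (true ∷ q) _ _ = true ∷ p⁻ , refl , refl , refl
add-inside (false ∷ p) (true ∷ p⁻) (_ ∷ q) () _
add-inside (true ∷ p) (b ∷ p⁻) (true ∷ q) sub (s≤s lt) with add-inside p p⁻ q (cong Vec.tail sub) lt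
... | p′ , size , meet-p , meet-q =
  b ∷ p′ , ∣∷∣-suc b p′ p⁻ size , ∣∷∣-cong b (p ∩ p′) (p ∩ p⁻) meet-p ,
  ∣∷∣-suc (b Bool.∧ true) (p′ ∩ q) (p⁻ ∩ q) meet-q
add-inside (a ∷ p) (b ∷ p⁻) (false ∷ q) sub lt with add-inside p p⁻ q (cong Vec.tail sub) (tail-< a lt)
  where
  tail-< : ∀ a → ∣ (a ∷ p) ∩ (false ∷ q) ∣ ℕ.< ∣ q ∣ → ∣ p ∩ q ∣ ℕ.< ∣ q ∣
  tail-< true  lt = lt
  tail-< false lt = lt
... | p′ , size , meet-p , meet-q =
  b ∷ p′ , ∣∷∣-suc b p′ p⁻ size , ∣∷∣-cong (a Bool.∧ b) (p ∩ p′) (p ∩ p⁻) meet-p ,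
  ∣∷∣-suc (b Bool.∧ false) (p′ ∩ q) (p⁻ ∩ q) meet-q

-- The sets p ∩ q and p ∩ r have their union inside p and their intersection inside q ∩ r. For sets
-- of equal size this is the triangle inequality.
∣∩∣-exchange : ∀ {v} (p q r : Subset v) → ∣ p ∩ r ∣ ℕ.+ ∣ p ∩ q ∣ ℕ.≤ ∣ q ∩ r ∣ ℕ.+ ∣ p ∣
∣∩∣-exchange [] [] [] = z≤n
∣∩∣-exchange (false ∷ p) (false ∷ q) (c ∷ r) = ∣∩∣-exchange p q r
∣∩∣-exchange (false ∷ p) (true ∷ q) (false ∷ r) = ∣∩∣-exchange p q r
∣∩∣-exchange (false ∷ p) (true ∷ q) (true ∷ r) = ℕ.m≤n⇒m≤1+n (∣∩∣-exchange p q r)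
∣∩∣-exchange (true ∷ p) (false ∷ q) (false ∷ r) =
  ℕ.≤-trans (ℕ.m≤n⇒m≤1+n (∣∩∣-exchange p q r)) (ℕ.≤-reflexive (sym (ℕ.+-suc _ _)))
∣∩∣-exchange (true ∷ p) (false ∷ q) (true ∷ r) =
  ℕ.≤-trans (s≤s (∣∩∣-exchange p q r)) (ℕ.≤-reflexive (sym (ℕ.+-suc _ _)))
∣∩∣-exchange (true ∷ p) (true ∷ q) (false ∷ r) =
  ℕ.≤-trans (ℕ.≤-reflexive (ℕ.+-suc _ _))
    (ℕ.≤-trans (s≤s (∣∩∣-exchange p q r)) (ℕ.≤-reflexive (sym (ℕ.+-suc _ _))))
∣∩∣-exchange (true ∷ p) (true ∷ q) (true ∷ r) =
  s≤s (ℕ.≤-trans (ℕ.≤-reflexive (ℕ.+-suc _ _))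
    (ℕ.≤-trans (s≤s (∣∩∣-exchange p q r)) (ℕ.≤-reflexive (sym (ℕ.+-suc _ _)))))

-- Characteristic vectors differ exactly on the symmetric difference.
hamming-∩ : ∀ {v} (p q : Subset v) → ∣ p ∣ ℕ.+ ∣ q ∣ ≡ hammingᵇ p q ℕ.+ (∣ p ∩ q ∣ ℕ.+ ∣ p ∩ q ∣)
hamming-∩ [] [] = refl
hamming-∩ (false ∷ p) (false ∷ q) = hamming-∩ p q
hamming-∩ (false ∷ p) (true ∷ q)  = trans (ℕ.+-suc _ _) (cong suc (hamming-∩ p q))
hamming-∩ (true ∷ p)  (false ∷ q) = cong suc (hamming-∩ p q)
hamming-∩ (true ∷ p)  (true ∷ q)  = begin
  suc (∣ p ∣ ℕ.+ suc ∣ q ∣)          ≡⟨ cong suc (ℕ.+-suc ∣ p ∣ ∣ q ∣) ⟩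
  suc (suc (∣ p ∣ ℕ.+ ∣ q ∣))        ≡⟨ cong (λ e → suc (suc e)) (hamming-∩ p q) ⟩
  suc (suc (h ℕ.+ (c ℕ.+ c)))        ≡⟨ cong suc (ℕ.+-suc h (c ℕ.+ c)) ⟨
  suc (h ℕ.+ suc (c ℕ.+ c))          ≡⟨ ℕ.+-suc h (suc (c ℕ.+ c)) ⟨
  h ℕ.+ suc (suc (c ℕ.+ c))          ≡⟨ cong (λ e → h ℕ.+ suc e) (ℕ.+-suc c c) ⟨
  h ℕ.+ (suc c ℕ.+ suc c)            ∎
  where
  open ≡-Reasoning
  h c : ℕ
  h = hammingᵇ p q
  c = ∣ p ∩ q ∣

module _ {v n : ℕ} where

  open Graph (Johnson v n)

  johnson : n -subsetsOf v → n -subsetsOf v → ℕ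
  johnson (p , _) (q , _) = n ℕ.∸ ∣ p ∩ q ∣

  ∣∩∣≤n : ∀ ((p , _) (q , _) : n -subsetsOf v) → ∣ p ∩ q ∣ ℕ.≤ n
  ∣∩∣≤n (p , ∣p∣≡n) (q , _) = subst (∣ p ∩ q ∣ ℕ.≤_) ∣p∣≡n (∣p∩q∣≤∣p∣ p q)

  hamming-johnson : ∀ s t → hammingᵇ (proj₁ s) (proj₁ t) ≡ johnson s t ℕ.+ johnson s t
  hamming-johnson s@(p , ∣p∣≡n) t@(q , ∣q∣≡n) = ℕ.+-cancelʳ-≡ (c ℕ.+ c) (hammingᵇ p q) (j ℕ.+ j) (begin
    hammingᵇ p q ℕ.+ (c ℕ.+ c)    ≡⟨ hamming-∩ p q ⟨
    ∣ p ∣ ℕ.+ ∣ q ∣               ≡⟨ cong₂ ℕ._+_ ∣p∣≡n ∣q∣≡n ⟩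
    n ℕ.+ n                       ≡⟨ cong₂ ℕ._+_ (ℕ.m∸n+n≡m c≤n) (ℕ.m∸n+n≡m c≤n) ⟨
    (j ℕ.+ c) ℕ.+ (j ℕ.+ c)       ≡⟨ interchange j c j c ⟩
    (j ℕ.+ j) ℕ.+ (c ℕ.+ c)       ∎)
    where
    open ≡-Reasoning
    c j : ℕ
    c = ∣ p ∩ q ∣
    j = johnson s t
    c≤n : c ℕ.≤ n
    c≤n = ∣∩∣≤n s t

  exchange : ∀ ((p , _) (q , _) : n -subsetsOf v) → ∣ p ∩ q ∣ ℕ.< n →
    Σ[ (p′ , _) ∈ n -subsetsOf v ] suc ∣ p ∩ p′ ∣ ≡ n × ∣ p′ ∩ q ∣ ≡ suc ∣ p ∩ q ∣
  exchange (p , ∣p∣≡n) (q , ∣q∣≡n) lt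
    with remove-outside p q (subst (∣ p ∩ q ∣ ℕ.<_) (sym ∣p∣≡n) lt)
  ... | p⁻ , size⁻ , sub , meet⁻ with add-inside p p⁻ q sub (subst (∣ p ∩ q ∣ ℕ.<_) (sym ∣q∣≡n) lt)
  ... | p′ , size , meet-p , meet-q =
    (p′ , trans size (trans size⁻ ∣p∣≡n)) ,
    trans (cong suc (trans meet-p (cong ∣_∣ sub))) (trans size⁻ ∣p∣≡n) ,
    trans meet-q (cong (suc ∘ ∣_∣) meet⁻)

  johnson-path : ∀ e s t → e ℕ.+ ∣ proj₁ s ∩ proj₁ t ∣ ≡ n → Path s t e
  johnson-path zero s@(p , _) t@(q , _) eq = subst (λ u → Path s u 0)
    (subsets-≡ (hamming≡0⇒≡ Bool._≟_ p q (trans (hamming-johnson s t) (cong₂ ℕ._+_ j≡0 j≡0)))) stop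
    where
    j≡0 : johnson s t ≡ 0
    j≡0 = ℕ.m≤n⇒m∸n≡0 (ℕ.≤-reflexive (sym eq))
  johnson-path (suc e) s@(p , _) t@(q , _) eq
    with exchange s t (ℕ.≤-trans (s≤s (ℕ.m≤n+m ∣ p ∩ q ∣ e)) (ℕ.≤-reflexive eq))
  ... | u , adj , closer = step adj (johnson-path e u t
    (trans (cong (e ℕ.+_) closer) (trans (ℕ.+-suc e _) eq)))

  -- Passing to a neighbour p′ raises the intersection with q by at most one, by `∣∩∣-exchange` and
  -- |p ∩ p′| = n - 1. The additive form avoids truncated subtraction in the induction.
  johnson-shortest : ∀ {s t ℓ} → Path s t ℓ → n ℕ.≤ ∣ proj₁ s ∩ proj₁ t ∣ ℕ.+ ℓ
  johnson-shortest {p , ∣p∣≡n} stop = ℕ.≤-reflexive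
    (sym (trans (ℕ.+-identityʳ _) (trans (cong ∣_∣ (∩-idem p)) ∣p∣≡n)))
  johnson-shortest {p , _} {q , _} {suc ℓ} (step {y = p′ , ∣p′∣≡n} adj path) = begin
    n                           ≤⟨ johnson-shortest path ⟩
    ∣ p′ ∩ q ∣ ℕ.+ ℓ            ≤⟨ ℕ.+-monoˡ-≤ ℓ (ℕ.+-cancelʳ-≤ ∣ p′ ∩ p ∣ ∣ p′ ∩ q ∣ (suc ∣ p ∩ q ∣) (begin
      ∣ p′ ∩ q ∣ ℕ.+ ∣ p′ ∩ p ∣      ≤⟨ ∣∩∣-exchange p′ p q ⟩
      ∣ p ∩ q ∣ ℕ.+ ∣ p′ ∣           ≡⟨ cong (∣ p ∩ q ∣ ℕ.+_)
                                          (trans ∣p′∣≡n (trans (sym adj) (cong (suc ∘ ∣_∣) (∩-comm p p′)))) ⟩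
      ∣ p ∩ q ∣ ℕ.+ suc ∣ p′ ∩ p ∣   ≡⟨ ℕ.+-suc _ _ ⟩
      suc ∣ p ∩ q ∣ ℕ.+ ∣ p′ ∩ p ∣   ∎)) ⟩
    suc (∣ p ∩ q ∣ ℕ.+ ℓ)       ≡⟨ ℕ.+-suc _ ℓ ⟨
    ∣ p ∩ q ∣ ℕ.+ suc ℓ         ∎
    where open ℕ.≤-Reasoning

  johnson-metric : IsShortestPathMetric johnson
  johnson-metric s t =
    johnson-path (johnson s t) s t (ℕ.m∸n+n≡m (∣∩∣≤n s t)) ,
    λ path → ℕ.m≤n+o⇒m∸n≤o n ∣ proj₁ s ∩ proj₁ t ∣ (johnson-shortest path)

-- Cubes in the Johnson graph and room for characteristic vectors

-- Choosing one element from each of n disjoint pairs embeds the n-cube isometrically.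
twins : ∀ {n} → Vec Bool n → Subset (n ℕ.* 2)
twins []      = []
twins (b ∷ x) = b ∷ not b ∷ twins x

∣twins∣ : ∀ {n} (x : Vec Bool n) → ∣ twins x ∣ ≡ n
∣twins∣ []          = refl
∣twins∣ (false ∷ x) = cong suc (∣twins∣ x)
∣twins∣ (true ∷ x)  = cong suc (∣twins∣ x)

∣twins∩twins∣ : ∀ {n} (x y : Vec Bool n) → hammingᵇ x y ℕ.+ ∣ twins x ∩ twins y ∣ ≡ n
∣twins∩twins∣ []          []          = refl
∣twins∩twins∣ (false ∷ x) (false ∷ y) = trans (ℕ.+-suc (hammingᵇ x y) _) (cong suc (∣twins∩twins∣ x y))
∣twins∩twins∣ (false ∷ x) (true ∷ y)  = cong suc (∣twins∩twins∣ x y)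
∣twins∩twins∣ (true ∷ x)  (false ∷ y) = cong suc (∣twins∩twins∣ x y)
∣twins∩twins∣ (true ∷ x)  (true ∷ y)  = trans (ℕ.+-suc (hammingᵇ x y) _) (cong suc (∣twins∩twins∣ x y))

∣replicate∣ : ∀ n → ∣ replicate n false ∣ ≡ 0
∣replicate∣ zero    = refl
∣replicate∣ (suc n) = ∣replicate∣ n

∣pad∣ : ∀ {m n} (m≤n : m ℕ.≤ n) (p : Subset m) → ∣ pad m≤n p ∣ ≡ ∣ p ∣
∣pad∣ {n = n} z≤n []    = ∣replicate∣ n
∣pad∣ (s≤s m≤n) (b ∷ p) = ∣∷∣-cong b (pad m≤n p) p (∣pad∣ m≤n p)

pad-∩ : ∀ {m n} (m≤n : m ℕ.≤ n) (p q : Subset m) → pad m≤n p ∩ pad m≤n q ≡ pad m≤n (p ∩ q)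
pad-∩ z≤n       []      []      = ∩-idem _
pad-∩ (s≤s m≤n) (a ∷ p) (b ∷ q) = cong (a Bool.∧ b ∷_) (pad-∩ m≤n p q)

twinSubset : ∀ {v n} → n ℕ.* 2 ℕ.≤ v → Vec Bool n → n -subsetsOf v
twinSubset le x = pad le (twins x) , trans (∣pad∣ le (twins x)) (∣twins∣ x)

johnson-twins : ∀ {v n} (le : n ℕ.* 2 ℕ.≤ v) (x y : Vec Bool n) →
  johnson (twinSubset {v} {n} le x) (twinSubset {v} {n} le y) ≡ hammingᵇ x y
johnson-twins {n = n} le x y = trans
  (cong₂ ℕ._∸_ (sym (∣twins∩twins∣ x y))
    (trans (cong ∣_∣ (pad-∩ le (twins x) (twins y))) (∣pad∣ le (twins x ∩ twins y))))
  (ℕ.m+n∸n≡m (hammingᵇ x y) ∣ twins x ∩ twins y ∣)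

1≤binomial : ∀ v n → n ℕ.≤ v → 1 ℕ.≤ binomial v n
1≤binomial v       zero    _         = ℕ.≤-refl
1≤binomial (suc v) (suc n) (s≤s n≤v) = ℕ.≤-trans (1≤binomial v n n≤v) (ℕ.m≤m+n (binomial v n) _)

-- The room for characteristic vectors in dimension C(v, n). In Pascal's rule one summand is large
-- by induction and the other is at least 1; the roles swap next to the diagonal, where the second
-- summand is C(v, v).
v≤binomial : ∀ v n → suc n ℕ.< v → v ℕ.≤ binomial v (suc n)
v≤binomial (suc v) n (s≤s n<v) with ℕ.m≤n⇒m<n∨m≡n n<v
v≤binomial (suc v) n _ | inj₁ 1+n<v =
  ℕ.+-mono-≤ (1≤binomial v n (ℕ.<⇒≤ (ℕ.<-trans (ℕ.n<1+n n) 1+n<v))) (v≤binomial v n 1+n<v)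
v≤binomial (suc (suc zero)) zero _ | inj₂ refl = ℕ.≤-refl
v≤binomial (suc v@(suc (suc n))) (suc n) _ | inj₂ refl = subst (ℕ._≤ binomial (suc v) v) (ℕ.+-comm v 1)
  (ℕ.+-mono-≤ (v≤binomial v n (ℕ.n<1+n (suc n))) (1≤binomial v v ℕ.≤-refl))

-- The reals as an instance, and least distortions as roots

ℝ-orderedAlgebra : OrderedAlgebra
ℝ-orderedAlgebra = record
  { commutativeRing = ℝ-commutativeRing
  ; _≤_ = _≤ᴿ_
  ; isPartialOrder = record
    { isPreorder = record
      { isEquivalence = CommutativeRing.isEquivalence ℝ-commutativeRing
      ; reflexive = proj₁
      ; trans = λ {x} {y} {z} → ≤ᴿ-trans x y z }
    ; antisym = _,_ }
  ; ι = fromℚ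
  ; ι-+ = λ p q → ≃-pointwise (fromℚ (p ℚ.+ q)) (fromℚ p +ᴿ fromℚ q) λ _ → refl
  ; ι-* = λ p q → ≃-pointwise (fromℚ (p ℚ.* q)) (fromℚ p *ᴿ fromℚ q) λ _ → refl
  ; ι-neg = λ p → ≃-pointwise (fromℚ (ℚ.- p)) (-ᴿ fromℚ p) λ _ → refl
  ; ι-0 = ≃-pointwise (fromℚ 0ℚ) 0ᴿ λ _ → refl
  ; ι-1 = ≃-pointwise (fromℚ 1ℚ) (fromℕ 1) λ _ → refl
  ; ι-mono-≤ = λ {p} {q} p≤q → ≤-pointwise (fromℚ p) (fromℚ q) λ _ → p≤q
  ; +-mono-≤ = λ {x} {y} {u} {v} → +ᴿ-mono-≤ x y u v
  ; *-nonNeg = λ {x} {y} → *ᴿ-nonNeg x y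
  ; square-nonNeg = λ x → ≤-pointwise 0ᴿ (x *ᴿ x) λ n → 0≤p² (seq x n)
  ; *-cancelˡ-≤ = λ {c} {x} {y} → *ᴿ-cancelˡ-≤ c x y
  ; square-cancel-≤ = λ {x} {y} → square-cancel-≤ᴿ x y }

module R = Theory ℝ-orderedAlgebra

foldr≃sum : ∀ {N} (f g : Vector ℝ N) → (∀ i → f i ≃ᴿ g i) → foldr _+ᴿ_ 0ᴿ f ≃ᴿ R.sum g
foldr≃sum {zero}  f g f≃g = ≃-pointwise 0ᴿ 0ᴿ λ _ → refl
foldr≃sum {suc N} f g f≃g = +ᴿ-cong (f zero) (g zero) (foldr _+ᴿ_ 0ᴿ (f ∘ suc)) (R.sum (g ∘ suc))
  (f≃g zero) (foldr≃sum (f ∘ suc) (g ∘ suc) (f≃g ∘ suc))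

normSquare : ∀ {N} → Vector ℝ N → Vector ℝ N → ℝ
normSquare u v = foldr _+ᴿ_ 0ᴿ (λ i → (u i -ᴿ v i) *ᴿ (u i -ᴿ v i))

-- The two sides agree by definition, but comparing them at type ℝ would also
-- compare their Cauchy proofs, which is infeasible.
normSquare≃dist² : ∀ {N} (u v : Vector ℝ N) → normSquare u v ≃ᴿ R.dist² u v
normSquare≃dist² u v = foldr≃sum (λ i → (u i -ᴿ v i) *ᴿ (u i -ᴿ v i)) (R.squaredDifference u v)
  λ i → ≃-pointwise ((u i -ᴿ v i) *ᴿ (u i -ᴿ v i)) (R.squaredDifference u v i) λ _ → refl

√-square-≃ : ∀ S S′ → S ≃ᴿ S′ → 0ᴿ ≤ᴿ S′ → √ S *ᴿ √ S ≃ᴿ S′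
√-square-≃ S S′ S≃S′ 0≤S′ = ≃ᴿ-trans (√ S *ᴿ √ S) S S′
  (√-square S (≤ᴿ-trans 0ᴿ S′ S 0≤S′ (proj₂ S≃S′))) S≃S′

√-least : ∀ E D → 0ᴿ ≤ᴿ E → 0ᴿ ≤ᴿ D → E ≤ᴿ D *ᴿ D → √ E ≤ᴿ D
√-least E D 0≤E 0≤D E≤D² = square-cancel-≤ᴿ (√ E) D 0≤D
  (≤ᴿ-trans (√ E *ᴿ √ E) E (D *ᴿ D) (proj₁ (√-square E 0≤E)) E≤D²)

-- Norms, distances and the competing D are all nonnegative, so bounds may be squared and unsquared;
-- in particular E ≤ D² gives √E ≤ D only because D ≥ 0.
leastDistortion-√ : ∀ {X : Set} {N} (d : X → X → ℕ) (E : ℝ) → 0ᴿ ≤ᴿ E →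
  Σ[ ϱ ∈ (X → Vector ℝ N) ] R.HasSquareDistortion d ϱ E →
  (∀ (ϱ : X → Vector ℝ N) E′ → 0ᴿ ≤ᴿ E′ → R.HasSquareDistortion d ϱ E′ → E ≤ᴿ E′) →
  IsLeastDistortion N (λ x y → fromℕ (d x y)) (√ E)
leastDistortion-√ {X} {N} d E 0≤E (ϱ , bounds) least =
  0≤√ E ,
  (ϱ , λ x y → R.square-bounds⇒root-bounds {fromℕ (d x y)} {R.dist² (ϱ x) (ϱ y)} {norm ϱ x y} {E} {√ E}
    (R.ιℕ-nonNeg (d x y)) (0≤norm ϱ x y) (0≤√ E) (norm² ϱ x y) (√-square E 0≤E) (bounds x y)) ,
  λ D 0≤D (ϱ′ , h) → √-least E D 0≤E 0≤D (least ϱ′ (D *ᴿ D) (*ᴿ-nonNeg D D 0≤D 0≤D)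
    λ x y → R.root-bounds⇒square-bounds {fromℕ (d x y)} {R.dist² (ϱ′ x) (ϱ′ y)} {norm ϱ′ x y} {D}
      (R.ιℕ-nonNeg (d x y)) (0≤norm ϱ′ x y) (norm² ϱ′ x y) (h x y))
  where
  norm : (X → Vector ℝ N) → X → X → ℝ
  norm ϱ x y = √ (normSquare (ϱ x) (ϱ y))
  0≤norm : ∀ ϱ x y → 0ᴿ ≤ᴿ norm ϱ x y
  0≤norm ϱ x y = 0≤√ (normSquare (ϱ x) (ϱ y))
  norm² : ∀ ϱ x y → norm ϱ x y *ᴿ norm ϱ x y ≃ᴿ R.dist² (ϱ x) (ϱ y)
  norm² ϱ x y = √-square-≃ (normSquare (ϱ x) (ϱ y)) (R.dist² (ϱ x) (ϱ y))
    (normSquare≃dist² (ϱ x) (ϱ y)) (R.dist²-nonNeg (ϱ x) (ϱ y))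

leastDistortion-cube : ∀ {X : Set} {N} (d : X → X → ℕ) n (φ : X → Vec Bool N) →
  (∀ x y → hammingᵇ (φ x) (φ y) ≡ d x y ℕ.+ d x y) → (∀ x y → d x y ℕ.≤ n) →
  (γ : Vec Bool n → X) → (∀ x y → d (γ x) (γ y) ≡ hammingᵇ x y) →
  IsLeastDistortion N (λ x y → fromℕ (d x y)) (√ (fromℕ n))
leastDistortion-cube d n φ φ-isometric d≤n γ γ-isometric = leastDistortion-√ d (fromℕ n) (R.ιℕ-nonNeg n)
  (R.binaryEmbedding-distortion d n φ φ-isometric d≤n {c}
    (√-square n/2 (*ᴿ-nonNeg (fromℚ ½) (fromℕ n) 0≤½ᴿ (R.ιℕ-nonNeg n))))
  λ ϱ E 0≤E → R.isometricCube-distortion d n γ γ-isometric {ϱ} {E} 0≤E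
  where
  n/2 c : ℝ
  n/2 = fromℚ ½ *ᴿ fromℕ n
  c = √ n/2
  0≤½ᴿ : 0ᴿ ≤ᴿ fromℚ ½
  0≤½ᴿ = ≤-pointwise 0ᴿ (fromℚ ½) λ _ → 0≤½

-- The three families

c₂-Hamming : ∀ q n → 2 ℕ.≤ q → c₂[ Hamming q n ]≃ √ (fromℕ n)
c₂-Hamming (suc zero) n (s≤s ())
c₂-Hamming (suc (suc q)) n 2≤q = hammingᶠ , hamming-metric n ,
  leastDistortion-cube hammingᶠ n (pad (n*q≤q^n n 2≤q) ∘ oneHots)
    (λ x y → trans (hamming-pad (n*q≤q^n n 2≤q) (oneHots x) (oneHots y)) (hamming-oneHots x y))
    (hamming≤n Fin._≟_) (Vec.map digit) hamming-digits

open import Data.Nat.Combinatorics using (_C_)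

c₂-Johnson : ∀ v n → 2 ℕ.* n ℕ.≤ v → c₂[ Johnson v n ]≃ √ (fromℕ n)
c₂-Johnson v n 2n≤v = johnson , johnson-metric ,
  leastDistortion-cube johnson n (proj₁ (features n 2n≤v)) (proj₂ (features n 2n≤v))
    (λ s t → ℕ.m∸n≤m n ∣ proj₁ s ∩ proj₁ t ∣)
    (twinSubset n2≤v) (johnson-twins n2≤v)
  where
  n2≤v : n ℕ.* 2 ℕ.≤ v
  n2≤v = subst (ℕ._≤ v) (ℕ.*-comm 2 n) 2n≤v
  features : ∀ n → 2 ℕ.* n ℕ.≤ v → Σ[ φ ∈ (n -subsetsOf v → Vec Bool (v C n)) ]
    (∀ s t → hammingᵇ (φ s) (φ t) ≡ johnson s t ℕ.+ johnson s t)
  -- With n = 0 there is a single coordinate, in which v bits need not fit; any constant map serves,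
  -- all distances being 0.
  features zero _ = (λ _ → replicate (v C 0) false) , λ s t →
    trans (hamming-refl Bool._≟_ (replicate (v C 0) false))
    (sym (cong (λ e → e ℕ.+ e) (ℕ.0∸n≡0 ∣ proj₁ s ∩ proj₁ t ∣)))
  features (suc n) le = pad v≤C ∘ proj₁ , λ s t →
    trans (hamming-pad v≤C (proj₁ s) (proj₁ t)) (hamming-johnson s t)
    where
    v≤C : v ℕ.≤ v C suc n
    v≤C = subst (v ℕ.≤_) (binomial≡C v (suc n)) (v≤binomial v n
      (ℕ.≤-trans (s≤s (ℕ.≤-trans (s≤s (ℕ.m≤m+n n (n ℕ.+ 0))) (ℕ.≤-reflexive (sym (ℕ.+-suc n (n ℕ.+ 0)))))) le))

-- ρ, num and den are variables here because comparing the compound terms they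
-- stand for at type ℝ would compare Cauchy proofs.
c₂-stronglyRegular : (G : Graph) (ν k l m : ℕ) → Graph.order G ≡ ν →
  IsStronglyRegular G ν k l m → HasDiameter G 2 → ∀ ρ num den →
  let ν′ = fromℕ ν
      w = fromℕ l -ᴿ fromℕ m
      Δ = w *ᴿ w +ᴿ fromℕ 4 *ᴿ (fromℕ k -ᴿ fromℕ m)
      r = fromℚ ½ *ᴿ (w +ᴿ ρ)
  in 0ᴿ ≤ᴿ ρ → (0ᴿ ≤ᴿ Δ → ρ *ᴿ ρ ≃ᴿ Δ) →
    num ≃ᴿ fromℕ 4 *ᴿ (ν′ -ᴿ fromℕ k -ᴿ fromℕ 1) *ᴿ (fromℕ k -ᴿ r) →
    den ≃ᴿ fromℕ k *ᴿ (ν′ -ᴿ fromℕ k +ᴿ r) →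
    Σ[ 0<den ∈ 0ᴿ <ᴿ den ] c₂[ G ]≃ √ (num *ᴿ inv den 0<den)
c₂-stronglyRegular G ν k l m refl srg (d , metric , d≤2 , x₀ , z₀ , d₀≡2) ρ num den 0≤ρ ρ² num≃ den≃ =
  0<den , d , metric , leastDistortion-√ d E
    (R.quotient-nonNeg {den} {inv den 0<den} {num} 1≤den (inv-inverse den 0<den)
      (≤ᴿ-trans 0ᴿ S.numerator num S.0≤spectralNumerator (proj₂ num≃)))
    (S.spectralEmbedding-distortion {t} {E} t-scale E-def)
    λ ϱ E′ _ → S.quotient≤ ϱ {E} {E′} E-def
  where
  module T = R.StronglyRegularGraph G srg d metric d≤2 {x₀} {z₀} d₀≡2
  -- The equation ρ² ≃ Δ is available only for Δ ≥ 0, since `√` truncates negative arguments; here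
  -- this follows from μ ≤ k.
  module S = T.Spectrum ρ 0≤ρ (ρ² T.0≤discriminant)
  1≤den : fromℕ 1 ≤ᴿ den
  1≤den = ≤ᴿ-trans (fromℕ 1) S.denominator den S.1≤denominator (proj₂ den≃)
  0<den : 0ᴿ <ᴿ den
  0<den = 1≤⇒0< den 1≤den
  E P u t : ℝ
  E = num *ᴿ inv den 0<den
  E-def : S.denominator *ᴿ E ≃ᴿ S.numerator
  E-def = ≃ᴿ-trans (S.denominator *ᴿ E) (den *ᴿ E) S.numerator
    (*ᴿ-congˡ S.denominator den E (proj₂ den≃ , proj₁ den≃))
    (≃ᴿ-trans (den *ᴿ E) num S.numerator
      (R.*-quotient {den} {inv den 0<den} num (inv-inverse den 0<den)) num≃)
  P = S.spectralScale *ᴿ -ᴿ S.s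
  0<P : 0ᴿ <ᴿ P
  0<P = 1≤⇒0< P S.1≤spectralScale*-s
  -- The rows of nonadjacent vertices have squared distance P, so t² = 4/P brings them to 4 = 2².
  u = fromℕ 4 *ᴿ inv P 0<P
  t = √ u
  t-scale : t *ᴿ t *ᴿ P ≃ᴿ fromℕ 4
  t-scale = ≃ᴿ-trans (t *ᴿ t *ᴿ P) (u *ᴿ P) (fromℕ 4)
    (*ᴿ-congˡ (t *ᴿ t) u P (√-square u
      (R.quotient-nonNeg {P} {inv P 0<P} {fromℕ 4} S.1≤spectralScale*-s (inv-inverse P 0<P) (R.ιℕ-nonNeg 4))))
    (≃ᴿ-trans (u *ᴿ P) (P *ᴿ u) (fromℕ 4) (*ᴿ-comm u P)
      (R.*-quotient {P} {inv P 0<P} (fromℕ 4) (inv-inverse P 0<P)))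

open import Data.Nat using (_≤_; _*_)

theorem2p5 :
      (∀ q n → 2 ≤ q → c₂[ Hamming q n ]≃ √ (fromℕ n))
    × (∀ v n → 2 * n ≤ v → c₂[ Johnson v n ]≃ √ (fromℕ n))
    × ((G : Graph) (ν k l m : ℕ) → IsStronglyRegular G ν k l m → HasDiameter G 2 →
        let ν′ = fromℕ ν
            k′ = fromℕ k
            λ′ = fromℕ l
            μ′ = fromℕ m
            Δ = (λ′ -ᴿ μ′) *ᴿ (λ′ -ᴿ μ′) +ᴿ fromℕ 4 *ᴿ (k′ -ᴿ μ′)
            r = fromℚ ½ *ᴿ (λ′ -ᴿ μ′ +ᴿ √ Δ)
            numerator = fromℕ 4 *ᴿ (ν′ -ᴿ k′ -ᴿ fromℕ 1) *ᴿ (k′ -ᴿ r)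
            denominator = k′ *ᴿ (ν′ -ᴿ k′ +ᴿ r)
        in Σ[ 0<denominator ∈ fromℕ 0 <ᴿ denominator ]
             c₂[ G ]≃ √ (numerator *ᴿ inv denominator 0<denominator))
theorem2p5 = c₂-Hamming , c₂-Johnson , λ G ν k l m srg diameter →
  let ν′ = fromℕ ν
      k′ = fromℕ k
      λ′ = fromℕ l
      μ′ = fromℕ m
      Δ = (λ′ -ᴿ μ′) *ᴿ (λ′ -ᴿ μ′) +ᴿ fromℕ 4 *ᴿ (k′ -ᴿ μ′)
      r = fromℚ ½ *ᴿ (λ′ -ᴿ μ′ +ᴿ √ Δ)
      numerator = fromℕ 4 *ᴿ (ν′ -ᴿ k′ -ᴿ fromℕ 1) *ᴿ (k′ -ᴿ r)
      denominator = k′ *ᴿ (ν′ -ᴿ k′ +ᴿ r)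
  in c₂-stronglyRegular G ν k l m (IsStronglyRegular.order≡ν srg) srg diameter (√ Δ) numerator denominator
       (0≤√ Δ) (√-square Δ)
       (≃-pointwise numerator numerator λ _ → refl) (≃-pointwise denominator denominator λ _ → refl)
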